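{- Let $q$ be a prime power with $q\equiv 1\pmod 4$ and $q\not\equiv 1\pmod 3$. For every $x\in\mathbb{F}_{q^3}^{*}$, \[ \kappa_{1}(x) - \kappa_{ -1}(x) = q\cdot \chi_{2}(x)\,\chi_{2}(\mathrm{T}(x)). \]
   Context: $\mathbb{E}=\mathbb{F}_{q^3}$, $\mathrm{T}(x)=x+x^q+x^{q^2}$ (trace to $\mathbb{F}_q$). Fix a primitive element $\alpha$ of $\mathbb{E}$ and put $\mu=\alpha^{q-1}$ (of order $q^2+q+1$). The quartic character $\chi_4$ of $\mathbb{E}$ is defined by $\chi_4(0)=0$, $\chi_4(\alpha^n)=\mathrm{i}^n$ with $\mathrm{i}=\sqrt{ -1}\in\mathbb{C}$; $\overline{\chi_4}$ is its complex conjugate; $\chi_2=\chi_4^2$ is the quadratic character of $\mathbb{E}$ ($\chi_2(0)=0$). For $z\in\{1,\mathrm{i},-1,-\mathrm{i}\}$ and $x\in\mathbb{E}^*$, $\kappa_z(x)$ is the number of $i$ with $0\le i<q^2+q+1$ such that $\chi_4(\mathrm{T}(\mu^ix))\,\overline{\chi_4}(\mathrm{T}(\mu^{ -i}x))=z$. -}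

module Defs where

open import Level using (0ℓ)
open import Data.Nat using (ℕ; zero; suc; _+_; _*_; _^_; _%_)
open import Data.Nat.Primality using (Prime)
open import Data.Fin using (Fin) renaming (zero to f0; suc to fs)
open import Data.Fin.Properties using () renaming (_≟_ to _≟F_)
open import Data.Bool using (Bool; true; false)
open import Data.List using (List; length; filter; upTo)
open import Data.Maybe using (Maybe; just; nothing)
open import Data.Product using (Σ; _×_; ∃-syntax)
open import Data.Integer using (ℤ) renaming (+_ to ℤ+; -_ to ℤ-)
open import Relation.Nullary using (Dec; yes; no; ¬_; does)
open import Relation.Binary.PropositionalEquality using (_≡_; _≢_; refl; cong)
open import Relation.Binary.Definitions using (DecidableEquality)
open import Algebra.Structures using (IsCommutativeRing)
open import Function.Bundles using (_↔_)

IsPrimePower : ℕ → Set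
IsPrimePower q = ∃[ p ] ∃[ k ] (Prime p × q ≡ p ^ suc k)

record FiniteField (n : ℕ) : Set₁ where
  infixl 6 _+ᶠ_
  infixl 7 _*ᶠ_
  field
    Carrier   : Set
    0ᶠ 1ᶠ     : Carrier
    _+ᶠ_ _*ᶠ_ : Carrier → Carrier → Carrier
    -ᶠ_       : Carrier → Carrier
    _⁻¹       : Carrier → Carrier
    isCommutativeRing : IsCommutativeRing _≡_ _+ᶠ_ _*ᶠ_ -ᶠ_ 0ᶠ 1ᶠ
    0≢1       : 0ᶠ ≢ 1ᶠ
    inverseʳ  : ∀ x → x ≢ 0ᶠ → x *ᶠ (x ⁻¹) ≡ 1ᶠ
    _≟_       : DecidableEquality Carrier
    card      : Fin n ↔ Carrier

  _^ᶠ_ : Carrier → ℕ → Carrier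
  x ^ᶠ zero  = 1ᶠ
  x ^ᶠ suc m = x *ᶠ (x ^ᶠ m)

  IsPrimitive : Carrier → Set
  IsPrimitive α = ∀ y → y ≢ 0ᶠ → ∃[ m ] α ^ᶠ m ≡ y

-- The values of a quartic character together with 0:  zero, or i^k (k ∈ Fin 4).
data C4₀ : Set where
  czero : C4₀
  ipow  : Fin 4 → C4₀

_≟C_ : DecidableEquality C4₀
czero  ≟C czero  = yes refl
czero  ≟C ipow _ = no (λ ())
ipow _ ≟C czero  = no (λ ())
ipow a ≟C ipow b with a ≟F b
... | yes refl = yes refl
... | no a≢b   = no (λ { refl → a≢b refl })

suc₄ : Fin 4 → Fin 4
suc₄ f0 = fs f0
suc₄ (fs f0) = fs (fs f0)
suc₄ (fs (fs f0)) = fs (fs (fs f0))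
suc₄ (fs (fs (fs f0))) = f0

_+₄_ : Fin 4 → Fin 4 → Fin 4
f0 +₄ b = b
fs f0 +₄ b = suc₄ b
fs (fs f0) +₄ b = suc₄ (suc₄ b)
fs (fs (fs f0)) +₄ b = suc₄ (suc₄ (suc₄ b))

neg₄ : Fin 4 → Fin 4
neg₄ f0 = f0
neg₄ (fs f0) = fs (fs (fs f0))
neg₄ (fs (fs f0)) = fs (fs f0)
neg₄ (fs (fs (fs f0))) = fs f0

_·c_ : C4₀ → C4₀ → C4₀
czero  ·c _      = czero
ipow _ ·c czero  = czero
ipow a ·c ipow b = ipow (a +₄ b)

conj : C4₀ → C4₀
conj czero    = czero
conj (ipow a) = ipow (neg₄ a)

c1 ci cm1 : C4₀
c1  = ipow f0
ci  = ipow (fs f0)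
cm1 = ipow (fs (fs f0))

re : C4₀ → ℤ
re czero = ℤ+ 0
re (ipow f0) = ℤ+ 1
re (ipow (fs f0)) = ℤ+ 0
re (ipow (fs (fs f0))) = ℤ- (ℤ+ 1)
re (ipow (fs (fs (fs f0)))) = ℤ+ 0

ipowℕ : ℕ → C4₀
ipowℕ zero = ipow f0
ipowℕ (suc m) = ci ·c ipowℕ m

search : (ℕ → Bool) → ℕ → Maybe ℕ
search P bound = go 0 bound
  where
  go : ℕ → ℕ → Maybe ℕ
  go m zero = nothing
  go m (suc r) with P m
  ... | true  = just m
  ... | false = go (suc m) r

module Characters (q : ℕ) (E : FiniteField (q ^ 3)) (α : FiniteField.Carrier E) where
  open FiniteField E

  -- absolute trace E → F_q, viewed inside E
  T : Carrier → Carrier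
  T x = x +ᶠ (x ^ᶠ q) +ᶠ (x ^ᶠ (q * q))

  dlog : Carrier → Maybe ℕ
  dlog y = search (λ m → does ((α ^ᶠ m) ≟ y)) (q ^ 3)

  χ₄ : Carrier → C4₀
  χ₄ y with y ≟ 0ᶠ
  ... | yes _ = czero
  ... | no _ with dlog y
  ...   | just m  = ipowℕ m
  ...   | nothing = czero   -- unreachable when α is primitive

  χ₂ : Carrier → C4₀
  χ₂ y = χ₄ y ·c χ₄ y

  -- μ = α^(q-1), of order q²+q+1
  μ : Carrier
  μ = α ^ᶠ (q Data.Nat.∸ 1)

  κ : C4₀ → Carrier → ℕ
  κ z x = length (filter (λ i → (χ₄ (T ((μ ^ᶠ i) *ᶠ x)) ·c conj (χ₄ (T (((μ ⁻¹) ^ᶠ i) *ᶠ x)))) ≟C z)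
                         (upTo (q * q + q + 1)))

{-# OPTIONS --safe #-}
-- Let F be the subfield of order q, N = q² + q + 1 and X = χ₂ with values in ℤ. For s, t in F the real
-- part of χ₄(s)·conj χ₄(t) is ½ χ₄(−1) ∑ X(c) over the c in F* with s + c²t = 0. Take s = T(μⁱx),
-- t = T(μ⁻ⁱx) and c = μⁱg. Since gcd(N, q − 1) = 1, each g in E* occurs for exactly one i, and
-- 2(κ₁ − κ₋₁) = χ₄(−1) ∑ X(g) over the g in E* with T(x(g + g⁻¹)) = 0. As for Salié sums, the g with
-- g + g⁻¹ = z contribute X(z + 2) + X(z − 2), so this equals 2 χ₄(−1) X(x) B(2T(x)), where B(t) is the
-- sum of X over the fibre T = t and B(t) = X(t) B(1) on F. Moreover χ₄(−1) = X(2), because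
-- (1 + i)² = 2i for i² = −1, so everything reduces to B(1) = q.
--
-- A double count gives B(1)² = q². For the sign, T(y²) = 1 has q² + B(1) solutions. Choose v with
-- T(v²) = 0 ≠ T(v). On every line y + Fv with T(yv) ≠ 0 there is exactly one solution, which accounts
-- for q² − q of them, and there is at least one more with T(yv) = 0. Hence B(1) > −q.
module Submission where

open import Defs
open import Algebra.Bundles using (CommutativeRing; RawRing)
open import Algebra.Solver.Ring.AlmostCommutativeRing using (AlmostCommutativeRing; fromCommutativeRing; _-Raw-AlmostCommutative⟶_)
open import Data.Bool using (Bool; true; false; if_then_else_)
open import Data.Empty using (⊥-elim)
open import Data.Fin using (Fin; toℕ; fromℕ; fromℕ<; inject₁; punchIn) renaming (zero to f0; suc to fs)
open import Data.Integer using (ℤ; _-_; _*_; _+_; -_; 0ℤ; 1ℤ; -1ℤ; _⊖_; -[1+_]; _≤_) renaming (+_ to ℤ+)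
open import Data.List using (filter; length; applyUpTo)
open import Data.Maybe using (Maybe; just; nothing)
open import Data.Nat as ℕ using (ℕ; zero; suc; _^_; _%_; _/_; _∸_; NonZero; s≤s; z≤n) renaming (_+_ to _+ℕ_; _*_ to _*ℕ_; _<_ to _<ℕ_; _≤_ to _≤ℕ_)
open import Data.Nat.Combinatorics using (_C_; nCn≡1; nCk≡n!/k![n-k]!; k![n∸k]!∣n!)
open import Data.Nat.Base using (_!)
open import Data.Nat.Divisibility using (_∣_; divides)
open import Data.Nat.Primality using (Prime; euclidsLemma; prime⇒nonTrivial)
open import Data.Product using (∃-syntax; _×_; _,_; proj₁; proj₂)
open import Data.Sum using (_⊎_; inj₁; inj₂; [_,_]′)
open import Function using (_∘_; id; _↔_; Inverse; mk↔ₛ′; case_of_)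
open import Level using (0ℓ)
open import Relation.Binary.PropositionalEquality using (_≡_; _≢_; refl; sym; trans; cong; cong₂; subst; subst₂; module ≡-Reasoning)
open import Relation.Nullary using (¬_; Dec; yes; no; does; contradiction; _×-dec_; ¬?)
open import Relation.Nullary.Decidable using (from-yes)
import Algebra.Properties.CommutativeSemiring.Binomial as Binomial
import Algebra.Properties.Ring as RingProperties
import Algebra.Properties.Semiring.Exp as SemiringExp
import Algebra.Properties.Semiring.Mult as SemiringMult
import Algebra.Properties.Semiring.Mult.TCOptimised as SemiringMult′
import Algebra.Properties.Semiring.Sum as SemiringSum
import Algebra.Solver.Ring as RingSolver
import Data.Fin.Properties as Fin
import Data.Integer.Properties as ℤ
import Data.Nat.Divisibility as ℕ∣
import Data.Nat.DivMod as ℕ/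
import Data.Nat.Properties as ℕ
import Data.Nat.Tactic.RingSolver as ℕRing
import Data.Integer.Tactic.RingSolver as ℤRing

-- Indicators and finite sums of integers.

open SemiringSum ℤ.+-*-semiring using (sum; sum-cong-≗; ∑-distrib-+; ∑-comm; sum-permute; sum-remove; sum-replicate-zero; *-distribˡ-sum)

-- Taking real parts is what removes the quartic character: for nonzero s, t in F the value at s/t
-- has nonzero real part only if s/t is a square, and on squares χ₄ is the quadratic character of a
-- root. From there on only quadratic sums occur. The number B(1) is the quotient of the quadratic
-- Gauss sums of E and F. The Hasse-Davenport relation predicts the square of the Gauss sum of F,
-- which is q because -1 is a square in F. To stay within ℤ, a count of pairs takes the place of the
-- modulus of a Gauss sum; such a count cannot see the sign, which is why the quadric T(y²) = 1 is
-- brought in. The congruence q ≡ 1 mod 4 makes N odd, so that nonsquares of F stay nonsquares in E,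
-- and puts a square root of -1 into F. The condition modulo 3 makes 3 invertible modulo N. It acts
-- twice: through (q - 1)(q + 2) ≡ -3 mod N it yields gcd(N, q - 1) = 1, and it forces every y with
-- T(y) = T(y²) = 0 into F, so that the isotropic vectors, being more numerous, include one of
-- nonzero trace.

𝟙 : ∀ {a} {P : Set a} → Dec P → ℤ
𝟙 d = if does d then 1ℤ else 0ℤ

𝟙-true : ∀ {a} {P : Set a} (d : Dec P) → P → 𝟙 d ≡ 1ℤ
𝟙-true (yes _) _ = refl
𝟙-true (no ¬p) p = contradiction p ¬p

𝟙-false : ∀ {a} {P : Set a} (d : Dec P) → ¬ P → 𝟙 d ≡ 0ℤ
𝟙-false (yes p) ¬p = contradiction p ¬p
𝟙-false (no _)  _  = refl

𝟙-cong : ∀ {a b} {P : Set a} {Q : Set b} (d : Dec P) (e : Dec Q) → (P → Q) → (Q → P) → 𝟙 d ≡ 𝟙 e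
𝟙-cong (yes p) e f g = sym (𝟙-true e (f p))
𝟙-cong (no ¬p) e f g = sym (𝟙-false e (¬p ∘ g))

𝟙-mono : ∀ {a b} {P : Set a} {Q : Set b} (d : Dec P) (e : Dec Q) → (P → Q) → 𝟙 d ≤ 𝟙 e
𝟙-mono (yes p) e f = ℤ.≤-reflexive (sym (𝟙-true e (f p)))
𝟙-mono (no _)  (yes _) _ = Data.Integer.+≤+ z≤n
𝟙-mono (no _)  (no _)  _ = ℤ.≤-refl

𝟙-guard : ∀ {a} {P : Set a} (d : Dec P) {i j : ℤ} → (P → i ≡ j) → 𝟙 d * i ≡ 𝟙 d * j
𝟙-guard (yes p) eq = cong (1ℤ *_) (eq p)
𝟙-guard (no _)  _  = refl

sum-mono : ∀ {m} {f g : Fin m → ℤ} → (∀ i → f i ≤ g i) → sum f ≤ sum g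
sum-mono {zero}  le = ℤ.≤-refl
sum-mono {suc m} le = ℤ.+-mono-≤ (le f0) (sum-mono (le ∘ fs))

sum-zero : ∀ {m} {f : Fin m → ℤ} → (∀ i → f i ≡ 0ℤ) → sum f ≡ 0ℤ
sum-zero {m} eq = trans (sum-cong-≗ eq) (sum-replicate-zero m)

sum-single : ∀ {m} (f : Fin m → ℤ) i → (∀ j → j ≢ i → f j ≡ 0ℤ) → sum f ≡ f i
sum-single {suc m} f i eq = begin
  sum f                         ≡⟨ sum-remove {i = i} f ⟩
  f i + sum (f ∘ punchIn i)     ≡⟨ cong (f i +_) (sum-zero λ j → eq _ (Fin.punchInᵢ≢i i j)) ⟩
  f i + 0ℤ                      ≡⟨ ℤ.+-identityʳ _ ⟩
  f i                           ∎
  where open ≡-Reasoning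

sum-const : ∀ m c → sum {m} (λ _ → c) ≡ ℤ+ m * c
sum-const zero    c = sym (ℤ.*-zeroˡ c)
sum-const (suc m) c = begin
  c + sum {m} (λ _ → c)  ≡⟨ cong (c +_) (sum-const m c) ⟩
  c + ℤ+ m * c           ≡⟨ ℤ.suc-* (ℤ+ m) c ⟨
  ℤ+ (suc m) * c         ∎
  where open ≡-Reasoning

length-filter-upTo : ∀ {a} {A : Set a} {P : A → Set} (P? : ∀ x → Dec (P x)) (f : ℕ → A) m →
  ℤ+ (length (filter P? (applyUpTo f m))) ≡ sum {m} (λ i → 𝟙 (P? (f (toℕ i))))
length-filter-upTo P? f zero    = refl
length-filter-upTo P? f (suc m) with P? (f 0)
... | yes _ = cong (1ℤ +_) (length-filter-upTo P? (f ∘ suc) m)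
... | no _  = trans (length-filter-upTo P? (f ∘ suc) m) (sym (ℤ.+-identityˡ _))

-- The values of the quartic character.

·c-assoc : ∀ a b c → (a ·c b) ·c c ≡ a ·c (b ·c c)
·c-assoc czero    b        c     = refl
·c-assoc (ipow a) czero    c     = refl
·c-assoc (ipow a) (ipow b) czero = refl
·c-assoc (ipow a) (ipow b) (ipow c) = cong ipow (+₄-assoc a b c)
  where
  +₄-assoc : ∀ a b c → (a +₄ b) +₄ c ≡ a +₄ (b +₄ c)
  +₄-assoc = from-yes (Fin.all? λ a → Fin.all? λ b → Fin.all? λ c → ((a +₄ b) +₄ c) Fin.≟ (a +₄ (b +₄ c)))

·c-zeroʳ : ∀ c → c ·c czero ≡ czero
·c-zeroʳ czero    = refl
·c-zeroʳ (ipow _) = refl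

·c-comm : ∀ a b → a ·c b ≡ b ·c a
·c-comm czero    b        = sym (·c-zeroʳ b)
·c-comm (ipow _) czero    = refl
·c-comm (ipow a) (ipow b) = cong ipow (+₄-comm a b)
  where
  +₄-comm : ∀ a b → a +₄ b ≡ b +₄ a
  +₄-comm = from-yes (Fin.all? λ a → Fin.all? λ b → (a +₄ b) Fin.≟ (b +₄ a))

·c-identityˡ : ∀ c → c1 ·c c ≡ c
·c-identityˡ czero    = refl
·c-identityˡ (ipow _) = refl

·c-conj : ∀ a → ipow a ·c conj (ipow a) ≡ c1
·c-conj a = cong ipow (+₄-neg₄ a)
  where
  +₄-neg₄ : ∀ a → a +₄ neg₄ a ≡ f0
  +₄-neg₄ = from-yes (Fin.all? λ a → (a +₄ neg₄ a) Fin.≟ f0)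

-- Real parts are not multiplicative in general, but a square of a power of i is 1 or -1 and acts as
-- a real scalar.
re-square-· : ∀ a b → re ((a ·c a) ·c b) ≡ re (a ·c a) * re b
re-square-· czero    b        = sym (ℤ.*-zeroˡ (re b))
re-square-· (ipow a) czero    = sym (ℤ.*-zeroʳ (re (ipow a ·c ipow a)))
re-square-· (ipow a) (ipow b) = go a b
  where
  go : ∀ a b → re (ipow ((a +₄ a) +₄ b)) ≡ re (ipow (a +₄ a)) * re (ipow b)
  go = from-yes (Fin.all? λ a → Fin.all? λ b → re (ipow ((a +₄ a) +₄ b)) ℤ.≟ re (ipow (a +₄ a)) * re (ipow b))

-- The values i and -i have real part 0, so only 1 and -1 are seen. Summed over all exponents this
-- turns κ₁ - κ₋₁ into a sum of real parts.
re-𝟙 : ∀ c → 𝟙 (c ≟C c1) - 𝟙 (c ≟C cm1) ≡ re c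
re-𝟙 czero    = refl
re-𝟙 (ipow a) = go a
  where
  go : ∀ a → 𝟙 (ipow a ≟C c1) - 𝟙 (ipow a ≟C cm1) ≡ re (ipow a)
  go = from-yes (Fin.all? λ a → (𝟙 (ipow a ≟C c1) - 𝟙 (ipow a ≟C cm1)) ℤ.≟ re (ipow a))

ipowℕ-+ : ∀ m n → ipowℕ (m +ℕ n) ≡ ipowℕ m ·c ipowℕ n
ipowℕ-+ zero n = sym (·c-identityˡ (ipowℕ n))
ipowℕ-+ (suc m) n = trans (cong (ci ·c_) (ipowℕ-+ m n)) (sym (·c-assoc ci (ipowℕ m) (ipowℕ n)))

ipowℕ-unit : ∀ m → ∃[ a ] ipowℕ m ≡ ipow a
ipowℕ-unit zero = f0 , refl
ipowℕ-unit (suc m) with ipowℕ m | ipowℕ-unit m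
... | _ | a , refl = suc₄ a , refl

ipowℕ-4∣ : ∀ {m} → 4 ∣ m → ipowℕ m ≡ c1
ipowℕ-4∣ (divides k refl) = go k
  where
  go : ∀ k → ipowℕ (k *ℕ 4) ≡ c1
  go zero    = refl
  go (suc k) = trans (ipowℕ-+ 4 (k *ℕ 4)) (cong (c1 ·c_) (go k))

∣difference⇒≡ : ∀ {d i j} → i ≤ℕ j → j <ℕ d → d ∣ j ∸ i → i ≡ j
∣difference⇒≡ {d} {i} {j} i≤j j<d d∣ = ℕ.≤-antisym i≤j (ℕ.m∸n≡0⇒m≤n (small (j ∸ i) (ℕ.≤-<-trans (ℕ.m∸n≤m j i) j<d) d∣))
  where
  small : ∀ k → k <ℕ d → d ∣ k → k ≡ 0
  small zero    _   _   = refl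
  small (suc k) k<d d∣k = contradiction (ℕ∣.∣⇒≤ d∣k) (ℕ.<⇒≱ k<d)

-- Arithmetic of a finite field and sums over its elements.

module FieldFacts {n : ℕ} (E : FiniteField n) where
  open FiniteField E

  commRing : CommutativeRing 0ℓ 0ℓ
  commRing = record { isCommutativeRing = isCommutativeRing }

  open CommutativeRing commRing public using (ring; semiring; commutativeSemiring)
    renaming ( *-assoc to *ᶠ-assoc; *-comm to *ᶠ-comm; *-identityˡ to *ᶠ-identityˡ; *-identityʳ to *ᶠ-identityʳ
             ; zeroˡ to *ᶠ-zeroˡ; zeroʳ to *ᶠ-zeroʳ; +-identityˡ to +ᶠ-identityˡ; +-identityʳ to +ᶠ-identityʳ
             ; +-assoc to +ᶠ-assoc; +-comm to +ᶠ-comm; -‿inverseʳ to +ᶠ-inverseʳ; distribˡ to *ᶠ-distribˡ-+ᶠ)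
  open SemiringMult′ semiring using () renaming (_×_ to _×ᶠ_)
  private module ×ᶠ = SemiringMult′ semiring
  open RingProperties ring using (-‿distribˡ-*; -‿distribʳ-*; -‿involutive; -0#≈0#; -‿+-comm)

  private
    -- The coefficient map of the ring solver. Integer coefficients have decidable equality in every
    -- characteristic, so terms cancel during normalisation. With the optimised multiples `fromℤ 1ℤ`
    -- reduces to `1ᶠ`, and solver constants match field terms by computation.
    fromℤ : ℤ → Carrier
    fromℤ (ℤ+ m)   = m ×ᶠ 1ᶠ
    fromℤ -[1+ m ] = -ᶠ (suc m ×ᶠ 1ᶠ)

    fromℤ-neg : ∀ i → fromℤ (- i) ≡ -ᶠ fromℤ i
    fromℤ-neg (ℤ+ zero)    = sym -0#≈0#
    fromℤ-neg (ℤ+ (suc m)) = refl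
    fromℤ-neg -[1+ m ]   = sym (-‿involutive _)

    ×ᶠ-suc : ∀ m → suc m ×ᶠ 1ᶠ ≡ 1ᶠ +ᶠ m ×ᶠ 1ᶠ
    ×ᶠ-suc m = ×ᶠ.×-homo-+ 1ᶠ 1 m

    cancel : ∀ a b c → (a +ᶠ b) +ᶠ (-ᶠ (a +ᶠ c)) ≡ b +ᶠ (-ᶠ c)
    cancel a b c = begin
      (a +ᶠ b) +ᶠ (-ᶠ (a +ᶠ c))           ≡⟨ cong ((a +ᶠ b) +ᶠ_) (-‿+-comm a c) ⟨
      (a +ᶠ b) +ᶠ ((-ᶠ a) +ᶠ (-ᶠ c))      ≡⟨ cong (_+ᶠ ((-ᶠ a) +ᶠ (-ᶠ c))) (+ᶠ-comm a b) ⟩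
      (b +ᶠ a) +ᶠ ((-ᶠ a) +ᶠ (-ᶠ c))      ≡⟨ +ᶠ-assoc b a _ ⟩
      b +ᶠ (a +ᶠ ((-ᶠ a) +ᶠ (-ᶠ c)))      ≡⟨ cong (b +ᶠ_) (+ᶠ-assoc a (-ᶠ a) (-ᶠ c)) ⟨
      b +ᶠ ((a +ᶠ (-ᶠ a)) +ᶠ (-ᶠ c))      ≡⟨ cong (λ z → b +ᶠ (z +ᶠ (-ᶠ c))) (+ᶠ-inverseʳ a) ⟩
      b +ᶠ (0ᶠ +ᶠ (-ᶠ c))                 ≡⟨ cong (b +ᶠ_) (+ᶠ-identityˡ (-ᶠ c)) ⟩
      b +ᶠ (-ᶠ c)                         ∎
      where open ≡-Reasoning

    fromℤ-⊖ : ∀ m k → fromℤ (m ⊖ k) ≡ m ×ᶠ 1ᶠ +ᶠ (-ᶠ (k ×ᶠ 1ᶠ))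
    fromℤ-⊖ m zero = sym (trans (cong (m ×ᶠ 1ᶠ +ᶠ_) -0#≈0#) (+ᶠ-identityʳ _))
    fromℤ-⊖ zero (suc k) = sym (+ᶠ-identityˡ _)
    fromℤ-⊖ (suc m) (suc k) = begin
      fromℤ (suc m ⊖ suc k)                           ≡⟨ cong fromℤ (ℤ.[1+m]⊖[1+n]≡m⊖n m k) ⟩
      fromℤ (m ⊖ k)                                   ≡⟨ fromℤ-⊖ m k ⟩
      m ×ᶠ 1ᶠ +ᶠ (-ᶠ (k ×ᶠ 1ᶠ))                       ≡⟨ cancel 1ᶠ _ _ ⟨
      (1ᶠ +ᶠ m ×ᶠ 1ᶠ) +ᶠ (-ᶠ (1ᶠ +ᶠ k ×ᶠ 1ᶠ))         ≡⟨ cong₂ (λ a b → a +ᶠ (-ᶠ b)) (×ᶠ-suc m) (×ᶠ-suc k) ⟨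
      suc m ×ᶠ 1ᶠ +ᶠ (-ᶠ (suc k ×ᶠ 1ᶠ))               ∎
      where open ≡-Reasoning

    fromℤ-+ : ∀ i j → fromℤ (i + j) ≡ fromℤ i +ᶠ fromℤ j
    fromℤ-+ (ℤ+ m)   (ℤ+ k)   = ×ᶠ.×-homo-+ 1ᶠ m k
    fromℤ-+ (ℤ+ m)   -[1+ k ] = fromℤ-⊖ m (suc k)
    fromℤ-+ -[1+ m ] (ℤ+ k)   = trans (fromℤ-⊖ k (suc m)) (+ᶠ-comm _ _)
    fromℤ-+ -[1+ m ] -[1+ k ] = begin
      -ᶠ (suc (suc (m +ℕ k)) ×ᶠ 1ᶠ)                  ≡⟨ cong (λ z → -ᶠ (suc z ×ᶠ 1ᶠ)) (ℕ.+-suc m k) ⟨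
      -ᶠ ((suc m +ℕ suc k) ×ᶠ 1ᶠ)                    ≡⟨ cong -ᶠ_ (×ᶠ.×-homo-+ 1ᶠ (suc m) (suc k)) ⟩
      -ᶠ (suc m ×ᶠ 1ᶠ +ᶠ suc k ×ᶠ 1ᶠ)                ≡⟨ -‿+-comm _ _ ⟨
      (-ᶠ (suc m ×ᶠ 1ᶠ)) +ᶠ (-ᶠ (suc k ×ᶠ 1ᶠ))       ∎
      where open ≡-Reasoning

    fromℤ-*-pos : ∀ m j → fromℤ (ℤ+ m * j) ≡ m ×ᶠ 1ᶠ *ᶠ fromℤ j
    fromℤ-*-pos m (ℤ+ k)   = trans (cong fromℤ (sym (ℤ.pos-* m k))) (×ᶠ.×1-homo-* m k)
    fromℤ-*-pos m -[1+ k ] = begin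
      fromℤ (ℤ+ m * - (ℤ+ (suc k)))       ≡⟨ cong fromℤ (ℤ.neg-distribʳ-* (ℤ+ m) (ℤ+ (suc k))) ⟨
      fromℤ (- (ℤ+ m * ℤ+ (suc k)))       ≡⟨ fromℤ-neg (ℤ+ m * ℤ+ (suc k)) ⟩
      -ᶠ fromℤ (ℤ+ m * ℤ+ (suc k))        ≡⟨ cong -ᶠ_ (fromℤ-*-pos m (ℤ+ (suc k))) ⟩
      -ᶠ (m ×ᶠ 1ᶠ *ᶠ suc k ×ᶠ 1ᶠ)       ≡⟨ -‿distribʳ-* _ _ ⟩
      m ×ᶠ 1ᶠ *ᶠ (-ᶠ (suc k ×ᶠ 1ᶠ))     ∎
      where open ≡-Reasoning

    fromℤ-* : ∀ i j → fromℤ (i * j) ≡ fromℤ i *ᶠ fromℤ j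
    fromℤ-* (ℤ+ m)   j = fromℤ-*-pos m j
    fromℤ-* -[1+ m ] j = begin
      fromℤ (- (ℤ+ (suc m)) * j)       ≡⟨ cong fromℤ (ℤ.neg-distribˡ-* (ℤ+ (suc m)) j) ⟨
      fromℤ (- (ℤ+ (suc m) * j))       ≡⟨ fromℤ-neg (ℤ+ (suc m) * j) ⟩
      -ᶠ fromℤ (ℤ+ (suc m) * j)        ≡⟨ cong -ᶠ_ (fromℤ-*-pos (suc m) j) ⟩
      -ᶠ (suc m ×ᶠ 1ᶠ *ᶠ fromℤ j)    ≡⟨ -‿distribˡ-* _ _ ⟩
      (-ᶠ (suc m ×ᶠ 1ᶠ)) *ᶠ fromℤ j  ∎
      where open ≡-Reasoning

    almostRing : AlmostCommutativeRing 0ℓ 0ℓ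
    almostRing = fromCommutativeRing commRing

    ℤ-rawRing : RawRing 0ℓ 0ℓ
    ℤ-rawRing = CommutativeRing.rawRing ℤ.+-*-commutativeRing

    ℤ⟶E : ℤ-rawRing -Raw-AlmostCommutative⟶ almostRing
    ℤ⟶E = record
      { ⟦_⟧ = fromℤ ; +-homo = fromℤ-+ ; *-homo = fromℤ-* ; -‿homo = fromℤ-neg ; 0-homo = refl ; 1-homo = refl }

    fromℤ-≟ : ∀ i j → Maybe (fromℤ i ≡ fromℤ j)
    fromℤ-≟ i j with i ℤ.≟ j
    ... | yes eq = just (cong fromℤ eq)
    ... | no _   = nothing

  open RingSolver ℤ-rawRing almostRing ℤ⟶E fromℤ-≟ public using (solve; _:=_; _:+_; _:*_; :-_; con)

  infixl 6 _-ᶠ_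
  _-ᶠ_ : Carrier → Carrier → Carrier
  x -ᶠ y = x +ᶠ (-ᶠ y)

  -ᶠ-unique : ∀ {x y} → x -ᶠ y ≡ 0ᶠ → x ≡ y
  -ᶠ-unique {x} {y} eq = begin
    x              ≡⟨ solve 2 (λ x y → x := (x :+ (:- y)) :+ y) refl x y ⟩
    x -ᶠ y +ᶠ y    ≡⟨ cong (_+ᶠ y) eq ⟩
    0ᶠ +ᶠ y        ≡⟨ +ᶠ-identityˡ y ⟩
    y              ∎
    where open ≡-Reasoning

  -ᶠ-self : ∀ {x y} → x ≡ y → x -ᶠ y ≡ 0ᶠ
  -ᶠ-self {x} refl = +ᶠ-inverseʳ x

  infix 4 _≟ᶠ_
  _≟ᶠ_ : (x y : Carrier) → Dec (x ≡ y)
  _≟ᶠ_ = _≟_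

  1≢0 : 1ᶠ ≢ 0ᶠ
  1≢0 = 0≢1 ∘ sym

  inverseˡ : ∀ x → x ≢ 0ᶠ → x ⁻¹ *ᶠ x ≡ 1ᶠ
  inverseˡ x x≢0 = trans (*ᶠ-comm _ _) (inverseʳ x x≢0)

  zero-product : ∀ {x y} → x *ᶠ y ≡ 0ᶠ → x ≡ 0ᶠ ⊎ y ≡ 0ᶠ
  zero-product {x} {y} eq with x ≟ 0ᶠ
  ... | yes x≡0 = inj₁ x≡0
  ... | no x≢0  = inj₂ (begin
    y                   ≡⟨ *ᶠ-identityˡ y ⟨
    1ᶠ *ᶠ y             ≡⟨ cong (_*ᶠ y) (inverseˡ x x≢0) ⟨
    x ⁻¹ *ᶠ x *ᶠ y      ≡⟨ *ᶠ-assoc _ _ _ ⟩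
    x ⁻¹ *ᶠ (x *ᶠ y)    ≡⟨ cong (x ⁻¹ *ᶠ_) eq ⟩
    x ⁻¹ *ᶠ 0ᶠ          ≡⟨ *ᶠ-zeroʳ _ ⟩
    0ᶠ                  ∎)
    where open ≡-Reasoning

  *ᶠ-nonzero : ∀ {x y} → x ≢ 0ᶠ → y ≢ 0ᶠ → x *ᶠ y ≢ 0ᶠ
  *ᶠ-nonzero x≢0 y≢0 eq = [ x≢0 , y≢0 ]′ (zero-product eq)

  *ᶠ-cancelˡ : ∀ {a x y} → a ≢ 0ᶠ → a *ᶠ x ≡ a *ᶠ y → x ≡ y
  *ᶠ-cancelˡ {a} {x} {y} a≢0 eq = -ᶠ-unique ([ ⊥-elim ∘ a≢0 , id ]′ (zero-product (begin
    a *ᶠ (x -ᶠ y)       ≡⟨ solve 3 (λ a x y → a :* (x :+ (:- y)) := a :* x :+ (:- (a :* y))) refl a x y ⟩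
    a *ᶠ x -ᶠ a *ᶠ y    ≡⟨ -ᶠ-self eq ⟩
    0ᶠ                  ∎)))
    where open ≡-Reasoning

  mul-inv-cancelʳ : ∀ x y → y ≢ 0ᶠ → x *ᶠ y *ᶠ y ⁻¹ ≡ x
  mul-inv-cancelʳ x y y≢0 = trans (*ᶠ-assoc _ _ _) (trans (cong (x *ᶠ_) (inverseʳ y y≢0)) (*ᶠ-identityʳ x))

  mul-inv-cancelʳ′ : ∀ x y → y ≢ 0ᶠ → x *ᶠ y ⁻¹ *ᶠ y ≡ x
  mul-inv-cancelʳ′ x y y≢0 = trans (*ᶠ-assoc _ _ _) (trans (cong (x *ᶠ_) (inverseˡ y y≢0)) (*ᶠ-identityʳ x))

  ^ᶠ-+ : ∀ x m k → x ^ᶠ (m +ℕ k) ≡ x ^ᶠ m *ᶠ x ^ᶠ k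
  ^ᶠ-+ x zero    k = sym (*ᶠ-identityˡ _)
  ^ᶠ-+ x (suc m) k = trans (cong (x *ᶠ_) (^ᶠ-+ x m k)) (sym (*ᶠ-assoc _ _ _))

  1^ᶠ : ∀ m → 1ᶠ ^ᶠ m ≡ 1ᶠ
  1^ᶠ zero    = refl
  1^ᶠ (suc m) = trans (*ᶠ-identityˡ _) (1^ᶠ m)

  *ᶠ-^ᶠ : ∀ x y m → (x *ᶠ y) ^ᶠ m ≡ x ^ᶠ m *ᶠ y ^ᶠ m
  *ᶠ-^ᶠ x y zero    = sym (*ᶠ-identityˡ _)
  *ᶠ-^ᶠ x y (suc m) = begin
    x *ᶠ y *ᶠ (x *ᶠ y) ^ᶠ m             ≡⟨ cong (x *ᶠ y *ᶠ_) (*ᶠ-^ᶠ x y m) ⟩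
    x *ᶠ y *ᶠ (x ^ᶠ m *ᶠ y ^ᶠ m)        ≡⟨ solve 4 (λ a b c d → a :* b :* (c :* d) := (a :* c) :* (b :* d)) refl x y _ _ ⟩
    x *ᶠ x ^ᶠ m *ᶠ (y *ᶠ y ^ᶠ m)        ∎
    where open ≡-Reasoning

  ^ᶠ-* : ∀ x m k → x ^ᶠ (m *ℕ k) ≡ (x ^ᶠ m) ^ᶠ k
  ^ᶠ-* x m zero    = cong (x ^ᶠ_) (ℕ.*-zeroʳ m)
  ^ᶠ-* x m (suc k) = begin
    x ^ᶠ (m *ℕ suc k)            ≡⟨ cong (x ^ᶠ_) (ℕ.*-suc m k) ⟩
    x ^ᶠ (m +ℕ m *ℕ k)           ≡⟨ ^ᶠ-+ x m (m *ℕ k) ⟩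
    x ^ᶠ m *ᶠ x ^ᶠ (m *ℕ k)      ≡⟨ cong (x ^ᶠ m *ᶠ_) (^ᶠ-* x m k) ⟩
    x ^ᶠ m *ᶠ (x ^ᶠ m) ^ᶠ k      ∎
    where open ≡-Reasoning

  ^ᶠ-nonzero : ∀ {x} m → x ≢ 0ᶠ → x ^ᶠ m ≢ 0ᶠ
  ^ᶠ-nonzero zero    x≢0 = 1≢0
  ^ᶠ-nonzero (suc m) x≢0 = *ᶠ-nonzero x≢0 (^ᶠ-nonzero m x≢0)

  open Inverse card renaming (to to element; from to index) using (strictlyInverseˡ; strictlyInverseʳ) public

  ∑ : (Carrier → ℤ) → ℤ
  ∑ f = sum (f ∘ element)

  ∑-cong : ∀ {f g : Carrier → ℤ} → (∀ x → f x ≡ g x) → ∑ f ≡ ∑ g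
  ∑-cong eq = sum-cong-≗ (eq ∘ element)

  ∑-+ : ∀ (f g : Carrier → ℤ) → ∑ (λ x → f x + g x) ≡ ∑ f + ∑ g
  ∑-+ f g = ∑-distrib-+ (f ∘ element) (g ∘ element)

  ∑-*ˡ : ∀ c (f : Carrier → ℤ) → ∑ (λ x → c * f x) ≡ c * ∑ f
  ∑-*ˡ c f = sym (*-distribˡ-sum c (f ∘ element))

  ∑-*ʳ : ∀ c (f : Carrier → ℤ) → ∑ (λ x → f x * c) ≡ ∑ f * c
  ∑-*ʳ c f = trans (∑-cong λ x → ℤ.*-comm (f x) c) (trans (∑-*ˡ c f) (ℤ.*-comm c (∑ f)))

  ∑-swap : ∀ (f : Carrier → Carrier → ℤ) → ∑ (λ x → ∑ (f x)) ≡ ∑ (λ y → ∑ (λ x → f x y))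
  ∑-swap f = ∑-comm (λ i j → f (element i) (element j))

  ∑-sum-swap : ∀ {m} (f : Carrier → Fin m → ℤ) → ∑ (λ x → sum (f x)) ≡ sum (λ i → ∑ (λ x → f x i))
  ∑-sum-swap f = ∑-comm (λ i j → f (element i) j)

  ∑-mono : ∀ {f g : Carrier → ℤ} → (∀ x → f x ≤ g x) → ∑ f ≤ ∑ g
  ∑-mono le = sum-mono (le ∘ element)

  ∑-const : ∀ c → ∑ (λ _ → c) ≡ ℤ+ n * c
  ∑-const c = sum-const n c

  ∑-single : ∀ (f : Carrier → ℤ) z → (∀ y → y ≢ z → f y ≡ 0ℤ) → ∑ f ≡ f z
  ∑-single f z eq = begin
    ∑ f                    ≡⟨ sum-single (f ∘ element) (index z) (λ j j≢ → eq _ λ e → j≢ (trans (sym (strictlyInverseʳ j)) (cong index e))) ⟩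
    f (element (index z))  ≡⟨ cong f (strictlyInverseˡ z) ⟩
    f z                    ∎
    where open ≡-Reasoning

  ∑-δ : ∀ (f : Carrier → ℤ) z → ∑ (λ y → 𝟙 (y ≟ z) * f y) ≡ f z
  ∑-δ f z = begin
    ∑ (λ y → 𝟙 (y ≟ z) * f y)  ≡⟨ ∑-single (λ y → 𝟙 (y ≟ z) * f y) z (λ y y≢z → cong (_* f y) (𝟙-false (y ≟ z) y≢z)) ⟩
    𝟙 (z ≟ z) * f z            ≡⟨ cong (_* f z) (𝟙-true (z ≟ z) refl) ⟩
    1ℤ * f z                   ≡⟨ ℤ.*-identityˡ (f z) ⟩
    f z                        ∎
    where open ≡-Reasoning

  ∑-δ₁ : ∀ z → ∑ (λ y → 𝟙 (y ≟ z)) ≡ 1ℤ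
  ∑-δ₁ z = trans (∑-cong λ y → sym (ℤ.*-identityʳ (𝟙 (y ≟ z)))) (∑-δ (λ _ → 1ℤ) z)

  ∑-reindex : ∀ (f : Carrier → ℤ) (φ ψ : Carrier → Carrier) → (∀ x → φ (ψ x) ≡ x) → (∀ x → ψ (φ x) ≡ x) → ∑ (f ∘ φ) ≡ ∑ f
  ∑-reindex f φ ψ φψ ψφ = begin
    sum (f ∘ φ ∘ element)                          ≡⟨ sum-cong-≗ (λ i → cong f (strictlyInverseˡ (φ (element i)))) ⟨
    sum (f ∘ element ∘ index ∘ φ ∘ element)        ≡⟨ sum-permute (f ∘ element) π ⟨
    sum (f ∘ element)                              ∎
    where
    open ≡-Reasoning
    π : Fin n ↔ Fin n
    π = mk↔ₛ′ (index ∘ φ ∘ element) (index ∘ ψ ∘ element)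
      (λ i → trans (cong (index ∘ φ) (strictlyInverseˡ _)) (trans (cong index (φψ _)) (strictlyInverseʳ i)))
      (λ i → trans (cong (index ∘ ψ) (strictlyInverseˡ _)) (trans (cong index (ψφ _)) (strictlyInverseʳ i)))

  ∑-scale : ∀ (f : Carrier → ℤ) a → a ≢ 0ᶠ → ∑ (λ x → f (a *ᶠ x)) ≡ ∑ f
  ∑-scale f a a≢0 = ∑-reindex f (a *ᶠ_) (a ⁻¹ *ᶠ_)
    (λ x → trans (sym (*ᶠ-assoc _ _ _)) (trans (cong (_*ᶠ x) (inverseʳ a a≢0)) (*ᶠ-identityˡ x)))
    (λ x → trans (sym (*ᶠ-assoc _ _ _)) (trans (cong (_*ᶠ x) (inverseˡ a a≢0)) (*ᶠ-identityˡ x)))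

  ∑-translate : ∀ (f : Carrier → ℤ) a → ∑ (λ x → f (x +ᶠ a)) ≡ ∑ f
  ∑-translate f a = ∑-reindex f (_+ᶠ a) (_-ᶠ a)
    (solve 2 (λ a x → x :+ (:- a) :+ a := x) refl a) (solve 2 (λ a x → x :+ a :+ (:- a) := x) refl a)

-- Bounded search for a discrete logarithm.

-- The local loop of search has no name outside Defs; the blank is filled in by unification once
-- its three arguments have been abstracted to distinct variables.
mutual
  searchFrom : (ℕ → Bool) → ℕ → ℕ → ℕ → Maybe ℕ
  searchFrom = _

  search-step : ∀ P r → P 0 ≡ false → search P (suc r) ≡ searchFrom P (suc r) 1 r
  search-step P r eq with P 0
  search-step P r refl | false with suc r | 1
  ... | b | m = refl

-- The argument `b` is the parameter `bound` inherited from the enclosing clause of `search`. The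
-- loop runs on `m` and `r`, whose sum is invariant, so a hit below `m +ℕ r` cannot be passed over.
searchFrom-finds : ∀ P b m r {k} → m ≤ℕ k → k <ℕ m +ℕ r → P k ≡ true →
  ∃[ j ] searchFrom P b m r ≡ just j × P j ≡ true
searchFrom-finds P b m zero m≤k k<m+0 Pk =
  contradiction (ℕ.<-≤-trans k<m+0 (ℕ.≤-reflexive (ℕ.+-identityʳ m))) (ℕ.≤⇒≯ m≤k)
searchFrom-finds P b m (suc r) {k} m≤k k< Pk with P m in eq
... | true  = m , refl , eq
... | false = searchFrom-finds P b (suc m) r (ℕ.≤∧≢⇒< m≤k λ { refl → case trans (sym Pk) eq of λ () })
                (subst (k <ℕ_) (ℕ.+-suc m r) k<) Pk

search-finds : ∀ P b {k} → k <ℕ b → P k ≡ true → ∃[ j ] search P b ≡ just j × P j ≡ true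
search-finds P b k<b Pk = searchFrom-finds P b 0 b z≤n k<b Pk

-- The multiplicative order of a primitive element.

module PrimitiveElement {n : ℕ} (E : FiniteField n) (α : FiniteField.Carrier E)
  (prim : FiniteField.IsPrimitive E α) (3≤n : 3 ≤ℕ n) where
  open FiniteField E
  open FieldFacts E

  -- Coding 0 by the first index and every other element by an exponent below d injects the field
  -- into d + 1 codes. This bounds every period of α from below.
  powers-cover : ∀ d → (∀ y → y ≢ 0ᶠ → ∃[ m ] m <ℕ d × α ^ᶠ m ≡ y) → n ≤ℕ suc d
  powers-cover d cover = Fin.injective⇒≤ {f = code ∘ element}
    λ {i} {j} eq → trans (sym (strictlyInverseʳ i)) (trans (cong index (code-injective eq)) (strictlyInverseʳ j))
    where
    code : Carrier → Fin (suc d)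
    code y with y ≟ 0ᶠ
    ... | yes _  = f0
    ... | no y≢0 = fs (fromℕ< (proj₁ (proj₂ (cover y y≢0))))

    decode : Fin (suc d) → Carrier
    decode f0     = 0ᶠ
    decode (fs k) = α ^ᶠ toℕ k

    decode-code : ∀ y → decode (code y) ≡ y
    decode-code y with y ≟ 0ᶠ
    ... | yes y≡0 = sym y≡0
    ... | no y≢0  = trans (cong (α ^ᶠ_) (Fin.toℕ-fromℕ< (proj₁ (proj₂ (cover y y≢0))))) (proj₂ (proj₂ (cover y y≢0)))

    code-injective : ∀ {x y} → code x ≡ code y → x ≡ y
    code-injective {x} {y} eq = trans (sym (decode-code x)) (trans (cong decode eq) (decode-code y))

  -- The powers of 0 are 1 and 0, so the field would have at most two elements.
  α≢0 : α ≢ 0ᶠ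
  α≢0 refl = ℕ.<⇒≱ 3≤n (powers-cover 1 λ y y≢0 → 0 , s≤s z≤n , only-one y≢0 (prim y y≢0))
    where
    only-one : ∀ {y} → y ≢ 0ᶠ → ∃[ m ] 0ᶠ ^ᶠ m ≡ y → 1ᶠ ≡ y
    only-one y≢0 (zero  , eq) = eq
    only-one y≢0 (suc m , eq) = contradiction (trans (sym eq) (*ᶠ-zeroˡ _)) y≢0

  α^-nonzero : ∀ m → α ^ᶠ m ≢ 0ᶠ
  α^-nonzero m = ^ᶠ-nonzero m α≢0

  α^-∸ : ∀ {i j} → i ≤ℕ j → α ^ᶠ i ≡ α ^ᶠ j → α ^ᶠ (j ∸ i) ≡ 1ᶠ
  α^-∸ {i} {j} i≤j eq = *ᶠ-cancelˡ (α^-nonzero i) (begin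
    α ^ᶠ i *ᶠ α ^ᶠ (j ∸ i)  ≡⟨ ^ᶠ-+ α i (j ∸ i) ⟨
    α ^ᶠ (i +ℕ (j ∸ i))     ≡⟨ cong (α ^ᶠ_) (ℕ.m+[n∸m]≡n i≤j) ⟩
    α ^ᶠ j                  ≡⟨ eq ⟨
    α ^ᶠ i                  ≡⟨ *ᶠ-identityʳ _ ⟨
    α ^ᶠ i *ᶠ 1ᶠ            ∎)
    where open ≡-Reasoning

  α^-% : ∀ d .{{_ : NonZero d}} → α ^ᶠ d ≡ 1ᶠ → ∀ m → α ^ᶠ (m % d) ≡ α ^ᶠ m
  α^-% d α^d≡1 m = sym (begin
    α ^ᶠ m                                   ≡⟨ cong (α ^ᶠ_) (ℕ/.m≡m%n+[m/n]*n m d) ⟩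
    α ^ᶠ (m % d +ℕ m / d *ℕ d)               ≡⟨ ^ᶠ-+ α (m % d) (m / d *ℕ d) ⟩
    α ^ᶠ (m % d) *ᶠ α ^ᶠ (m / d *ℕ d)        ≡⟨ cong (λ k → α ^ᶠ (m % d) *ᶠ α ^ᶠ k) (ℕ.*-comm (m / d) d) ⟩
    α ^ᶠ (m % d) *ᶠ α ^ᶠ (d *ℕ (m / d))      ≡⟨ cong (α ^ᶠ (m % d) *ᶠ_) (^ᶠ-* α d (m / d)) ⟩
    α ^ᶠ (m % d) *ᶠ (α ^ᶠ d) ^ᶠ (m / d)      ≡⟨ cong (λ z → α ^ᶠ (m % d) *ᶠ z ^ᶠ (m / d)) α^d≡1 ⟩
    α ^ᶠ (m % d) *ᶠ 1ᶠ ^ᶠ (m / d)            ≡⟨ cong (α ^ᶠ (m % d) *ᶠ_) (1^ᶠ (m / d)) ⟩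
    α ^ᶠ (m % d) *ᶠ 1ᶠ                       ≡⟨ *ᶠ-identityʳ _ ⟩
    α ^ᶠ (m % d)                             ∎)
    where open ≡-Reasoning

  period-bound : ∀ d .{{_ : NonZero d}} → α ^ᶠ d ≡ 1ᶠ → n ≤ℕ suc d
  period-bound d α^d≡1 = powers-cover d λ y y≢0 →
    let m , α^m≡y = prim y y≢0 in m % d , ℕ/.m%n<n m d , trans (α^-% d α^d≡1 m) α^m≡y

  M : ℕ
  M = n ∸ 1

  n≡1+M : n ≡ suc M
  n≡1+M = sym (ℕ.m+[n∸m]≡n (ℕ.≤-trans (s≤s z≤n) 3≤n))

  instance
    M≢0 : NonZero M
    M≢0 = ℕ.>-nonZero (ℕ.≤-trans (s≤s z≤n) (ℕ.∸-monoˡ-≤ 1 3≤n))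

  -- Pigeonhole among n + 1 objects, namely 0 and the powers with exponents below n. Two powers must
  -- collide; their exponents differ by a period d ≤ n - 1, and `period-bound` gives d ≥ n - 1.
  α^M≡1 : α ^ᶠ M ≡ 1ᶠ
  α^M≡1 = from-collision (Fin.pigeonhole (ℕ.n<1+n n) zero-or-power)
    where
    zero-or-power : Fin (suc n) → Fin n
    zero-or-power f0     = index 0ᶠ
    zero-or-power (fs i) = index (α ^ᶠ toℕ i)

    index-injective : ∀ {x y} → index x ≡ index y → x ≡ y
    index-injective eq = trans (sym (strictlyInverseˡ _)) (trans (cong element eq) (strictlyInverseˡ _))

    from-collision : (∃[ i ] ∃[ j ] i Data.Fin.< j × zero-or-power i ≡ zero-or-power j) → α ^ᶠ M ≡ 1ᶠ
    from-collision (f0   , fs j , _ , eq) = contradiction (sym (index-injective eq)) (α^-nonzero (toℕ j))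
    from-collision (fs i , fs j , s≤s i<j , eq) = subst (λ e → α ^ᶠ e ≡ 1ᶠ) (ℕ.≤-antisym d≤M M≤d) α^d≡1
      where
      d = toℕ j ∸ toℕ i
      α^d≡1 : α ^ᶠ d ≡ 1ᶠ
      α^d≡1 = α^-∸ (ℕ.<⇒≤ i<j) (index-injective eq)
      d≤M : d ≤ℕ M
      d≤M = ℕ.≤-trans (ℕ.m∸n≤m (toℕ j) (toℕ i)) (ℕ.s≤s⁻¹ (subst (toℕ j <ℕ_) n≡1+M (Fin.toℕ<n j)))
      M≤d : M ≤ℕ d
      M≤d = ℕ.s≤s⁻¹ (subst (_≤ℕ suc d) n≡1+M (period-bound d {{ℕ.>-nonZero (ℕ.m<n⇒0<n∸m i<j)}} α^d≡1))

  -- The remainder of m modulo M is again a period; a nonzero one would be shorter than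
  -- `period-bound` permits.
  order : ∀ m → α ^ᶠ m ≡ 1ᶠ → M ∣ m
  order m α^m≡1 = ℕ∣.m%n≡0⇒n∣m m M (remainder (m % M) (ℕ/.m%n<n m M) (trans (α^-% M α^M≡1 m) α^m≡1))
    where
    remainder : ∀ r → r <ℕ M → α ^ᶠ r ≡ 1ᶠ → r ≡ 0
    remainder zero    _   _     = refl
    remainder (suc r) r<M α^r≡1 =
      contradiction (ℕ.s≤s⁻¹ (subst (_≤ℕ suc (suc r)) n≡1+M (period-bound (suc r) α^r≡1))) (ℕ.<⇒≱ r<M)

  M∣⇒α^≡1 : ∀ {m} → M ∣ m → α ^ᶠ m ≡ 1ᶠ
  M∣⇒α^≡1 (divides k refl) = begin
    α ^ᶠ (k *ℕ M)     ≡⟨ cong (α ^ᶠ_) (ℕ.*-comm k M) ⟩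
    α ^ᶠ (M *ℕ k)     ≡⟨ ^ᶠ-* α M k ⟩
    (α ^ᶠ M) ^ᶠ k     ≡⟨ cong (_^ᶠ k) α^M≡1 ⟩
    1ᶠ ^ᶠ k           ≡⟨ 1^ᶠ k ⟩
    1ᶠ                ∎
    where open ≡-Reasoning

  x^n≡x : ∀ x → x ^ᶠ n ≡ x
  x^n≡x x with x ≟ 0ᶠ
  ... | yes refl = trans (cong (0ᶠ ^ᶠ_) n≡1+M) (*ᶠ-zeroˡ _)
  ... | no x≢0 with prim x x≢0
  ...   | m , refl = begin
    (α ^ᶠ m) ^ᶠ n            ≡⟨ cong ((α ^ᶠ m) ^ᶠ_) n≡1+M ⟩
    α ^ᶠ m *ᶠ (α ^ᶠ m) ^ᶠ M  ≡⟨ cong (α ^ᶠ m *ᶠ_) (^ᶠ-* α m M) ⟨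
    α ^ᶠ m *ᶠ α ^ᶠ (m *ℕ M)  ≡⟨ cong (α ^ᶠ m *ᶠ_) (M∣⇒α^≡1 (divides m refl)) ⟩
    α ^ᶠ m *ᶠ 1ᶠ             ≡⟨ *ᶠ-identityʳ _ ⟩
    α ^ᶠ m                   ∎
    where open ≡-Reasoning

-- Binomial coefficients modulo p and the Frobenius map.

prime∤! : ∀ {p} → Prime p → ∀ k → k <ℕ p → ¬ (p ∣ k !)
prime∤! pp zero    1<p p∣1 = contradiction (ℕ∣.∣1⇒≡1 p∣1) (ℕ.nonTrivial⇒≢1 {{prime⇒nonTrivial pp}})
prime∤! pp (suc k) k<p p∣  with euclidsLemma (suc k) (k !) pp p∣
... | inj₁ p∣k+1 = ℕ.<⇒≱ k<p (ℕ∣.∣⇒≤ p∣k+1)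
... | inj₂ p∣k!  = prime∤! pp k (ℕ.<-trans (ℕ.n<1+n k) k<p) p∣k!

-- The prime p divides p!, which is the coefficient times k!(p - k)!, but it divides neither
-- factorial, since all their factors lie below p.
prime∣C : ∀ {p} → Prime p → ∀ k → 0 <ℕ k → k <ℕ p → p ∣ p C k
prime∣C {p} pp k 0<k k<p = [ id , ⊥-elim ∘ no-factor ]′ (euclidsLemma (p C k) (k ! *ℕ (p ∸ k) !) pp p∣product)
  where
  instance
    _ = k ℕ.!* (p ∸ k) !≢0
  self∣! : ∀ m → 0 <ℕ m → m ∣ m !
  self∣! (suc m) _ = ℕ∣.m∣m*n (m !)
  p∣product : p ∣ (p C k) *ℕ (k ! *ℕ (p ∸ k) !)
  p∣product = subst (p ∣_) (sym (trans (cong (_*ℕ (k ! *ℕ (p ∸ k) !)) (nCk≡n!/k![n-k]! (ℕ.<⇒≤ k<p)))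
                                       (ℕ/.m/n*n≡m (k![n∸k]!∣n! (ℕ.<⇒≤ k<p))))) (self∣! p (ℕ.<-trans 0<k k<p))
  no-factor : ¬ (p ∣ k ! *ℕ (p ∸ k) !)
  no-factor p∣ = [ prime∤! pp k k<p , prime∤! pp (p ∸ k) (ℕ.∸-monoʳ-< 0<k (ℕ.<⇒≤ k<p)) ]′ (euclidsLemma (k !) ((p ∸ k) !) pp p∣)

module Frobenius {n : ℕ} (E : FiniteField n) {p : ℕ} (pp : Prime p) {e : ℕ} (n≡p^e : n ≡ p ^ e) where
  open FiniteField E
  open FieldFacts E
  private
    module Sum = SemiringSum semiring
  open SemiringMult semiring using (×-homo-1; ×1-homo-*; ×-assoc-*; ×-assocˡ; ×-congʳ; ×-congˡ) renaming (_×_ to _×ᶠ_)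
  open SemiringExp semiring using () renaming (_^_ to _^′_)

  private
    ^′≡^ᶠ : ∀ x m → x ^′ m ≡ x ^ᶠ m
    ^′≡^ᶠ x zero    = refl
    ^′≡^ᶠ x (suc m) = cong (x *ᶠ_) (^′≡^ᶠ x m)

  -- Translation by 1 permutes the field, so the sum S of all elements satisfies S + n·1 = S.
  cardinality-×ᶠ : n ×ᶠ 1ᶠ ≡ 0ᶠ
  cardinality-×ᶠ = begin
    n ×ᶠ 1ᶠ                          ≡⟨ solve 2 (λ s u → u := (:- s) :+ (s :+ u)) refl S _ ⟩
    (-ᶠ S) +ᶠ (S +ᶠ n ×ᶠ 1ᶠ)         ≡⟨ cong ((-ᶠ S) +ᶠ_) (cong (S +ᶠ_) (Sum.sum-replicate n)) ⟨
    (-ᶠ S) +ᶠ (S +ᶠ Sum.sum {n} (λ _ → 1ᶠ))              ≡⟨ cong ((-ᶠ S) +ᶠ_) (Sum.∑-distrib-+ element (λ _ → 1ᶠ)) ⟨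
    (-ᶠ S) +ᶠ Sum.sum (λ i → element i +ᶠ 1ᶠ)            ≡⟨ cong ((-ᶠ S) +ᶠ_) (Sum.sum-cong-≗ λ i → strictlyInverseˡ (element i +ᶠ 1ᶠ)) ⟨
    (-ᶠ S) +ᶠ Sum.sum (λ i → element (index (element i +ᶠ 1ᶠ))) ≡⟨ cong ((-ᶠ S) +ᶠ_) (Sum.sum-permute element π) ⟨
    (-ᶠ S) +ᶠ S                      ≡⟨ solve 1 (λ s → (:- s) :+ s := con 0ℤ) refl S ⟩
    0ᶠ                               ∎
    where
    open ≡-Reasoning
    S = Sum.sum element
    π : Fin n ↔ Fin n
    π = mk↔ₛ′ (λ i → index (element i +ᶠ 1ᶠ)) (λ i → index (element i -ᶠ 1ᶠ))
      (λ i → trans (cong (λ z → index (z +ᶠ 1ᶠ)) (strictlyInverseˡ _))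
                   (trans (cong index (solve 1 (λ x → x :+ (:- con 1ℤ) :+ con 1ℤ := x) refl (element i))) (strictlyInverseʳ i)))
      (λ i → trans (cong (λ z → index (z -ᶠ 1ᶠ)) (strictlyInverseˡ _))
                   (trans (cong index (solve 1 (λ x → x :+ con 1ℤ :+ (:- con 1ℤ) := x) refl (element i))) (strictlyInverseʳ i)))

  -- Here p^e·1 is a product of e factors p·1, and one of them must vanish.
  characteristic : p ×ᶠ 1ᶠ ≡ 0ᶠ
  characteristic = go e (subst (λ m → m ×ᶠ 1ᶠ ≡ 0ᶠ) n≡p^e cardinality-×ᶠ)
    where
    go : ∀ j → (p ^ j) ×ᶠ 1ᶠ ≡ 0ᶠ → p ×ᶠ 1ᶠ ≡ 0ᶠ
    go zero    eq = contradiction (trans (sym (×-homo-1 1ᶠ)) eq) 1≢0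
    go (suc j) eq = [ id , go j ]′ (zero-product (trans (sym (×1-homo-* p (p ^ j))) eq))

  p∣⇒×ᶠ≡0 : ∀ {m} → p ∣ m → ∀ x → m ×ᶠ x ≡ 0ᶠ
  p∣⇒×ᶠ≡0 (divides k refl) x = begin
    (k *ℕ p) ×ᶠ x            ≡⟨ ×-congˡ (ℕ.*-comm k p) ⟩
    (p *ℕ k) ×ᶠ x            ≡⟨ ×-assocˡ x p k ⟨
    p ×ᶠ (k ×ᶠ x)            ≡⟨ ×-congʳ p (*ᶠ-identityˡ _) ⟨
    p ×ᶠ (1ᶠ *ᶠ (k ×ᶠ x))    ≡⟨ ×-assoc-* p 1ᶠ (k ×ᶠ x) ⟨
    p ×ᶠ 1ᶠ *ᶠ (k ×ᶠ x)      ≡⟨ cong (_*ᶠ (k ×ᶠ x)) characteristic ⟩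
    0ᶠ *ᶠ (k ×ᶠ x)           ≡⟨ *ᶠ-zeroˡ _ ⟩
    0ᶠ                       ∎
    where open ≡-Reasoning

  frobenius-+ : ∀ x y → (x +ᶠ y) ^ᶠ p ≡ x ^ᶠ p +ᶠ y ^ᶠ p
  frobenius-+ x y = begin
    (x +ᶠ y) ^ᶠ p                     ≡⟨ ^′≡^ᶠ (x +ᶠ y) p ⟨
    (x +ᶠ y) ^′ p                     ≡⟨ Binomial.theorem commutativeSemiring p x y ⟩
    Sum.sum (term p)                  ≡⟨ outer-terms p (ℕ.nonTrivial⇒nonZero p {{prime⇒nonTrivial pp}}) (λ k 0<k k<p → p∣⇒×ᶠ≡0 (prime∣C pp k 0<k k<p) _) ⟩
    y ^′ p +ᶠ x ^′ p                  ≡⟨ +ᶠ-comm _ _ ⟩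
    x ^′ p +ᶠ y ^′ p                  ≡⟨ cong₂ _+ᶠ_ (^′≡^ᶠ x p) (^′≡^ᶠ y p) ⟩
    x ^ᶠ p +ᶠ y ^ᶠ p                  ∎
    where
    open ≡-Reasoning
    term : ∀ m → Fin (suc m) → Carrier
    term m k = (m C toℕ k) ×ᶠ (x ^′ toℕ k *ᶠ y ^′ (m ∸ toℕ k))

    -- Stated for an arbitrary exponent, because splitting off the first and the last term requires
    -- matching the exponent as a successor, which is impossible for the variable p.
    outer-terms : ∀ m → NonZero m → (∀ k → 0 <ℕ k → k <ℕ m → (m C k) ×ᶠ (x ^′ k *ᶠ y ^′ (m ∸ k)) ≡ 0ᶠ) →
      Sum.sum (term m) ≡ y ^′ m +ᶠ x ^′ m
    outer-terms (suc m) _ inner = cong₂ _+ᶠ_ first (begin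
      Sum.sum (term (suc m) ∘ fs)                       ≡⟨ Sum.sum-init-last (term (suc m) ∘ fs) ⟩
      Sum.sum (term (suc m) ∘ fs ∘ inject₁) +ᶠ term (suc m) (fs (fromℕ m))
        ≡⟨ cong₂ _+ᶠ_ (trans (Sum.sum-cong-≗ inner′) (Sum.sum-replicate-zero m)) last ⟩
      0ᶠ +ᶠ x ^′ suc m                                  ≡⟨ +ᶠ-identityˡ _ ⟩
      x ^′ suc m                                        ∎)
      where
      first : term (suc m) f0 ≡ y ^′ suc m
      first = trans (×-homo-1 _) (*ᶠ-identityˡ _)

      inner′ : ∀ i → term (suc m) (fs (inject₁ i)) ≡ 0ᶠ
      inner′ i = inner (suc (toℕ (inject₁ i))) (s≤s z≤n) (s≤s (subst (_<ℕ m) (sym (Fin.toℕ-inject₁ i)) (Fin.toℕ<n i)))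

      last : term (suc m) (fs (fromℕ m)) ≡ x ^′ suc m
      last = begin
        term (suc m) (fs (fromℕ m))                                ≡⟨ cong (λ k → (suc m C suc k) ×ᶠ (x ^′ suc k *ᶠ y ^′ (m ∸ k))) (Fin.toℕ-fromℕ m) ⟩
        (suc m C suc m) ×ᶠ (x ^′ suc m *ᶠ y ^′ (m ∸ m))            ≡⟨ cong₂ (λ c k → c ×ᶠ (x ^′ suc m *ᶠ y ^′ k)) (nCn≡1 (suc m)) (ℕ.n∸n≡0 m) ⟩
        1 ×ᶠ (x ^′ suc m *ᶠ 1ᶠ)                                    ≡⟨ trans (×-homo-1 _) (*ᶠ-identityʳ _) ⟩
        x ^′ suc m                                                 ∎

  frobenius^-+ : ∀ k x y → (x +ᶠ y) ^ᶠ (p ^ k) ≡ x ^ᶠ (p ^ k) +ᶠ y ^ᶠ (p ^ k)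
  frobenius^-+ zero    x y = trans (*ᶠ-identityʳ _) (sym (cong₂ _+ᶠ_ (*ᶠ-identityʳ x) (*ᶠ-identityʳ y)))
  frobenius^-+ (suc k) x y = begin
    (x +ᶠ y) ^ᶠ (p *ℕ p ^ k)                          ≡⟨ ^ᶠ-* (x +ᶠ y) p (p ^ k) ⟩
    ((x +ᶠ y) ^ᶠ p) ^ᶠ (p ^ k)                        ≡⟨ cong (_^ᶠ (p ^ k)) (frobenius-+ x y) ⟩
    (x ^ᶠ p +ᶠ y ^ᶠ p) ^ᶠ (p ^ k)                     ≡⟨ frobenius^-+ k (x ^ᶠ p) (y ^ᶠ p) ⟩
    (x ^ᶠ p) ^ᶠ (p ^ k) +ᶠ (y ^ᶠ p) ^ᶠ (p ^ k)        ≡⟨ cong₂ _+ᶠ_ (^ᶠ-* x p (p ^ k)) (^ᶠ-* y p (p ^ k)) ⟨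
    x ^ᶠ (p *ℕ p ^ k) +ᶠ y ^ᶠ (p *ℕ p ^ k)            ∎
    where open ≡-Reasoning

-- The cubic extension: its cyclic group and a square root of -1.

parity : ∀ m → (∃[ k ] m ≡ k +ℕ k) ⊎ (∃[ k ] m ≡ suc (k +ℕ k))
parity zero = inj₁ (0 , refl)
parity (suc m) with parity m
... | inj₁ (k , refl) = inj₂ (k , refl)
... | inj₂ (k , refl) = inj₁ (suc k , cong suc (sym (ℕ.+-suc k k)))

-- The prime below q enters only through `frob-+`. That the characteristic is odd is recovered from
-- the order of α.
module Cubic (q : ℕ) (2≤q : 2 ≤ℕ q) (q%4≡1 : q % 4 ≡ 1) (q%3≢1 : ¬ (q % 3 ≡ 1))
  (E : FiniteField (q ^ 3)) (α : FiniteField.Carrier E) (prim : FiniteField.IsPrimitive E α)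
  (frob-+ : ∀ x y → FiniteField._^ᶠ_ E (FiniteField._+ᶠ_ E x y) q ≡ FiniteField._+ᶠ_ E (FiniteField._^ᶠ_ E x q) (FiniteField._^ᶠ_ E y q)) where
  open FiniteField E
  open FieldFacts E
  open Characters q E α

  3≤q³ : 3 ≤ℕ q ^ 3
  3≤q³ = ℕ.≤-trans (ℕ.m≤m+n 3 5) (ℕ.^-monoˡ-≤ 3 2≤q)

  open PrimitiveElement E α prim 3≤q³

  r N : ℕ
  r = q / 4
  N = q *ℕ q +ℕ q +ℕ 1

  q≡1+4r : q ≡ suc (r *ℕ 4)
  q≡1+4r = trans (ℕ/.m≡m%n+[m/n]*n q 4) (cong (_+ℕ r *ℕ 4) q%4≡1)

  q∸1≡4r : q ∸ 1 ≡ r *ℕ 4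
  q∸1≡4r = cong (_∸ 1) q≡1+4r

  M≡N[q∸1] : M ≡ N *ℕ (q ∸ 1)
  M≡N[q∸1] = begin
    -- Writing q as a successor removes the truncated subtraction and leaves a semiring identity.
    q ^ 3 ∸ 1                          ≡⟨ cong (λ k → k ^ 3 ∸ 1) q≡1+4r ⟩
    suc k ^ 3 ∸ 1                      ≡⟨ cong (_∸ 1) (cube k) ⟩
    (suc k *ℕ suc k +ℕ suc k +ℕ 1) *ℕ k  ≡⟨ cong₂ (λ a b → (a *ℕ a +ℕ a +ℕ 1) *ℕ b) q≡1+4r q∸1≡4r ⟨
    N *ℕ (q ∸ 1)                       ∎
    where
    open ≡-Reasoning
    k = r *ℕ 4
    cube : ∀ k → suc k *ℕ (suc k *ℕ (suc k *ℕ 1)) ≡ suc ((suc k *ℕ suc k +ℕ suc k +ℕ 1) *ℕ k)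
    cube = ℕRing.solve-∀

  M≡4Nr : M ≡ N *ℕ r *ℕ 4
  M≡4Nr = trans M≡N[q∸1] (trans (cong (N *ℕ_) q∸1≡4r) (sym (ℕ.*-assoc N r 4)))

  instance
    q∸1≢0 : NonZero (q ∸ 1)
    q∸1≢0 = ℕ.>-nonZero (ℕ.∸-monoˡ-≤ 1 2≤q)
    N≢0 : NonZero N
    N≢0 = ℕ.>-nonZero (ℕ.m≤n+m 1 (q *ℕ q +ℕ q))
    Nr≢0 : NonZero (N *ℕ r)
    Nr≢0 = ℕ.m*n≢0⇒m≢0 (N *ℕ r) {4} {{subst NonZero M≡4Nr M≢0}}

  -- I² = −1 because α has order 4Nr; in particular char E ≠ 2.
  I : Carrier
  I = α ^ᶠ (N *ℕ r)

  private
    I²-power : I *ᶠ I ≡ α ^ᶠ (N *ℕ r +ℕ N *ℕ r)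
    I²-power = sym (^ᶠ-+ α (N *ℕ r) (N *ℕ r))

    I⁴≡1 : I *ᶠ I *ᶠ (I *ᶠ I) ≡ 1ᶠ
    I⁴≡1 = begin
      I *ᶠ I *ᶠ (I *ᶠ I)   ≡⟨ cong₂ _*ᶠ_ I²-power I²-power ⟩
      _                    ≡⟨ ^ᶠ-+ α (N *ℕ r +ℕ N *ℕ r) (N *ℕ r +ℕ N *ℕ r) ⟨
      _                    ≡⟨ cong (α ^ᶠ_) (trans (quadruple (N *ℕ r)) (sym M≡4Nr)) ⟩
      α ^ᶠ M               ≡⟨ α^M≡1 ⟩
      1ᶠ                   ∎
      where
      open ≡-Reasoning
      quadruple : ∀ k → k +ℕ k +ℕ (k +ℕ k) ≡ k *ℕ 4
      quadruple = ℕRing.solve-∀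

    I²≢1 : I *ᶠ I ≢ 1ᶠ
    I²≢1 I²≡1 = ℕ.<⇒≱ (subst (N *ℕ r +ℕ N *ℕ r <ℕ_) (sym M≡4Nr) (double< (N *ℕ r)))
                      (ℕ∣.∣⇒≤ {{ℕ.>-nonZero (ℕ.<-≤-trans (ℕ.>-nonZero⁻¹ (N *ℕ r)) (ℕ.m≤m+n (N *ℕ r) _))}} (order _ (trans (sym I²-power) I²≡1)))
      where
      double< : ∀ k .{{_ : NonZero k}} → k +ℕ k <ℕ k *ℕ 4
      double< (suc k) = subst (suc k +ℕ suc k <ℕ_) (expand k) (ℕ.m<m+n _ (s≤s z≤n))
        where
        expand : ∀ k → suc k +ℕ suc k +ℕ suc (suc (k +ℕ k)) ≡ suc k *ℕ 4
        expand = ℕRing.solve-∀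

  I²≡-1 : I *ᶠ I ≡ -ᶠ 1ᶠ
  I²≡-1 = [ ⊥-elim ∘ I²≢1 ∘ -ᶠ-unique , (λ eq → -ᶠ-unique (trans (solve 1 (λ a → a :+ (:- (:- con 1ℤ)) := a :+ con 1ℤ) refl (I *ᶠ I)) eq)) ]′
    (zero-product (begin
      (I *ᶠ I -ᶠ 1ᶠ) *ᶠ (I *ᶠ I +ᶠ 1ᶠ)   ≡⟨ solve 1 (λ a → (a :+ (:- con 1ℤ)) :* (a :+ con 1ℤ) := a :* a :+ (:- con 1ℤ)) refl (I *ᶠ I) ⟩
      I *ᶠ I *ᶠ (I *ᶠ I) -ᶠ 1ᶠ          ≡⟨ -ᶠ-self I⁴≡1 ⟩
      0ᶠ                                ∎))
    where open ≡-Reasoning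

  2ᶠ : Carrier
  2ᶠ = 1ᶠ +ᶠ 1ᶠ

  2≢0 : 2ᶠ ≢ 0ᶠ
  2≢0 2≡0 = I²≢1 (trans I²≡-1 (-ᶠ-unique (begin
    (-ᶠ 1ᶠ) -ᶠ 1ᶠ  ≡⟨ solve 0 ((:- con 1ℤ) :+ (:- con 1ℤ) := :- (con 1ℤ :+ con 1ℤ)) refl ⟩
    -ᶠ 2ᶠ          ≡⟨ cong -ᶠ_ 2≡0 ⟩
    -ᶠ 0ᶠ          ≡⟨ solve 0 (:- con 0ℤ := con 0ℤ) refl ⟩
    0ᶠ             ∎)))
    where open ≡-Reasoning

  x≢-x : ∀ {x} → x ≢ 0ᶠ → x ≢ -ᶠ x
  x≢-x {x} x≢0 x≡-x = *ᶠ-nonzero 2≢0 x≢0 (begin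
    2ᶠ *ᶠ x         ≡⟨ solve 1 (λ x → (con 1ℤ :+ con 1ℤ) :* x := x :+ (:- (:- x))) refl x ⟩
    x -ᶠ (-ᶠ x)     ≡⟨ -ᶠ-self x≡-x ⟩
    0ᶠ              ∎)
    where open ≡-Reasoning

  same-square : ∀ {x y} → x *ᶠ x ≡ y *ᶠ y → x ≡ y ⊎ x ≡ -ᶠ y
  same-square {x} {y} eq = [ inj₁ ∘ -ᶠ-unique , (λ s → inj₂ (-ᶠ-unique (trans (solve 2 (λ x y → x :+ (:- (:- y)) := x :+ y) refl x y) s))) ]′
    (zero-product (trans (solve 2 (λ x y → (x :+ (:- y)) :* (x :+ y) := x :* x :+ (:- (y :* y))) refl x y) (-ᶠ-self eq)))

  ∑-square-root : ∀ (f : Carrier → ℤ) {w} → w ≢ 0ᶠ → ∑ (λ c → 𝟙 (c *ᶠ c ≟ᶠ w *ᶠ w) * f c) ≡ f w + f (-ᶠ w)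
  ∑-square-root f {w} w≢0 = begin
    ∑ (λ c → 𝟙 (c *ᶠ c ≟ᶠ w *ᶠ w) * f c)                         ≡⟨ ∑-cong split ⟩
    ∑ (λ c → 𝟙 (c ≟ᶠ w) * f c + 𝟙 (c ≟ᶠ (-ᶠ w)) * f c)            ≡⟨ ∑-+ (λ c → 𝟙 (c ≟ᶠ w) * f c) (λ c → 𝟙 (c ≟ᶠ (-ᶠ w)) * f c) ⟩
    ∑ (λ c → 𝟙 (c ≟ᶠ w) * f c) + ∑ (λ c → 𝟙 (c ≟ᶠ (-ᶠ w)) * f c)  ≡⟨ cong₂ _+_ (∑-δ f w) (∑-δ f (-ᶠ w)) ⟩
    f w + f (-ᶠ w)                                              ∎
    where
    open ≡-Reasoning
    indicator : ∀ c (d : Dec (c *ᶠ c ≡ w *ᶠ w)) → 𝟙 d ≡ 𝟙 (c ≟ᶠ w) + 𝟙 (c ≟ᶠ (-ᶠ w))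
    indicator c (no c²≢) = sym (cong₂ _+_ (𝟙-false (c ≟ᶠ w) λ c≡w → c²≢ (cong (λ a → a *ᶠ a) c≡w))
      (𝟙-false (c ≟ᶠ (-ᶠ w)) λ c≡-w → c²≢ (trans (cong (λ a → a *ᶠ a) c≡-w) (solve 1 (λ w → (:- w) :* (:- w) := w :* w) refl w))))
    indicator c (yes c²≡) = [ at-w , at--w ]′ (same-square c²≡)
      where
      at-w : c ≡ w → 1ℤ ≡ 𝟙 (c ≟ᶠ w) + 𝟙 (c ≟ᶠ (-ᶠ w))
      at-w c≡w = sym (cong₂ _+_ (𝟙-true (c ≟ᶠ w) c≡w) (𝟙-false (c ≟ᶠ (-ᶠ w)) λ c≡-w → x≢-x w≢0 (trans (sym c≡w) c≡-w)))
      at--w : c ≡ -ᶠ w → 1ℤ ≡ 𝟙 (c ≟ᶠ w) + 𝟙 (c ≟ᶠ (-ᶠ w))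
      at--w c≡-w = sym (cong₂ _+_ (𝟙-false (c ≟ᶠ w) λ c≡w → x≢-x w≢0 (trans (sym c≡w) c≡-w)) (𝟙-true (c ≟ᶠ (-ᶠ w)) c≡-w))
    split : ∀ c → 𝟙 (c *ᶠ c ≟ᶠ w *ᶠ w) * f c ≡ 𝟙 (c ≟ᶠ w) * f c + 𝟙 (c ≟ᶠ (-ᶠ w)) * f c
    split c = trans (cong (_* f c) (indicator c (c *ᶠ c ≟ᶠ w *ᶠ w))) (ℤ.*-distribʳ-+ (f c) (𝟙 (c ≟ᶠ w)) (𝟙 (c ≟ᶠ (-ᶠ w))))

  -- The quartic and the quadratic character.

  ipowℕ-cong : ∀ i j → α ^ᶠ i ≡ α ^ᶠ j → ipowℕ i ≡ ipowℕ j
  ipowℕ-cong i j eq = [ (λ i≤j → sym (go i≤j eq)) , (λ j≤i → go j≤i (sym eq)) ]′ (ℕ.≤-total i j)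
    where
    go : ∀ {i j} → i ≤ℕ j → α ^ᶠ i ≡ α ^ᶠ j → ipowℕ j ≡ ipowℕ i
    go {i} {j} i≤j eq = begin
      ipowℕ j                       ≡⟨ cong ipowℕ (ℕ.m+[n∸m]≡n i≤j) ⟨
      ipowℕ (i +ℕ (j ∸ i))          ≡⟨ ipowℕ-+ i (j ∸ i) ⟩
      -- The difference of the exponents is a multiple of M = 4Nr, hence of 4. Thus χ₄ does not
      -- depend on which exponent the search returns.
      ipowℕ i ·c ipowℕ (j ∸ i)      ≡⟨ cong (ipowℕ i ·c_) (ipowℕ-4∣ (ℕ∣.∣-trans (divides (N *ℕ r) M≡4Nr) (order (j ∸ i) (α^-∸ i≤j eq)))) ⟩
      ipowℕ i ·c c1                 ≡⟨ trans (·c-comm (ipowℕ i) c1) (·c-identityˡ (ipowℕ i)) ⟩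
      ipowℕ i                       ∎
      where open ≡-Reasoning

  dlog-α^ : ∀ m → ∃[ j ] dlog (α ^ᶠ m) ≡ just j × α ^ᶠ j ≡ α ^ᶠ m
  -- Reducing m modulo M provides an exponent below the search bound q³.
  dlog-α^ m with search-finds (λ j → does ((α ^ᶠ j) ≟ᶠ (α ^ᶠ m))) (q ^ 3) {m % M}
                   (ℕ.<-trans (ℕ/.m%n<n m M) (subst (M <ℕ_) (sym n≡1+M) (ℕ.n<1+n M)))
                   (does-true (α ^ᶠ (m % M) ≟ᶠ α ^ᶠ m) (α^-% M α^M≡1 m))
    where
    does-true : ∀ {P : Set} (d : Dec P) → P → does d ≡ true
    does-true (yes _) _ = refl
    does-true (no ¬p) p = contradiction p ¬p
  ... | j , found , hit = j , found , true-does (α ^ᶠ j ≟ᶠ α ^ᶠ m) hit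
    where
    true-does : ∀ {P : Set} (d : Dec P) → does d ≡ true → P
    true-does (yes p) _ = p

  χ₄-α^ : ∀ m → χ₄ (α ^ᶠ m) ≡ ipowℕ m
  χ₄-α^ m with α ^ᶠ m ≟ᶠ 0ᶠ
  ... | yes eq = contradiction eq (α^-nonzero m)
  ... | no _ with dlog (α ^ᶠ m) | dlog-α^ m
  ...   | _ | j , refl , α^j≡α^m = ipowℕ-cong j m α^j≡α^m

  χ₄-0 : χ₄ 0ᶠ ≡ czero
  χ₄-0 with 0ᶠ ≟ᶠ 0ᶠ
  ... | yes _  = refl
  ... | no 0≢0 = contradiction refl 0≢0

  χ₄-* : ∀ x y → χ₄ (x *ᶠ y) ≡ χ₄ x ·c χ₄ y
  χ₄-* x y = go (x ≟ᶠ 0ᶠ) (y ≟ᶠ 0ᶠ)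
    where
    open ≡-Reasoning
    go : Dec (x ≡ 0ᶠ) → Dec (y ≡ 0ᶠ) → χ₄ (x *ᶠ y) ≡ χ₄ x ·c χ₄ y
    go (yes refl) _    = trans (cong χ₄ (*ᶠ-zeroˡ y)) (trans χ₄-0 (cong (_·c χ₄ y) (sym χ₄-0)))
    go (no _) (yes refl) = trans (cong χ₄ (*ᶠ-zeroʳ x)) (trans χ₄-0 (sym (trans (cong (χ₄ x ·c_) χ₄-0) (·c-zeroʳ (χ₄ x)))))
    go (no x≢0) (no y≢0) = let i , α^i≡x = prim x x≢0 ; j , α^j≡y = prim y y≢0 in begin
      χ₄ (x *ᶠ y)                    ≡⟨ cong₂ (λ a b → χ₄ (a *ᶠ b)) α^i≡x α^j≡y ⟨
      χ₄ (α ^ᶠ i *ᶠ α ^ᶠ j)          ≡⟨ cong χ₄ (^ᶠ-+ α i j) ⟨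
      χ₄ (α ^ᶠ (i +ℕ j))             ≡⟨ χ₄-α^ (i +ℕ j) ⟩
      ipowℕ (i +ℕ j)                 ≡⟨ ipowℕ-+ i j ⟩
      ipowℕ i ·c ipowℕ j             ≡⟨ cong₂ _·c_ (χ₄-α^ i) (χ₄-α^ j) ⟨
      χ₄ (α ^ᶠ i) ·c χ₄ (α ^ᶠ j)     ≡⟨ cong₂ (λ a b → χ₄ a ·c χ₄ b) α^i≡x α^j≡y ⟩
      χ₄ x ·c χ₄ y                   ∎

  χ₄-unit : ∀ {x} → x ≢ 0ᶠ → ∃[ a ] χ₄ x ≡ ipow a
  χ₄-unit {x} x≢0 with prim x x≢0
  ... | m , refl = let a , eq = ipowℕ-unit m in a , trans (χ₄-α^ m) eq

  X : Carrier → ℤ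
  X x = re (χ₂ x)

  X-0 : X 0ᶠ ≡ 0ℤ
  X-0 = cong (λ c → re (c ·c c)) χ₄-0

  X-χ₄ : ∀ x → X x ≡ re (χ₄ (x *ᶠ x))
  X-χ₄ x = cong re (sym (χ₄-* x x))

  X-* : ∀ x y → X (x *ᶠ y) ≡ X x * X y
  X-* x y = begin
    re (χ₄ (x *ᶠ y) ·c χ₄ (x *ᶠ y))       ≡⟨ cong re (χ₄-* (x *ᶠ y) (x *ᶠ y)) ⟨
    re (χ₄ (x *ᶠ y *ᶠ (x *ᶠ y)))          ≡⟨ cong (re ∘ χ₄) (solve 2 (λ x y → x :* y :* (x :* y) := x :* x :* (y :* y)) refl x y) ⟩
    re (χ₄ (x *ᶠ x *ᶠ (y *ᶠ y)))          ≡⟨ cong re (trans (χ₄-* (x *ᶠ x) (y *ᶠ y)) (cong₂ _·c_ (χ₄-* x x) (χ₄-* y y))) ⟩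
    re (χ₂ x ·c χ₂ y)                     ≡⟨ re-square-· (χ₄ x) (χ₂ y) ⟩
    X x * X y                             ∎
    where open ≡-Reasoning

  X-square : ∀ {x} → x ≢ 0ᶠ → X (x *ᶠ x) ≡ 1ℤ
  X-square {x} x≢0 with χ₄-unit x≢0
  ... | a , eq = begin
    X (x *ᶠ x)                               ≡⟨ X-* x x ⟩
    X x * X x                                ≡⟨ cong (λ c → re (c ·c c) * re (c ·c c)) eq ⟩
    re (ipow (a +₄ a)) * re (ipow (a +₄ a))  ≡⟨ go a ⟩
    1ℤ                                       ∎
    where
    open ≡-Reasoning
    go : ∀ a → re (ipow (a +₄ a)) * re (ipow (a +₄ a)) ≡ 1ℤ
    go = from-yes (Fin.all? λ a → (re (ipow (a +₄ a)) * re (ipow (a +₄ a))) ℤ.≟ 1ℤ)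

  X-α : X α ≡ -1ℤ
  X-α = trans (cong X (sym (*ᶠ-identityʳ α))) (cong (λ c → re (c ·c c)) (χ₄-α^ 1))

  X-odd-power : ∀ k → X (α ^ᶠ suc (k +ℕ k)) ≡ -1ℤ
  X-odd-power k = trans (X-* α (α ^ᶠ (k +ℕ k))) (cong₂ _*_ X-α (trans (cong X (^ᶠ-+ α k k)) (X-square (α^-nonzero k))))

  square-or-nonsquare : ∀ {x} → x ≢ 0ᶠ → (∃[ w ] w ≢ 0ᶠ × x ≡ w *ᶠ w) ⊎ X x ≡ -1ℤ
  square-or-nonsquare {x} x≢0 with prim x x≢0
  ... | m , refl with parity m
  ...   | inj₁ (k , refl) = inj₁ (α ^ᶠ k , α^-nonzero k , ^ᶠ-+ α k k)
  ...   | inj₂ (k , refl) = inj₂ (X-odd-power k)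

  count-square-roots : ∀ d → ∑ (λ y → 𝟙 (y *ᶠ y ≟ᶠ d)) ≡ 1ℤ + X d
  count-square-roots d = go (d ≟ᶠ 0ᶠ)
    where
    open ≡-Reasoning
    nonzero-case : (∃[ w ] w ≢ 0ᶠ × d ≡ w *ᶠ w) ⊎ X d ≡ -1ℤ → ∑ (λ y → 𝟙 (y *ᶠ y ≟ᶠ d)) ≡ 1ℤ + X d
    nonzero-case (inj₁ (w , w≢0 , refl)) = begin
      ∑ (λ y → 𝟙 (y *ᶠ y ≟ᶠ w *ᶠ w))         ≡⟨ ∑-cong (λ y → ℤ.*-identityʳ (𝟙 (y *ᶠ y ≟ᶠ w *ᶠ w))) ⟨
      ∑ (λ y → 𝟙 (y *ᶠ y ≟ᶠ w *ᶠ w) * 1ℤ)    ≡⟨ ∑-square-root (λ _ → 1ℤ) w≢0 ⟩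
      1ℤ + 1ℤ                                ≡⟨ cong (1ℤ +_) (X-square w≢0) ⟨
      1ℤ + X (w *ᶠ w)                        ∎
    nonzero-case (inj₂ X≡-1) = begin
      ∑ (λ y → 𝟙 (y *ᶠ y ≟ᶠ d))              ≡⟨ ∑-cong (λ y → 𝟙-false (y *ᶠ y ≟ᶠ d) (not-square y)) ⟩
      ∑ (λ _ → 0ℤ)                           ≡⟨ trans (∑-const 0ℤ) (ℤ.*-zeroʳ (ℤ+ (q ^ 3))) ⟩
      0ℤ                                     ≡⟨ cong (1ℤ +_) X≡-1 ⟨
      1ℤ + X d                               ∎
      where
      X-square-≢-1 : ∀ y → Dec (y ≡ 0ᶠ) → X (y *ᶠ y) ≢ -1ℤ
      X-square-≢-1 y (yes refl) eq = case trans (sym eq) (trans (cong X (*ᶠ-zeroˡ 0ᶠ)) X-0) of λ ()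
      X-square-≢-1 y (no y≢0)   eq = case trans (sym eq) (X-square y≢0) of λ ()
      not-square : ∀ y → y *ᶠ y ≢ d
      not-square y refl = X-square-≢-1 y (y ≟ᶠ 0ᶠ) X≡-1
    go : Dec (d ≡ 0ᶠ) → ∑ (λ y → 𝟙 (y *ᶠ y ≟ᶠ d)) ≡ 1ℤ + X d
    go (yes refl) = begin
      ∑ (λ y → 𝟙 (y *ᶠ y ≟ᶠ 0ᶠ))    ≡⟨ ∑-cong (λ y → 𝟙-cong (y *ᶠ y ≟ᶠ 0ᶠ) (y ≟ᶠ 0ᶠ) (λ eq → [ id , id ]′ (zero-product eq)) λ { refl → *ᶠ-zeroˡ _ }) ⟩
      ∑ (λ y → 𝟙 (y ≟ᶠ 0ᶠ))         ≡⟨ ∑-δ₁ 0ᶠ ⟩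
      1ℤ                            ≡⟨ cong (1ℤ +_) X-0 ⟨
      1ℤ + X 0ᶠ                     ∎
    go (no d≢0) = nonzero-case (square-or-nonsquare d≢0)

  ∑-squares : ∀ (f : Carrier → ℤ) → ∑ (λ y → f (y *ᶠ y)) ≡ ∑ (λ z → f z * (1ℤ + X z))
  ∑-squares f = begin
    ∑ (λ y → f (y *ᶠ y))                               ≡⟨ ∑-cong (λ y → ∑-δ f (y *ᶠ y)) ⟨
    ∑ (λ y → ∑ (λ z → 𝟙 (z ≟ᶠ y *ᶠ y) * f z))           ≡⟨ ∑-swap (λ y z → 𝟙 (z ≟ᶠ y *ᶠ y) * f z) ⟩
    ∑ (λ z → ∑ (λ y → 𝟙 (z ≟ᶠ y *ᶠ y) * f z))           ≡⟨ ∑-cong (λ z → trans (∑-*ʳ (f z) (λ y → 𝟙 (z ≟ᶠ y *ᶠ y))) (trans (ℤ.*-comm (∑ (λ y → 𝟙 (z ≟ᶠ y *ᶠ y))) (f z)) (cong (f z *_) (trans (∑-cong λ y → 𝟙-cong (z ≟ᶠ y *ᶠ y) (y *ᶠ y ≟ᶠ z) sym sym) (count-square-roots z))))) ⟩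
    ∑ (λ z → f z * (1ℤ + X z))                         ∎
    where open ≡-Reasoning

  -- The subfield F and the trace.

  φ : Carrier → Carrier
  φ x = x ^ᶠ q

  -- F is encoded inside E as the fixed points of x ↦ x^q, since the traces are elements of E.
  -- Membership is decidable, so a sum over F is a sum over E weighted by `𝟙 (InF? c)`.
  InF : Carrier → Set
  InF c = φ c ≡ c

  InF? : ∀ c → Dec (InF c)
  InF? c = φ c ≟ᶠ c

  φ-* : ∀ x y → φ (x *ᶠ y) ≡ φ x *ᶠ φ y
  φ-* x y = *ᶠ-^ᶠ x y q

  φ-0 : φ 0ᶠ ≡ 0ᶠ
  φ-0 = begin
    φ 0ᶠ                     ≡⟨ solve 1 (λ a → a := a :+ a :+ (:- a)) refl (φ 0ᶠ) ⟩
    φ 0ᶠ +ᶠ φ 0ᶠ -ᶠ φ 0ᶠ     ≡⟨ -ᶠ-self (trans (sym (frob-+ 0ᶠ 0ᶠ)) (cong φ (+ᶠ-identityˡ 0ᶠ))) ⟩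
    0ᶠ                       ∎
    where open ≡-Reasoning

  φ-neg : ∀ x → φ (-ᶠ x) ≡ -ᶠ φ x
  φ-neg x = -ᶠ-unique (begin
    φ (-ᶠ x) -ᶠ (-ᶠ φ x)   ≡⟨ solve 2 (λ a b → b :+ (:- (:- a)) := a :+ b) refl (φ x) (φ (-ᶠ x)) ⟩
    φ x +ᶠ φ (-ᶠ x)        ≡⟨ frob-+ x (-ᶠ x) ⟨
    φ (x -ᶠ x)             ≡⟨ trans (cong φ (+ᶠ-inverseʳ x)) φ-0 ⟩
    0ᶠ                     ∎)
    where open ≡-Reasoning

  φ-injective-0 : ∀ {x} → φ x ≡ 0ᶠ → x ≡ 0ᶠ
  φ-injective-0 {x} φx≡0 with x ≟ᶠ 0ᶠ
  ... | yes x≡0 = x≡0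
  ... | no x≢0  = contradiction φx≡0 (^ᶠ-nonzero q x≢0)

  φ³ : ∀ x → φ (φ (φ x)) ≡ x
  φ³ x = begin
    ((x ^ᶠ q) ^ᶠ q) ^ᶠ q      ≡⟨ cong (_^ᶠ q) (^ᶠ-* x q q) ⟨
    (x ^ᶠ (q *ℕ q)) ^ᶠ q      ≡⟨ ^ᶠ-* x (q *ℕ q) q ⟨
    x ^ᶠ (q *ℕ q *ℕ q)        ≡⟨ cong (x ^ᶠ_) (trans (ℕ.*-assoc q q q) (cong (λ k → q *ℕ (q *ℕ k)) (sym (ℕ.*-identityʳ q)))) ⟩
    x ^ᶠ (q ^ 3)              ≡⟨ x^n≡x x ⟩
    x                         ∎
    where open ≡-Reasoning

  T≡ : ∀ x → T x ≡ x +ᶠ φ x +ᶠ φ (φ x)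
  T≡ x = cong (x +ᶠ φ x +ᶠ_) (^ᶠ-* x q q)

  T-+ : ∀ x y → T (x +ᶠ y) ≡ T x +ᶠ T y
  T-+ x y = begin
    T (x +ᶠ y)                                                   ≡⟨ T≡ (x +ᶠ y) ⟩
    x +ᶠ y +ᶠ φ (x +ᶠ y) +ᶠ φ (φ (x +ᶠ y))                       ≡⟨ cong₂ (λ a b → x +ᶠ y +ᶠ a +ᶠ b) (frob-+ x y) (trans (cong φ (frob-+ x y)) (frob-+ (φ x) (φ y))) ⟩
    x +ᶠ y +ᶠ (φ x +ᶠ φ y) +ᶠ (φ (φ x) +ᶠ φ (φ y))               ≡⟨ solve 6 (λ a b c d e f → a :+ b :+ (c :+ d) :+ (e :+ f) := (a :+ c :+ e) :+ (b :+ d :+ f)) refl x y (φ x) (φ y) (φ (φ x)) (φ (φ y)) ⟩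
    x +ᶠ φ x +ᶠ φ (φ x) +ᶠ (y +ᶠ φ y +ᶠ φ (φ y))                 ≡⟨ cong₂ _+ᶠ_ (T≡ x) (T≡ y) ⟨
    T x +ᶠ T y                                                   ∎
    where open ≡-Reasoning

  T-* : ∀ {c} → InF c → ∀ x → T (c *ᶠ x) ≡ c *ᶠ T x
  T-* {c} c∈F x = begin
    T (c *ᶠ x)                                         ≡⟨ T≡ (c *ᶠ x) ⟩
    c *ᶠ x +ᶠ φ (c *ᶠ x) +ᶠ φ (φ (c *ᶠ x))             ≡⟨ cong₂ (λ a b → c *ᶠ x +ᶠ a +ᶠ b) (φ-c x) (trans (cong φ (φ-c x)) (φ-c (φ x))) ⟩
    c *ᶠ x +ᶠ c *ᶠ φ x +ᶠ c *ᶠ φ (φ x)                 ≡⟨ solve 4 (λ c x y z → c :* x :+ c :* y :+ c :* z := c :* (x :+ y :+ z)) refl c x (φ x) (φ (φ x)) ⟩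
    c *ᶠ (x +ᶠ φ x +ᶠ φ (φ x))                         ≡⟨ cong (c *ᶠ_) (T≡ x) ⟨
    c *ᶠ T x                                           ∎
    where
    open ≡-Reasoning
    φ-c : ∀ y → φ (c *ᶠ y) ≡ c *ᶠ φ y
    φ-c y = trans (φ-* c y) (cong (_*ᶠ φ y) c∈F)

  T∈F : ∀ x → InF (T x)
  T∈F x = begin
    φ (T x)                              ≡⟨ cong φ (T≡ x) ⟩
    φ (x +ᶠ φ x +ᶠ φ (φ x))              ≡⟨ trans (frob-+ _ _) (cong (_+ᶠ φ (φ (φ x))) (frob-+ _ _)) ⟩
    φ x +ᶠ φ (φ x) +ᶠ φ (φ (φ x))        ≡⟨ cong (φ x +ᶠ φ (φ x) +ᶠ_) (φ³ x) ⟩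
    φ x +ᶠ φ (φ x) +ᶠ x                  ≡⟨ solve 3 (λ a b c → b :+ c :+ a := a :+ b :+ c) refl x (φ x) (φ (φ x)) ⟩
    x +ᶠ φ x +ᶠ φ (φ x)                  ≡⟨ T≡ x ⟨
    T x                                  ∎
    where open ≡-Reasoning

  1∈F : InF 1ᶠ
  1∈F = 1^ᶠ q

  +∈F : ∀ {c d} → InF c → InF d → InF (c +ᶠ d)
  +∈F {c} {d} c∈F d∈F = trans (frob-+ c d) (cong₂ _+ᶠ_ c∈F d∈F)

  *∈F : ∀ {c d} → InF c → InF d → InF (c *ᶠ d)
  *∈F {c} {d} c∈F d∈F = trans (φ-* c d) (cong₂ _*ᶠ_ c∈F d∈F)

  -∈F : ∀ {c} → InF c → InF (-ᶠ c)
  -∈F {c} c∈F = trans (φ-neg c) (cong -ᶠ_ c∈F)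

  φ-⁻¹ : ∀ {c} → c ≢ 0ᶠ → φ c *ᶠ φ (c ⁻¹) ≡ 1ᶠ
  φ-⁻¹ {c} c≢0 = trans (sym (φ-* c (c ⁻¹))) (trans (cong φ (inverseʳ c c≢0)) 1∈F)

  ⁻¹∈F : ∀ {c} → c ≢ 0ᶠ → InF c → InF (c ⁻¹)
  ⁻¹∈F {c} c≢0 c∈F = *ᶠ-cancelˡ c≢0 (trans (cong (_*ᶠ φ (c ⁻¹)) (sym c∈F)) (trans (φ-⁻¹ c≢0) (sym (inverseʳ c c≢0))))

  -- φ w = −w would give w = φ³ w = −w: the degree 3 is odd.
  square-root∈F : ∀ {w} → w ≢ 0ᶠ → InF (w *ᶠ w) → InF w
  square-root∈F {w} w≢0 w²∈F = [ id , ⊥-elim ∘ odd ]′ (same-square (trans (sym (φ-* w w)) w²∈F))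
    where
    odd : φ w ≢ -ᶠ w
    odd φw≡-w = x≢-x w≢0 (begin
      w                ≡⟨ φ³ w ⟨
      φ (φ (φ w))      ≡⟨ cong (φ ∘ φ) φw≡-w ⟩
      φ (φ (-ᶠ w))     ≡⟨ cong φ (trans (φ-neg w) (trans (cong -ᶠ_ φw≡-w) (solve 1 (λ w → :- (:- w) := w) refl w))) ⟩
      φ w              ≡⟨ φw≡-w ⟩
      -ᶠ w             ∎)
      where open ≡-Reasoning

  T-0 : T 0ᶠ ≡ 0ᶠ
  T-0 = trans (T≡ 0ᶠ) (trans (cong₂ (λ a b → 0ᶠ +ᶠ a +ᶠ b) φ-0 (trans (cong φ φ-0) φ-0)) (solve 0 (con 0ℤ :+ con 0ℤ :+ con 0ℤ := con 0ℤ) refl))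

  -- A fixed power satisfies α^(m(q - 1)) = 1, so N(q - 1) divides m(q - 1).
  α^∈F⇒N∣ : ∀ m → InF (α ^ᶠ m) → N ∣ m
  α^∈F⇒N∣ m m∈F = ℕ∣.*-cancelʳ-∣ (q ∸ 1) (subst₂ _∣_ M≡N[q∸1] exponent
      (order (m *ℕ q ∸ m) (α^-∸ (ℕ.m≤m*n m q {{ℕ.>-nonZero (ℕ.<⇒≤ 2≤q)}}) (sym (trans (^ᶠ-* α m q) m∈F)))))
    where
    exponent : m *ℕ q ∸ m ≡ m *ℕ (q ∸ 1)
    exponent = sym (trans (ℕ.*-distribˡ-∸ m q 1) (cong (m *ℕ q ∸_) (ℕ.*-identityʳ m)))

  N∣⇒α^∈F : ∀ {m} → N ∣ m → InF (α ^ᶠ m)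
  N∣⇒α^∈F {m} (divides k refl) = begin
    (α ^ᶠ m) ^ᶠ q                        ≡⟨ cong ((α ^ᶠ m) ^ᶠ_) (ℕ.m+[n∸m]≡n (ℕ.<⇒≤ 2≤q)) ⟨
    α ^ᶠ m *ᶠ (α ^ᶠ m) ^ᶠ (q ∸ 1)        ≡⟨ cong (α ^ᶠ m *ᶠ_) (^ᶠ-* α m (q ∸ 1)) ⟨
    α ^ᶠ m *ᶠ α ^ᶠ (m *ℕ (q ∸ 1))        ≡⟨ cong (α ^ᶠ m *ᶠ_) (M∣⇒α^≡1 (divides k (trans (ℕ.*-assoc k N (q ∸ 1)) (cong (k *ℕ_) (sym M≡N[q∸1]))))) ⟩
    α ^ᶠ m *ᶠ 1ᶠ                         ≡⟨ *ᶠ-identityʳ _ ⟩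
    α ^ᶠ m                               ∎
    where open ≡-Reasoning

  1<N : 1 <ℕ N
  1<N = ℕ.<-≤-trans (ℕ.≤-trans 2≤q (ℕ.m≤n+m q (q *ℕ q))) (ℕ.m≤m+n (q *ℕ q +ℕ q) 1)

  α∉F : ¬ InF α
  α∉F α∈F = ℕ.<⇒≱ 1<N (ℕ∣.∣⇒≤ (α^∈F⇒N∣ 1 (subst InF (sym (*ᶠ-identityʳ α)) α∈F)))

  -- If T vanished identically, so would αT(x) − T(αx) = (α − φα) φx + (α − φ²α) φ²x; the values at
  -- x = 1 and x = α force φα = α.
  T-nonzero : ∃[ z ] T z ≢ 0ᶠ
  T-nonzero with Fin.any? (λ i → ¬? (T (element i) ≟ᶠ 0ᶠ))
  ... | yes (i , T≢0) = element i , T≢0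
  ... | no all-zero   = contradiction (sym (-ᶠ-unique u≡0)) α∉F
    where
    open ≡-Reasoning
    T≡0 : ∀ x → T x ≡ 0ᶠ
    T≡0 x with T x ≟ᶠ 0ᶠ
    ... | yes eq = eq
    ... | no neq = contradiction (index x , subst (λ z → T z ≢ 0ᶠ) (sym (strictlyInverseˡ x)) neq) all-zero
    u v : Carrier
    u = α -ᶠ φ α
    v = α -ᶠ φ (φ α)
    relation : ∀ x → u *ᶠ φ x +ᶠ v *ᶠ φ (φ x) ≡ 0ᶠ
    relation x = begin
      u *ᶠ φ x +ᶠ v *ᶠ φ (φ x)
        ≡⟨ solve 6 (λ a b c x y z → (a :+ (:- b)) :* y :+ (a :+ (:- c)) :* z := a :* (x :+ y :+ z) :+ (:- (a :* x :+ b :* y :+ c :* z))) refl α (φ α) (φ (φ α)) x (φ x) (φ (φ x)) ⟩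
      α *ᶠ (x +ᶠ φ x +ᶠ φ (φ x)) -ᶠ (α *ᶠ x +ᶠ φ α *ᶠ φ x +ᶠ φ (φ α) *ᶠ φ (φ x))
        ≡⟨ cong₂ (λ s t → α *ᶠ s -ᶠ t) (trans (sym (T≡ x)) (T≡0 x))
             (trans (sym (trans (T≡ (α *ᶠ x)) (cong₂ (λ s t → α *ᶠ x +ᶠ s +ᶠ t) (φ-* α x) (trans (cong φ (φ-* α x)) (φ-* (φ α) (φ x)))))) (T≡0 (α *ᶠ x))) ⟩
      α *ᶠ 0ᶠ -ᶠ 0ᶠ
        ≡⟨ solve 1 (λ a → a :* con 0ℤ :+ (:- con 0ℤ) := con 0ℤ) refl α ⟩
      0ᶠ ∎
    u+v≡0 : u *ᶠ 1ᶠ +ᶠ v *ᶠ 1ᶠ ≡ 0ᶠ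
    u+v≡0 = trans (cong₂ (λ s t → u *ᶠ s +ᶠ v *ᶠ t) (sym 1∈F) (sym (trans (cong φ 1∈F) 1∈F))) (relation 1ᶠ)
    φu : φ u ≡ φ α -ᶠ φ (φ α)
    φu = trans (frob-+ α (-ᶠ φ α)) (cong (φ α +ᶠ_) (φ-neg (φ α)))
    u≡0 : u ≡ 0ᶠ
    u≡0 = [ id , φ-injective-0 ]′ (zero-product (begin
      u *ᶠ φ u                                                     ≡⟨ cong (u *ᶠ_) φu ⟩
      u *ᶠ (φ α -ᶠ φ (φ α))                                        ≡⟨ solve 4 (λ u v b c → u :* (b :+ (:- c)) := u :* b :+ v :* c :+ (:- ((u :* con 1ℤ :+ v :* con 1ℤ) :* c))) refl u v (φ α) (φ (φ α)) ⟩
      u *ᶠ φ α +ᶠ v *ᶠ φ (φ α) -ᶠ (u *ᶠ 1ᶠ +ᶠ v *ᶠ 1ᶠ) *ᶠ φ (φ α)  ≡⟨ cong₂ (λ s t → s -ᶠ t *ᶠ φ (φ α)) (relation α) u+v≡0 ⟩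
      0ᶠ -ᶠ 0ᶠ *ᶠ φ (φ α)                                          ≡⟨ solve 1 (λ a → con 0ℤ :+ (:- (con 0ℤ :* a)) := con 0ℤ) refl (φ (φ α)) ⟩
      0ᶠ                                                           ∎))

  T-one : ∃[ z ] T z ≡ 1ᶠ
  T-one = let z , Tz≢0 = T-nonzero in
    (T z) ⁻¹ *ᶠ z , trans (T-* (⁻¹∈F Tz≢0 (T∈F z)) z) (inverseˡ (T z) Tz≢0)

  -- The sizes of F and of the fibres of the trace.

  Q : ℤ
  Q = ℤ+ q

  cube≡ : ℤ+ (q ^ 3) ≡ Q * (Q * Q)
  cube≡ = trans (ℤ.pos-* q (q *ℕ (q *ℕ 1))) (cong (Q *_) (trans (cong (λ k → ℤ+ (q *ℕ k)) (ℕ.*-identityʳ q)) (ℤ.pos-* q q)))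

  instance
    Q≢0 : Data.Integer.NonZero Q
    Q≢0 = ℕ.>-nonZero (ℕ.<⇒≤ 2≤q)

  α^-injective : ∀ {i j} → i <ℕ M → j <ℕ M → α ^ᶠ i ≡ α ^ᶠ j → i ≡ j
  α^-injective {i} {j} i<M j<M eq =
    [ (λ i≤j → go i≤j j<M eq) , (λ j≤i → sym (go j≤i i<M (sym eq))) ]′ (ℕ.≤-total i j)
    where
    go : ∀ {i j} → i ≤ℕ j → j <ℕ M → α ^ᶠ i ≡ α ^ᶠ j → i ≡ j
    go {i} {j} i≤j j<M eq = ∣difference⇒≡ i≤j j<M (order (j ∸ i) (α^-∸ i≤j eq))

  -- F* is generated by α^N, of order q - 1, so 0 together with the `β j` enumerates F without
  -- repetition.
  count-F : ∑ (λ c → 𝟙 (InF? c)) ≡ Q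
  count-F = begin
    ∑ (λ c → 𝟙 (InF? c))                                                     ≡⟨ ∑-cong (λ c → pointwise c (c ≟ᶠ 0ᶠ)) ⟩
    ∑ (λ c → 𝟙 (c ≟ᶠ 0ᶠ) + sum (λ j → 𝟙 (c ≟ᶠ β j)))                         ≡⟨ ∑-+ (λ c → 𝟙 (c ≟ᶠ 0ᶠ)) (λ c → sum (λ j → 𝟙 (c ≟ᶠ β j))) ⟩
    ∑ (λ c → 𝟙 (c ≟ᶠ 0ᶠ)) + ∑ (λ c → sum (λ j → 𝟙 (c ≟ᶠ β j)))               ≡⟨ cong₂ _+_ (∑-δ₁ 0ᶠ) (∑-sum-swap (λ c j → 𝟙 (c ≟ᶠ β j))) ⟩
    1ℤ + sum (λ j → ∑ (λ c → 𝟙 (c ≟ᶠ β j)))                                  ≡⟨ cong (1ℤ +_) (trans (sum-cong-≗ (λ j → ∑-δ₁ (β j))) (trans (sum-const (q ∸ 1) 1ℤ) (ℤ.*-identityʳ (ℤ+ (q ∸ 1))))) ⟩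
    1ℤ + ℤ+ (q ∸ 1)                                                          ≡⟨ cong ℤ+ (ℕ.m+[n∸m]≡n (ℕ.<⇒≤ 2≤q)) ⟩
    Q                                                                        ∎
    where
    open ≡-Reasoning
    β : Fin (q ∸ 1) → Carrier
    β j = α ^ᶠ (N *ℕ toℕ j)

    exponent< : ∀ {k} → k <ℕ q ∸ 1 → N *ℕ k <ℕ M
    exponent< {k} k<q∸1 = subst (N *ℕ k <ℕ_) (sym M≡N[q∸1]) (ℕ.*-monoʳ-< N k<q∸1)

    β-injective : ∀ {i j} → β i ≡ β j → i ≡ j
    β-injective {i} {j} eq = Fin.toℕ-injective (ℕ.*-cancelˡ-≡ (toℕ i) (toℕ j) N
      (α^-injective (exponent< (Fin.toℕ<n i)) (exponent< (Fin.toℕ<n j)) eq))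

    α^-multiple : ∀ m → N ∣ m → ∃[ j ] α ^ᶠ m ≡ β j
    α^-multiple m N∣m = fromℕ< (ℕ/.m%n<n k (q ∸ 1)) , (begin
      α ^ᶠ m                                                       ≡⟨ cong (α ^ᶠ_) (trans (ℕ∣._∣_.equality N∣m) (ℕ.*-comm k N)) ⟩
      α ^ᶠ (N *ℕ k)                                                ≡⟨ cong (λ k → α ^ᶠ (N *ℕ k)) (ℕ/.m≡m%n+[m/n]*n k (q ∸ 1)) ⟩
      α ^ᶠ (N *ℕ (k % (q ∸ 1) +ℕ k / (q ∸ 1) *ℕ (q ∸ 1)))          ≡⟨ cong (α ^ᶠ_) (distribute (k % (q ∸ 1)) (k / (q ∸ 1))) ⟩
      α ^ᶠ (N *ℕ (k % (q ∸ 1)) +ℕ k / (q ∸ 1) *ℕ M)                ≡⟨ ^ᶠ-+ α (N *ℕ (k % (q ∸ 1))) (k / (q ∸ 1) *ℕ M) ⟩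
      α ^ᶠ (N *ℕ (k % (q ∸ 1))) *ᶠ α ^ᶠ (k / (q ∸ 1) *ℕ M)         ≡⟨ trans (cong (α ^ᶠ (N *ℕ (k % (q ∸ 1))) *ᶠ_) (M∣⇒α^≡1 (divides (k / (q ∸ 1)) refl))) (*ᶠ-identityʳ _) ⟩
      α ^ᶠ (N *ℕ (k % (q ∸ 1)))                                    ≡⟨ cong (λ j → α ^ᶠ (N *ℕ j)) (Fin.toℕ-fromℕ< (ℕ/.m%n<n k (q ∸ 1))) ⟨
      β (fromℕ< (ℕ/.m%n<n k (q ∸ 1)))                              ∎)
      where
      k : ℕ
      k = ℕ∣.quotient N∣m
      distribute : ∀ a b → N *ℕ (a +ℕ b *ℕ (q ∸ 1)) ≡ N *ℕ a +ℕ b *ℕ M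
      distribute a b = trans (rearrange N a b (q ∸ 1)) (cong (λ m → N *ℕ a +ℕ b *ℕ m) (sym M≡N[q∸1]))
        where
        rearrange : ∀ N a b d → N *ℕ (a +ℕ b *ℕ d) ≡ N *ℕ a +ℕ b *ℕ (N *ℕ d)
        rearrange = ℕRing.solve-∀

    β-surjective : ∀ {c} → c ≢ 0ᶠ → InF c → ∃[ j ] c ≡ β j
    β-surjective {c} c≢0 c∈F = go (prim c c≢0)
      where
      go : ∃[ m ] α ^ᶠ m ≡ c → ∃[ j ] c ≡ β j
      go (m , α^m≡c) = let j , α^m≡βj = α^-multiple m (α^∈F⇒N∣ m (subst InF (sym α^m≡c) c∈F)) in j , trans (sym α^m≡c) α^m≡βj

    pointwise : ∀ c → Dec (c ≡ 0ᶠ) → 𝟙 (InF? c) ≡ 𝟙 (c ≟ᶠ 0ᶠ) + sum (λ j → 𝟙 (c ≟ᶠ β j))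
    pointwise c (yes c≡0) = trans (𝟙-true (InF? c) (subst InF (sym c≡0) φ-0)) (sym (cong₂ _+_ (𝟙-true (c ≟ᶠ 0ᶠ) c≡0)
      (sum-zero (λ j → 𝟙-false (c ≟ᶠ β j) (λ c≡β → α^-nonzero (N *ℕ toℕ j) (trans (sym c≡β) c≡0))))))
    pointwise c (no c≢0) with InF? c in eq
    ... | no c∉F = sym (cong₂ _+_ (𝟙-false (c ≟ᶠ 0ᶠ) c≢0)
      (sum-zero (λ j → 𝟙-false (c ≟ᶠ β j) (λ { refl → c∉F (N∣⇒α^∈F (ℕ∣.m∣m*n (toℕ j))) }))))
    ... | yes c∈F = let j , c≡βj = β-surjective c≢0 c∈F in
      sym (cong₂ _+_ (𝟙-false (c ≟ᶠ 0ᶠ) c≢0)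
        (trans (sum-single (λ j → 𝟙 (c ≟ᶠ β j)) j (λ i i≢j → 𝟙-false (c ≟ᶠ β i) (λ c≡βi → i≢j (β-injective (trans (sym c≡βi) c≡βj)))))
               (𝟙-true (c ≟ᶠ β j) c≡βj)))

  -- An element of trace 1 makes every fibre over F a translate of the kernel. The q fibres
  -- partition E, so the kernel has q³/q elements.
  count-T : ∀ {t} → InF t → ∑ (λ z → 𝟙 (T z ≟ᶠ t)) ≡ Q * Q
  count-T {t} t∈F = trans (fibre t∈F) kernel
    where
    open ≡-Reasoning
    K = ∑ (λ z → 𝟙 (T z ≟ᶠ 0ᶠ))

    fibre : ∀ {t} → InF t → ∑ (λ z → 𝟙 (T z ≟ᶠ t)) ≡ K
    fibre {t} t∈F = begin
      ∑ (λ z → 𝟙 (T z ≟ᶠ t))                  ≡⟨ ∑-translate (λ z → 𝟙 (T z ≟ᶠ t)) (t *ᶠ z₁) ⟨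
      ∑ (λ z → 𝟙 (T (z +ᶠ t *ᶠ z₁) ≟ᶠ t))     ≡⟨ ∑-cong (λ z → 𝟙-cong (T (z +ᶠ t *ᶠ z₁) ≟ᶠ t) (T z ≟ᶠ 0ᶠ)
                                                   (λ eq → trans (solve 2 (λ a t → a := (a :+ t) :+ (:- t)) refl (T z) t) (-ᶠ-self (trans (sym (shift z)) eq)))
                                                   (λ eq → trans (shift z) (trans (cong (_+ᶠ t) eq) (+ᶠ-identityˡ t)))) ⟩
      K                                       ∎
      where
      z₁ = proj₁ T-one
      shift : ∀ z → T (z +ᶠ t *ᶠ z₁) ≡ T z +ᶠ t
      shift z = trans (T-+ z (t *ᶠ z₁)) (cong (T z +ᶠ_) (trans (T-* t∈F z₁) (trans (cong (t *ᶠ_) (proj₂ T-one)) (*ᶠ-identityʳ t))))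

    kernel : K ≡ Q * Q
    kernel = ℤ.*-cancelˡ-≡ Q K (Q * Q) (begin
      Q * K                                                              ≡⟨ cong (_* K) count-F ⟨
      ∑ (λ t → 𝟙 (InF? t)) * K                                           ≡⟨ ∑-*ʳ K (λ t → 𝟙 (InF? t)) ⟨
      ∑ (λ t → 𝟙 (InF? t) * K)                                           ≡⟨ ∑-cong (λ t → 𝟙-guard (InF? t) (λ t∈F → sym (fibre t∈F))) ⟩
      ∑ (λ t → 𝟙 (InF? t) * ∑ (λ z → 𝟙 (T z ≟ᶠ t)))                      ≡⟨ ∑-cong (λ t → ∑-*ˡ (𝟙 (InF? t)) (λ z → 𝟙 (T z ≟ᶠ t))) ⟨
      ∑ (λ t → ∑ (λ z → 𝟙 (InF? t) * 𝟙 (T z ≟ᶠ t)))                      ≡⟨ ∑-swap (λ t z → 𝟙 (InF? t) * 𝟙 (T z ≟ᶠ t)) ⟩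
      ∑ (λ z → ∑ (λ t → 𝟙 (InF? t) * 𝟙 (T z ≟ᶠ t)))                      ≡⟨ ∑-cong (λ z → ∑-cong (λ t → trans (ℤ.*-comm (𝟙 (InF? t)) (𝟙 (T z ≟ᶠ t))) (cong (_* 𝟙 (InF? t)) (𝟙-cong (T z ≟ᶠ t) (t ≟ᶠ T z) sym sym)))) ⟩
      ∑ (λ z → ∑ (λ t → 𝟙 (t ≟ᶠ T z) * 𝟙 (InF? t)))                      ≡⟨ ∑-cong (λ z → trans (∑-δ (λ t → 𝟙 (InF? t)) (T z)) (𝟙-true (InF? (T z)) (T∈F z))) ⟩
      ∑ (λ z → 1ℤ)                                                       ≡⟨ trans (∑-const 1ℤ) (trans (ℤ.*-identityʳ (ℤ+ (q ^ 3))) cube≡) ⟩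
      Q * (Q * Q)                                                        ∎)

  -- The fibre sums B(t) and the square of B(1).

  B : Carrier → ℤ
  B t = ∑ (λ z → 𝟙 (T z ≟ᶠ t) * X z)

  -- N is odd, as q² + q = q(q + 1) = 2(4r + 1)(2r + 1). So the generator α^N of F* is a nonsquare
  -- of E, and X restricts to the quadratic character of F.
  X-α^N : X (α ^ᶠ N) ≡ -1ℤ
  X-α^N = trans (cong (λ m → X (α ^ᶠ m)) N≡) (X-odd-power (suc (r *ℕ 4) *ℕ suc (r *ℕ 2)))
    where
    odd : ∀ r → suc (r *ℕ 4) *ℕ suc (r *ℕ 4) +ℕ suc (r *ℕ 4) +ℕ 1 ≡ suc (suc (r *ℕ 4) *ℕ suc (r *ℕ 2) +ℕ suc (r *ℕ 4) *ℕ suc (r *ℕ 2))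
    odd = ℕRing.solve-∀
    N≡ : N ≡ suc (suc (r *ℕ 4) *ℕ suc (r *ℕ 2) +ℕ suc (r *ℕ 4) *ℕ suc (r *ℕ 2))
    N≡ = trans (cong (λ a → a *ℕ a +ℕ a +ℕ 1) q≡1+4r) (odd r)

  self-negative : ∀ i → i ≡ -1ℤ * i → i ≡ 0ℤ
  self-negative i eq = ℤ.*-cancelˡ-≡ (ℤ+ 2) i 0ℤ (begin
    ℤ+ 2 * i          ≡⟨ double i ⟩
    i + i             ≡⟨ cong (i +_) eq ⟩
    i + -1ℤ * i       ≡⟨ cancel i ⟩
    ℤ+ 2 * 0ℤ         ∎)
    where
    open ≡-Reasoning
    double : ∀ i → ℤ+ 2 * i ≡ i + i
    double = ℤRing.solve-∀
    cancel : ∀ i → i + -1ℤ * i ≡ ℤ+ 2 * 0ℤ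
    cancel = ℤRing.solve-∀

  ∑X≡0 : ∑ X ≡ 0ℤ
  ∑X≡0 = self-negative (∑ X) (begin
    ∑ X                      ≡⟨ ∑-scale X α α≢0 ⟨
    ∑ (λ x → X (α *ᶠ x))     ≡⟨ ∑-cong (λ x → trans (X-* α x) (cong (_* X x) X-α)) ⟩
    ∑ (λ x → -1ℤ * X x)      ≡⟨ ∑-*ˡ -1ℤ X ⟩
    -1ℤ * ∑ X                ∎)
    where open ≡-Reasoning

  B-scale : ∀ {c} → c ≢ 0ᶠ → InF c → ∀ t → B (c *ᶠ t) ≡ X c * B t
  B-scale {c} c≢0 c∈F t = begin
    ∑ (λ z → 𝟙 (T z ≟ᶠ c *ᶠ t) * X z)                   ≡⟨ ∑-scale (λ z → 𝟙 (T z ≟ᶠ c *ᶠ t) * X z) c c≢0 ⟨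
    ∑ (λ z → 𝟙 (T (c *ᶠ z) ≟ᶠ c *ᶠ t) * X (c *ᶠ z))     ≡⟨ ∑-cong (λ z → trans (cong₂ _*_ (𝟙-cong (T (c *ᶠ z) ≟ᶠ c *ᶠ t) (T z ≟ᶠ t)
                                                               (λ eq → *ᶠ-cancelˡ c≢0 (trans (sym (T-* c∈F z)) eq)) (λ { refl → T-* c∈F z })) (X-* c z))
                                                               (swap (𝟙 (T z ≟ᶠ t)) (X c) (X z))) ⟩
    ∑ (λ z → X c * (𝟙 (T z ≟ᶠ t) * X z))                ≡⟨ ∑-*ˡ (X c) (λ z → 𝟙 (T z ≟ᶠ t) * X z) ⟩
    X c * B t                                           ∎
    where
    open ≡-Reasoning
    swap : ∀ a b c → a * (b * c) ≡ b * (a * c)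
    swap = ℤRing.solve-∀

  -- Scaling by α^N, an element of F with X = -1, preserves the kernel of the trace and reverses the
  -- sign of the sum.
  B-0 : B 0ᶠ ≡ 0ℤ
  B-0 = self-negative (B 0ᶠ) (trans (cong B (sym (*ᶠ-zeroʳ (α ^ᶠ N))))
    (trans (B-scale (α^-nonzero N) (N∣⇒α^∈F ℕ∣.∣-refl) 0ᶠ) (cong (_* B 0ᶠ) X-α^N)))

  B-F : ∀ {t} → InF t → B t ≡ X t * B 1ᶠ
  B-F {t} t∈F = go (t ≟ᶠ 0ᶠ)
    where
    go : Dec (t ≡ 0ᶠ) → B t ≡ X t * B 1ᶠ
    go (yes t≡0) = subst (λ t → B t ≡ X t * B 1ᶠ) (sym t≡0) (trans B-0 (sym (cong (_* B 1ᶠ) X-0)))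
    go (no t≢0)  = trans (cong B (sym (*ᶠ-identityʳ t))) (B-scale t≢0 t∈F 1ᶠ)

  X-1 : X 1ᶠ ≡ 1ℤ
  X-1 = trans (cong X (sym (*ᶠ-identityˡ 1ᶠ))) (X-square 1≢0)

  X² : ∀ z → X z * X z ≡ 1ℤ - 𝟙 (z ≟ᶠ 0ᶠ)
  X² z = go (z ≟ᶠ 0ᶠ)
    where
    go : (d : Dec (z ≡ 0ᶠ)) → X z * X z ≡ 1ℤ - 𝟙 d
    go (yes z≡0) = cong (λ i → i * i) (trans (cong X z≡0) X-0)
    go (no z≢0)  = trans (sym (X-* z z)) (X-square z≢0)

  -- Traces lie in F, so the other fibres are empty. The indicator lets sums of B(t)² run over all
  -- of E.
  B-any : ∀ t → B t ≡ 𝟙 (InF? t) * (X t * B 1ᶠ)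
  B-any t with InF? t
  ... | yes t∈F = trans (B-F t∈F) (sym (ℤ.*-identityˡ (X t * B 1ᶠ)))
  ... | no t∉F  = sum-zero (λ i → cong (_* X (element i)) (𝟙-false (T (element i) ≟ᶠ t) (λ { refl → t∉F (T∈F (element i)) })))

  Q-1≡ : Q - 1ℤ ≡ ℤ+ (q ∸ 1)
  Q-1≡ = trans (ℤ.[+m]-[+n]≡m⊖n q 1) (ℤ.⊖-≥ (ℕ.<⇒≤ 2≤q))

  -- Both sides count ∑ X(z)X(y) over the pairs with T z = T y, by the common trace and by y/z.
  B²-double-count : (Q - 1ℤ) * (B 1ᶠ * B 1ᶠ) ≡ (Q - 1ℤ) * (Q * Q)
  B²-double-count = trans (sym by-trace) by-ratio
    where
    open ≡-Reasoning
    b = B 1ᶠ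

    D : ℤ
    D = ∑ (λ z → ∑ (λ y → 𝟙 (T y ≟ᶠ T z) * (X z * X y)))

    by-trace : D ≡ (Q - 1ℤ) * (b * b)
    by-trace = begin
      D
        ≡⟨ ∑-cong (λ z → trans (∑-cong (λ y → rearrange (𝟙 (T y ≟ᶠ T z)) (X z) (X y))) (∑-*ˡ (X z) (λ y → 𝟙 (T y ≟ᶠ T z) * X y))) ⟩
      ∑ (λ z → X z * B (T z))
        ≡⟨ ∑-cong (λ z → ∑-δ (λ t → X z * B t) (T z)) ⟨
      ∑ (λ z → ∑ (λ t → 𝟙 (t ≟ᶠ T z) * (X z * B t)))
        ≡⟨ ∑-swap (λ z t → 𝟙 (t ≟ᶠ T z) * (X z * B t)) ⟩
      ∑ (λ t → ∑ (λ z → 𝟙 (t ≟ᶠ T z) * (X z * B t)))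
        ≡⟨ ∑-cong (λ t → trans (∑-cong (λ z → trans (cong (_* (X z * B t)) (𝟙-cong (t ≟ᶠ T z) (T z ≟ᶠ t) sym sym)) (sym (ℤ.*-assoc (𝟙 (T z ≟ᶠ t)) (X z) (B t)))))
                                (∑-*ʳ (B t) (λ z → 𝟙 (T z ≟ᶠ t) * X z))) ⟩
      ∑ (λ t → B t * B t)
        ≡⟨ ∑-cong pointwise ⟩
      ∑ (λ t → (𝟙 (InF? t) + -1ℤ * 𝟙 (t ≟ᶠ 0ᶠ)) * (b * b))
        ≡⟨ ∑-*ʳ (b * b) (λ t → 𝟙 (InF? t) + -1ℤ * 𝟙 (t ≟ᶠ 0ᶠ)) ⟩
      ∑ (λ t → 𝟙 (InF? t) + -1ℤ * 𝟙 (t ≟ᶠ 0ᶠ)) * (b * b)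
        ≡⟨ cong (_* (b * b)) (trans (∑-+ (λ t → 𝟙 (InF? t)) (λ t → -1ℤ * 𝟙 (t ≟ᶠ 0ᶠ)))
             (cong₂ _+_ count-F (trans (∑-*ˡ -1ℤ (λ t → 𝟙 (t ≟ᶠ 0ᶠ))) (cong (-1ℤ *_) (∑-δ₁ 0ᶠ))))) ⟩
      (Q - 1ℤ) * (b * b) ∎
      where
      rearrange : ∀ i x y → i * (x * y) ≡ x * (i * y)
      rearrange = ℤRing.solve-∀
      factor : ∀ x b → (x * b) * (x * b) ≡ (x * x) * (b * b)
      factor = ℤRing.solve-∀
      pointwise : ∀ t → B t * B t ≡ (𝟙 (InF? t) + -1ℤ * 𝟙 (t ≟ᶠ 0ᶠ)) * (b * b)
      pointwise t = trans (cong₂ _*_ (B-any t) (B-any t)) (go (InF? t))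
        where
        go : (d : Dec (InF t)) → (𝟙 d * (X t * b)) * (𝟙 d * (X t * b)) ≡ (𝟙 d + -1ℤ * 𝟙 (t ≟ᶠ 0ᶠ)) * (b * b)
        go (no t∉F) = sym (cong (λ i → (0ℤ + -1ℤ * i) * (b * b)) (𝟙-false (t ≟ᶠ 0ᶠ) (λ { refl → t∉F φ-0 })))
        go (yes _)  = begin
          (1ℤ * (X t * b)) * (1ℤ * (X t * b))         ≡⟨ cong (λ i → i * i) (ℤ.*-identityˡ (X t * b)) ⟩
          (X t * b) * (X t * b)                       ≡⟨ factor (X t) b ⟩
          (X t * X t) * (b * b)                       ≡⟨ cong (_* (b * b)) (X² t) ⟩
          (1ℤ - 𝟙 (t ≟ᶠ 0ᶠ)) * (b * b)                ≡⟨ cong (λ i → (1ℤ + i) * (b * b)) (ℤ.-1*i≡-i (𝟙 (t ≟ᶠ 0ᶠ))) ⟨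
          (1ℤ + -1ℤ * 𝟙 (t ≟ᶠ 0ᶠ)) * (b * b)          ∎

    C : Carrier → ℤ
    C k = ∑ (λ z → 𝟙 (T ((1ᶠ -ᶠ k) *ᶠ z) ≟ᶠ 0ᶠ))

    -- For k ≠ 1 multiplication by 1 - k permutes E and the kernel of the trace is counted; for k =
    -- 1 every z qualifies.
    C≡ : ∀ k → C k ≡ Q * Q + 𝟙 (k ≟ᶠ 1ᶠ) * (Q * (Q * Q) - Q * Q)
    C≡ k with k ≟ᶠ 1ᶠ
    ... | yes refl = begin
      C 1ᶠ                   ≡⟨ ∑-cong (λ z → 𝟙-true (T ((1ᶠ -ᶠ 1ᶠ) *ᶠ z) ≟ᶠ 0ᶠ) (trans (cong T (solve 1 (λ z → (con 1ℤ :+ (:- con 1ℤ)) :* z := con 0ℤ) refl z)) T-0)) ⟩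
      ∑ (λ _ → 1ℤ)           ≡⟨ trans (∑-const 1ℤ) (trans (ℤ.*-identityʳ (ℤ+ (q ^ 3))) cube≡) ⟩
      Q * (Q * Q)            ≡⟨ total (Q * (Q * Q)) (Q * Q) ⟩
      Q * Q + 1ℤ * (Q * (Q * Q) - Q * Q) ∎
      where
      total : ∀ a b → a ≡ b + 1ℤ * (a - b)
      total = ℤRing.solve-∀
    ... | no k≢1 = begin
      C k                                  ≡⟨ ∑-scale (λ z → 𝟙 (T z ≟ᶠ 0ᶠ)) (1ᶠ -ᶠ k) (λ eq → k≢1 (sym (-ᶠ-unique eq))) ⟩
      ∑ (λ z → 𝟙 (T z ≟ᶠ 0ᶠ))              ≡⟨ count-T φ-0 ⟩
      Q * Q                                ≡⟨ ℤ.+-identityʳ (Q * Q) ⟨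
      Q * Q + 0ℤ                           ∎

    A≡ : ∀ k → ∑ (λ z → 𝟙 (T ((1ᶠ -ᶠ k) *ᶠ z) ≟ᶠ 0ᶠ) * (X z * X z)) ≡ C k - 1ℤ
    A≡ k = begin
      ∑ (λ z → J z * (X z * X z))                         ≡⟨ ∑-cong (λ z → trans (cong (J z *_) (X² z)) (expand (J z) (𝟙 (z ≟ᶠ 0ᶠ)))) ⟩
      ∑ (λ z → J z + -1ℤ * (𝟙 (z ≟ᶠ 0ᶠ) * J z))         ≡⟨ ∑-+ J (λ z → -1ℤ * (𝟙 (z ≟ᶠ 0ᶠ) * J z)) ⟩
      C k + ∑ (λ z → -1ℤ * (𝟙 (z ≟ᶠ 0ᶠ) * J z))           ≡⟨ cong (C k +_) (∑-*ˡ -1ℤ (λ z → 𝟙 (z ≟ᶠ 0ᶠ) * J z)) ⟩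
      C k + -1ℤ * ∑ (λ z → 𝟙 (z ≟ᶠ 0ᶠ) * J z)             ≡⟨ cong (λ i → C k + -1ℤ * i) (trans (∑-δ J 0ᶠ) (𝟙-true (T ((1ᶠ -ᶠ k) *ᶠ 0ᶠ) ≟ᶠ 0ᶠ) (trans (cong T (*ᶠ-zeroʳ (1ᶠ -ᶠ k))) T-0))) ⟩
      C k - 1ℤ                                              ∎
      where
      J : Carrier → ℤ
      J z = 𝟙 (T ((1ᶠ -ᶠ k) *ᶠ z) ≟ᶠ 0ᶠ)
      expand : ∀ i d → i * (1ℤ - d) ≡ i + -1ℤ * (d * i)
      expand = ℤRing.solve-∀

    -- Put y = zk. The factor X(z)² is kept instead of being replaced by 1, so that z = 0, which
    -- admits no ratio, contributes 0 on both sides.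
    substitute : ∀ z → ∑ (λ y → 𝟙 (T y ≟ᶠ T z) * (X z * X y)) ≡ ∑ (λ k → 𝟙 (T ((1ᶠ -ᶠ k) *ᶠ z) ≟ᶠ 0ᶠ) * (X z * X z) * X k)
    substitute z = go (z ≟ᶠ 0ᶠ)
      where
      rearrange : ∀ i x y → i * (x * (x * y)) ≡ i * (x * x) * y
      rearrange = ℤRing.solve-∀
      difference : ∀ k → T ((1ᶠ -ᶠ k) *ᶠ z) +ᶠ T (z *ᶠ k) ≡ T z
      difference k = trans (sym (T-+ ((1ᶠ -ᶠ k) *ᶠ z) (z *ᶠ k))) (cong T (solve 2 (λ k z → (con 1ℤ :+ (:- k)) :* z :+ z :* k := z) refl k z))
      X≡0⇒ : ∀ i j k → X z ≡ 0ℤ → i * (X z * X k) ≡ j * (X z * X z) * X k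
      X≡0⇒ i j k X≡0 rewrite X≡0 = trans (ℤ.*-zeroʳ i) (sym (cong (_* X k) (ℤ.*-zeroʳ j)))
      go : Dec (z ≡ 0ᶠ) → ∑ (λ y → 𝟙 (T y ≟ᶠ T z) * (X z * X y)) ≡ ∑ (λ k → 𝟙 (T ((1ᶠ -ᶠ k) *ᶠ z) ≟ᶠ 0ᶠ) * (X z * X z) * X k)
      go (yes z≡0) = ∑-cong (λ k → X≡0⇒ (𝟙 (T k ≟ᶠ T z)) (𝟙 (T ((1ᶠ -ᶠ k) *ᶠ z) ≟ᶠ 0ᶠ)) k (trans (cong X z≡0) X-0))
      go (no z≢0)  = begin
        ∑ (λ y → 𝟙 (T y ≟ᶠ T z) * (X z * X y))                           ≡⟨ ∑-scale (λ y → 𝟙 (T y ≟ᶠ T z) * (X z * X y)) z z≢0 ⟨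
        ∑ (λ k → 𝟙 (T (z *ᶠ k) ≟ᶠ T z) * (X z * X (z *ᶠ k)))             ≡⟨ ∑-cong (λ k → trans
              (cong₂ (λ i x → i * (X z * x))
                (𝟙-cong (T (z *ᶠ k) ≟ᶠ T z) (T ((1ᶠ -ᶠ k) *ᶠ z) ≟ᶠ 0ᶠ)
                  (λ eq → trans (solve 2 (λ a b → a := (a :+ b) :+ (:- b)) refl _ (T (z *ᶠ k))) (-ᶠ-self (trans (difference k) (sym eq))))
                  (λ eq → trans (sym (+ᶠ-identityˡ _)) (trans (cong (_+ᶠ T (z *ᶠ k)) (sym eq)) (difference k))))
                (X-* z k))
              (rearrange (𝟙 (T ((1ᶠ -ᶠ k) *ᶠ z) ≟ᶠ 0ᶠ)) (X z) (X k))) ⟩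
        ∑ (λ k → 𝟙 (T ((1ᶠ -ᶠ k) *ᶠ z) ≟ᶠ 0ᶠ) * (X z * X z) * X k)       ∎

    by-ratio : D ≡ (Q - 1ℤ) * (Q * Q)
    by-ratio = begin
      D
        ≡⟨ ∑-cong substitute ⟩
      ∑ (λ z → ∑ (λ k → 𝟙 (T ((1ᶠ -ᶠ k) *ᶠ z) ≟ᶠ 0ᶠ) * (X z * X z) * X k))
        ≡⟨ ∑-swap (λ z k → 𝟙 (T ((1ᶠ -ᶠ k) *ᶠ z) ≟ᶠ 0ᶠ) * (X z * X z) * X k) ⟩
      ∑ (λ k → ∑ (λ z → 𝟙 (T ((1ᶠ -ᶠ k) *ᶠ z) ≟ᶠ 0ᶠ) * (X z * X z) * X k))
        ≡⟨ ∑-cong (λ k → trans (∑-*ʳ (X k) (λ z → 𝟙 (T ((1ᶠ -ᶠ k) *ᶠ z) ≟ᶠ 0ᶠ) * (X z * X z)))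
             (trans (cong (_* X k) (trans (A≡ k) (cong (_- 1ℤ) (C≡ k)))) (collect (Q * Q) (𝟙 (k ≟ᶠ 1ᶠ)) (Q * (Q * Q) - Q * Q) (X k)))) ⟩
      -- Since X sums to 0 over E, the part common to all ratios disappears and only the excess q³ -
      -- q² at k = 1 remains.
      ∑ (λ k → (Q * Q - 1ℤ) * X k + (Q * (Q * Q) - Q * Q) * (𝟙 (k ≟ᶠ 1ᶠ) * X k))
        ≡⟨ trans (∑-+ (λ k → (Q * Q - 1ℤ) * X k) (λ k → (Q * (Q * Q) - Q * Q) * (𝟙 (k ≟ᶠ 1ᶠ) * X k)))
             (cong₂ _+_ (trans (∑-*ˡ (Q * Q - 1ℤ) X) (cong ((Q * Q - 1ℤ) *_) ∑X≡0))
                        (trans (∑-*ˡ (Q * (Q * Q) - Q * Q) (λ k → 𝟙 (k ≟ᶠ 1ᶠ) * X k)) (cong ((Q * (Q * Q) - Q * Q) *_) (trans (∑-δ X 1ᶠ) X-1)))) ⟩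
      (Q * Q - 1ℤ) * 0ℤ + (Q * (Q * Q) - Q * Q) * 1ℤ
        ≡⟨ simplify Q ⟩
      (Q - 1ℤ) * (Q * Q) ∎
      where
      collect : ∀ s i d x → (s + i * d - 1ℤ) * x ≡ (s - 1ℤ) * x + d * (i * x)
      collect = ℤRing.solve-∀
      simplify : ∀ Q → (Q * Q - 1ℤ) * 0ℤ + (Q * (Q * Q) - Q * Q) * 1ℤ ≡ (Q - 1ℤ) * (Q * Q)
      simplify = ℤRing.solve-∀

  B² : B 1ᶠ * B 1ᶠ ≡ Q * Q
  B² = ℤ.*-cancelˡ-≡ (Q - 1ℤ) (B 1ᶠ * B 1ᶠ) (Q * Q) {{subst Data.Integer.NonZero (sym Q-1≡) q∸1≢0}} B²-double-count

  -- The sign of B(1) and the quadratic form T(y²).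

  𝟙-¬ : ∀ {P : Set} (d : Dec P) → 𝟙 (¬? d) ≡ 1ℤ - 𝟙 d
  𝟙-¬ (yes _) = refl
  𝟙-¬ (no _)  = refl

  T-product : ∀ x y → T (x *ᶠ y) ≡ x *ᶠ y +ᶠ φ x *ᶠ φ y +ᶠ φ (φ x) *ᶠ φ (φ y)
  T-product x y = trans (T≡ (x *ᶠ y)) (cong₂ (λ a b → x *ᶠ y +ᶠ a +ᶠ b) (φ-* x y) (trans (cong φ (φ-* x y)) (φ-* (φ x) (φ y))))

  -- For q ≡ 0 or 2 modulo 3 the value q² + q + 1 is 1 modulo 3, whereas q ≡ 1 would make it
  -- divisible by 3.
  N≡1+3k : ∃[ k ] N ≡ suc (k *ℕ 3)
  N≡1+3k = by-residue (q % 3) (ℕ/.m%n<n q 3) q%3≢1 (ℕ/.m≡m%n+[m/n]*n q 3)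
    where
    residue-0 : ∀ j → (j *ℕ 3) *ℕ (j *ℕ 3) +ℕ (j *ℕ 3) +ℕ 1 ≡ suc ((j *ℕ (j *ℕ 3) +ℕ j) *ℕ 3)
    residue-0 = ℕRing.solve-∀
    residue-2 : ∀ j → (2 +ℕ j *ℕ 3) *ℕ (2 +ℕ j *ℕ 3) +ℕ (2 +ℕ j *ℕ 3) +ℕ 1 ≡ suc ((2 +ℕ 5 *ℕ j +ℕ 3 *ℕ (j *ℕ j)) *ℕ 3)
    residue-2 = ℕRing.solve-∀
    by-residue : ∀ s → s <ℕ 3 → ¬ (s ≡ 1) → q ≡ s +ℕ q / 3 *ℕ 3 → ∃[ k ] N ≡ suc (k *ℕ 3)
    by-residue 0 _ _   eq = q / 3 *ℕ (q / 3 *ℕ 3) +ℕ q / 3 , trans (cong (λ a → a *ℕ a +ℕ a +ℕ 1) eq) (residue-0 (q / 3))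
    by-residue 1 _ 1≢1 _  = contradiction refl 1≢1
    by-residue 2 _ _   eq = 2 +ℕ 5 *ℕ (q / 3) +ℕ 3 *ℕ (q / 3 *ℕ (q / 3)) , trans (cong (λ a → a *ℕ a +ℕ a +ℕ 1) eq) (residue-2 (q / 3))
    by-residue (suc (suc (suc s))) (s≤s (s≤s (s≤s ()))) _ _

  -- With N = 3k + 1 one has m = mN - k(3m).
  N∣m*3⇒N∣m : ∀ m → N ∣ m *ℕ 3 → N ∣ m
  N∣m*3⇒N∣m m N∣m*3 = let k , N≡ = N≡1+3k in
    ℕ∣.∣m+n∣m⇒∣n (subst (N ∣_) (trans (cong (m *ℕ_) N≡) (expand m k)) (ℕ∣.∣n⇒∣m*n m ℕ∣.∣-refl)) (ℕ∣.∣n⇒∣m*n k N∣m*3)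
    where
    expand : ∀ m k → m *ℕ suc (k *ℕ 3) ≡ k *ℕ (m *ℕ 3) +ℕ m
    expand = ℕRing.solve-∀

  -- E*/F* is cyclic of order N, which is prime to 3, so it has no element of order 3.
  cube∈F⇒∈F : ∀ {y} → InF (y *ᶠ (y *ᶠ (y *ᶠ 1ᶠ))) → InF y
  cube∈F⇒∈F {y} y³∈F with y ≟ᶠ 0ᶠ
  ... | yes refl = φ-0
  ... | no y≢0 with prim y y≢0
  ...   | m , refl = N∣⇒α^∈F (N∣m*3⇒N∣m m (α^∈F⇒N∣ (m *ℕ 3) (subst InF (sym (^ᶠ-* α m 3)) y³∈F)))

  -- With conjugates a, b, c the hypotheses say a + b + c = 0 = a² + b² + c², whence a² + ab + b² = 0 and a³ = b³.
  isotropic-trace-0 : ∀ {y} → T y ≡ 0ᶠ → T (y *ᶠ y) ≡ 0ᶠ → InF y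
  isotropic-trace-0 {y} Ty≡0 Ty²≡0 = cube∈F⇒∈F (trans φ-cube (sym (-ᶠ-unique cubes)))
    where
    open ≡-Reasoning
    a = y
    b = φ y
    c = φ (φ y)
    φ-cube : φ (y *ᶠ (y *ᶠ (y *ᶠ 1ᶠ))) ≡ b *ᶠ (b *ᶠ (b *ᶠ 1ᶠ))
    φ-cube = trans (φ-* y _) (cong (φ y *ᶠ_) (trans (φ-* y _) (cong (φ y *ᶠ_) (trans (φ-* y 1ᶠ) (cong (φ y *ᶠ_) 1∈F)))))
    cubes : a *ᶠ (a *ᶠ (a *ᶠ 1ᶠ)) -ᶠ b *ᶠ (b *ᶠ (b *ᶠ 1ᶠ)) ≡ 0ᶠ
    cubes = *ᶠ-cancelˡ 2≢0 (begin
      2ᶠ *ᶠ (a *ᶠ (a *ᶠ (a *ᶠ 1ᶠ)) -ᶠ b *ᶠ (b *ᶠ (b *ᶠ 1ᶠ)))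
        ≡⟨ solve 3 (λ a b c → (con 1ℤ :+ con 1ℤ) :* (a :* (a :* (a :* con 1ℤ)) :+ (:- (b :* (b :* (b :* con 1ℤ)))))
             := (a :+ (:- b)) :* ((a :* a :+ b :* b :+ c :* c) :+ (a :+ b :+ c) :* (a :+ b :+ (:- c)))) refl a b c ⟩
      (a -ᶠ b) *ᶠ ((a *ᶠ a +ᶠ b *ᶠ b +ᶠ c *ᶠ c) +ᶠ (a +ᶠ b +ᶠ c) *ᶠ (a +ᶠ b -ᶠ c))
        ≡⟨ cong₂ (λ s t → (a -ᶠ b) *ᶠ (s +ᶠ t *ᶠ (a +ᶠ b -ᶠ c))) (trans (sym (T-product y y)) Ty²≡0) (trans (sym (T≡ y)) Ty≡0) ⟩
      (a -ᶠ b) *ᶠ (0ᶠ +ᶠ 0ᶠ *ᶠ (a +ᶠ b -ᶠ c))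
        ≡⟨ solve 3 (λ a b c → (a :+ (:- b)) :* (con 0ℤ :+ con 0ℤ :* (a :+ b :+ (:- c))) := (con 1ℤ :+ con 1ℤ) :* con 0ℤ) refl a b c ⟩
      2ᶠ *ᶠ 0ᶠ ∎)

  -- Each z has 1 + X(z) square roots, so lifting from z to y adds B(t) to the size q² of the fibre.
  -- This ties the quadric to the sum whose sign is sought.
  count-T-square : ∀ {t} → InF t → ∑ (λ y → 𝟙 (T (y *ᶠ y) ≟ᶠ t)) ≡ Q * Q + B t
  count-T-square {t} t∈F = begin
    ∑ (λ y → 𝟙 (T (y *ᶠ y) ≟ᶠ t))                          ≡⟨ ∑-squares (λ z → 𝟙 (T z ≟ᶠ t)) ⟩
    ∑ (λ z → 𝟙 (T z ≟ᶠ t) * (1ℤ + X z))                    ≡⟨ ∑-cong (λ z → expand (𝟙 (T z ≟ᶠ t)) (X z)) ⟩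
    ∑ (λ z → 𝟙 (T z ≟ᶠ t) + 𝟙 (T z ≟ᶠ t) * X z)            ≡⟨ ∑-+ (λ z → 𝟙 (T z ≟ᶠ t)) (λ z → 𝟙 (T z ≟ᶠ t) * X z) ⟩
    ∑ (λ z → 𝟙 (T z ≟ᶠ t)) + B t                           ≡⟨ cong (_+ B t) (count-T t∈F) ⟩
    Q * Q + B t                                            ∎
    where
    open ≡-Reasoning
    expand : ∀ i x → i * (1ℤ + x) ≡ i + i * x
    expand = ℤRing.solve-∀

  -- Because B(0) = 0, exactly q² elements satisfy T(y²) = 0. Were they all of trace 0,
  -- `isotropic-trace-0` would place them in F, which has only q elements. The nonzero trace is what
  -- `unit-vector` divides by.
  isotropic : ∃[ v ] T (v *ᶠ v) ≡ 0ᶠ × T v ≢ 0ᶠ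
  isotropic with Fin.any? (λ i → (T (element i *ᶠ element i) ≟ᶠ 0ᶠ) ×-dec ¬? (T (element i) ≟ᶠ 0ᶠ))
  ... | yes (i , found) = element i , found
  ... | no none = contradiction (ℤ.drop‿+≤+ (subst (_≤ Q) (sym (ℤ.pos-* q q)) Q²≤Q)) (ℕ.<⇒≱ (ℕ.m<m*n q q {{ℕ.>-nonZero (ℕ.<⇒≤ 2≤q)}} 2≤q))
    where
    bad : ∀ y → T (y *ᶠ y) ≡ 0ᶠ → InF y
    bad y Ty²≡0 with T y ≟ᶠ 0ᶠ
    ... | yes Ty≡0 = isotropic-trace-0 Ty≡0 Ty²≡0
    ... | no Ty≢0  = contradiction (index y , subst (λ y → T (y *ᶠ y) ≡ 0ᶠ × T y ≢ 0ᶠ) (sym (strictlyInverseˡ y)) (Ty²≡0 , Ty≢0)) none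
    Q²≤Q : Q * Q ≤ Q
    Q²≤Q = subst₂ _≤_ (trans (count-T-square φ-0) (trans (cong (Q * Q +_) B-0) (ℤ.+-identityʳ (Q * Q)))) count-F
      (∑-mono (λ y → 𝟙-mono (T (y *ᶠ y) ≟ᶠ 0ᶠ) (InF? y) (bad y)))

  I∈F : InF I
  I∈F = N∣⇒α^∈F (ℕ∣.m∣m*n r)

  module Isotropic {v : Carrier} (Tv²≡0 : T (v *ᶠ v) ≡ 0ᶠ) (Tv≢0 : T v ≢ 0ᶠ) where
    private
      n : Carrier → ℤ
      n y = 𝟙 (¬? (T (y *ᶠ v) ≟ᶠ 0ᶠ))

    v≢0 : v ≢ 0ᶠ
    v≢0 refl = Tv≢0 T-0

    count-orthogonal : ∑ (λ y → 𝟙 (T (y *ᶠ v) ≟ᶠ 0ᶠ)) ≡ Q * Q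
    count-orthogonal = begin
      ∑ (λ y → 𝟙 (T (y *ᶠ v) ≟ᶠ 0ᶠ))   ≡⟨ ∑-cong (λ y → cong (λ z → 𝟙 (T z ≟ᶠ 0ᶠ)) (*ᶠ-comm y v)) ⟩
      ∑ (λ y → 𝟙 (T (v *ᶠ y) ≟ᶠ 0ᶠ))   ≡⟨ ∑-scale (λ y → 𝟙 (T y ≟ᶠ 0ᶠ)) v v≢0 ⟩
      ∑ (λ y → 𝟙 (T y ≟ᶠ 0ᶠ))          ≡⟨ count-T φ-0 ⟩
      Q * Q                            ∎
      where open ≡-Reasoning

    count-non-orthogonal : ∑ n ≡ Q * (Q * Q) - Q * Q
    count-non-orthogonal = begin
      ∑ n                                                      ≡⟨ ∑-cong (λ y → trans (𝟙-¬ (T (y *ᶠ v) ≟ᶠ 0ᶠ)) (cong (1ℤ +_) (sym (ℤ.-1*i≡-i (𝟙 (T (y *ᶠ v) ≟ᶠ 0ᶠ)))))) ⟩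
      ∑ (λ y → 1ℤ + -1ℤ * 𝟙 (T (y *ᶠ v) ≟ᶠ 0ᶠ))                ≡⟨ ∑-+ (λ _ → 1ℤ) (λ y → -1ℤ * 𝟙 (T (y *ᶠ v) ≟ᶠ 0ᶠ)) ⟩
      ∑ (λ _ → 1ℤ) + ∑ (λ y → -1ℤ * 𝟙 (T (y *ᶠ v) ≟ᶠ 0ᶠ))      ≡⟨ cong₂ _+_ (trans (∑-const 1ℤ) (trans (ℤ.*-identityʳ (ℤ+ (q ^ 3))) cube≡))
                                                                   (trans (∑-*ˡ -1ℤ (λ y → 𝟙 (T (y *ᶠ v) ≟ᶠ 0ᶠ))) (cong (-1ℤ *_) count-orthogonal)) ⟩
      Q * (Q * Q) + -1ℤ * (Q * Q)                              ≡⟨ cong (Q * (Q * Q) +_) (ℤ.-1*i≡-i (Q * Q)) ⟩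
      Q * (Q * Q) - Q * Q                                      ∎
      where open ≡-Reasoning

    line : ∀ c → InF c → ∀ y → T ((y +ᶠ c *ᶠ v) *ᶠ v) ≡ T (y *ᶠ v)
    line c c∈F y = begin
      T ((y +ᶠ c *ᶠ v) *ᶠ v)               ≡⟨ cong T (solve 3 (λ c v y → (y :+ c :* v) :* v := y :* v :+ c :* (v :* v)) refl c v y) ⟩
      T (y *ᶠ v +ᶠ c *ᶠ (v *ᶠ v))          ≡⟨ T-+ _ _ ⟩
      T (y *ᶠ v) +ᶠ T (c *ᶠ (v *ᶠ v))      ≡⟨ cong (T (y *ᶠ v) +ᶠ_) (trans (T-* c∈F _) (cong (c *ᶠ_) Tv²≡0)) ⟩
      T (y *ᶠ v) +ᶠ c *ᶠ 0ᶠ                ≡⟨ solve 2 (λ a c → a :+ c :* con 0ℤ := a) refl (T (y *ᶠ v)) c ⟩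
      T (y *ᶠ v)                           ∎
      where open ≡-Reasoning

    -- Since T(v²) = 0, the term in c² drops out: along y + Fv the quadratic form is affine in c
    -- with slope 2T(yv).
    line-square : ∀ c → InF c → ∀ y → T ((y +ᶠ c *ᶠ v) *ᶠ (y +ᶠ c *ᶠ v)) ≡ T (y *ᶠ y) +ᶠ c *ᶠ (2ᶠ *ᶠ T (y *ᶠ v))
    line-square c c∈F y = begin
      T ((y +ᶠ c *ᶠ v) *ᶠ (y +ᶠ c *ᶠ v))
        ≡⟨ cong T (solve 3 (λ c v y → (y :+ c :* v) :* (y :+ c :* v) := y :* y :+ c :* (y :* v :+ (y :* v :+ c :* (v :* v)))) refl c v y) ⟩
      T (y *ᶠ y +ᶠ c *ᶠ (y *ᶠ v +ᶠ (y *ᶠ v +ᶠ c *ᶠ (v *ᶠ v))))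
        ≡⟨ trans (T-+ _ _) (cong (T (y *ᶠ y) +ᶠ_) (trans (T-* c∈F _) (cong (c *ᶠ_) (trans (T-+ _ _) (cong (T (y *ᶠ v) +ᶠ_) (trans (T-+ _ _) (cong (T (y *ᶠ v) +ᶠ_) (trans (T-* c∈F _) (cong (c *ᶠ_) Tv²≡0))))))))) ⟩
      T (y *ᶠ y) +ᶠ c *ᶠ (T (y *ᶠ v) +ᶠ (T (y *ᶠ v) +ᶠ c *ᶠ 0ᶠ))
        ≡⟨ solve 3 (λ a b c → a :+ c :* (b :+ (b :+ c :* con 0ℤ)) := a :+ c :* ((con 1ℤ :+ con 1ℤ) :* b)) refl (T (y *ᶠ y)) (T (y *ᶠ v)) c ⟩
      T (y *ᶠ y) +ᶠ c *ᶠ (2ᶠ *ᶠ T (y *ᶠ v)) ∎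
      where open ≡-Reasoning

    unique-point : ∀ y → T (y *ᶠ v) ≢ 0ᶠ → ∑ (λ c → 𝟙 (InF? c) * 𝟙 (T (y *ᶠ y) +ᶠ c *ᶠ (2ᶠ *ᶠ T (y *ᶠ v)) ≟ᶠ 1ᶠ)) ≡ 1ℤ
    unique-point y T≢0 = begin
      ∑ (λ c → 𝟙 (InF? c) * 𝟙 (a +ᶠ c *ᶠ s ≟ᶠ 1ᶠ))       ≡⟨ ∑-cong (λ c → trans (ℤ.*-comm (𝟙 (InF? c)) (𝟙 (a +ᶠ c *ᶠ s ≟ᶠ 1ᶠ)))
                                                              (cong (_* 𝟙 (InF? c)) (𝟙-cong (a +ᶠ c *ᶠ s ≟ᶠ 1ᶠ) (c ≟ᶠ c₀) (to c) (from c)))) ⟩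
      ∑ (λ c → 𝟙 (c ≟ᶠ c₀) * 𝟙 (InF? c))                 ≡⟨ ∑-δ (λ c → 𝟙 (InF? c)) c₀ ⟩
      𝟙 (InF? c₀)                                        ≡⟨ 𝟙-true (InF? c₀) c₀∈F ⟩
      1ℤ                                                 ∎
      where
      open ≡-Reasoning
      a = T (y *ᶠ y)
      s = 2ᶠ *ᶠ T (y *ᶠ v)
      s≢0 : s ≢ 0ᶠ
      s≢0 = *ᶠ-nonzero 2≢0 T≢0
      c₀ = (1ᶠ -ᶠ a) *ᶠ s ⁻¹
      c₀∈F : InF c₀
      c₀∈F = *∈F (+∈F 1∈F (-∈F (T∈F (y *ᶠ y)))) (⁻¹∈F s≢0 (*∈F (+∈F 1∈F 1∈F) (T∈F (y *ᶠ v))))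
      to : ∀ c → a +ᶠ c *ᶠ s ≡ 1ᶠ → c ≡ c₀
      to c eq = trans (sym (mul-inv-cancelʳ c s s≢0)) (cong (_*ᶠ s ⁻¹)
        (trans (solve 2 (λ a z → z := a :+ z :+ (:- a)) refl a (c *ᶠ s)) (cong (_-ᶠ a) eq)))
      from : ∀ c → c ≡ c₀ → a +ᶠ c *ᶠ s ≡ 1ᶠ
      from c refl = trans (cong (a +ᶠ_) (mul-inv-cancelʳ′ (1ᶠ -ᶠ a) s s≢0)) (solve 1 (λ a → a :+ (con 1ℤ :+ (:- a)) := con 1ℤ) refl a)

    -- Rather than choosing representatives of the lines y + Fv, the count is repeated for all q
    -- translations by cv. Each y with T(yv) ≠ 0 then contributes exactly 1, and there are q³ - q²
    -- of these.
    count-off-hyperplane : ∑ (λ y → n y * 𝟙 (T (y *ᶠ y) ≟ᶠ 1ᶠ)) ≡ Q * Q - Q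
    count-off-hyperplane = ℤ.*-cancelˡ-≡ Q D (Q * Q - Q) (begin
      Q * D
        ≡⟨ cong (_* D) count-F ⟨
      ∑ (λ c → 𝟙 (InF? c)) * D
        ≡⟨ ∑-*ʳ D (λ c → 𝟙 (InF? c)) ⟨
      ∑ (λ c → 𝟙 (InF? c) * D)
        ≡⟨ ∑-cong (λ c → cong (𝟙 (InF? c) *_) (∑-translate h (c *ᶠ v))) ⟨
      ∑ (λ c → 𝟙 (InF? c) * ∑ (λ y → h (y +ᶠ c *ᶠ v)))
        ≡⟨ ∑-cong (λ c → 𝟙-guard (InF? c) (λ c∈F → ∑-cong (λ y → cong₂ (λ s t → 𝟙 (¬? (s ≟ᶠ 0ᶠ)) * 𝟙 (t ≟ᶠ 1ᶠ)) (line c c∈F y) (line-square c c∈F y)))) ⟩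
      ∑ (λ c → 𝟙 (InF? c) * ∑ (λ y → n y * e c y))
        ≡⟨ ∑-cong (λ c → ∑-*ˡ (𝟙 (InF? c)) (λ y → n y * e c y)) ⟨
      ∑ (λ c → ∑ (λ y → 𝟙 (InF? c) * (n y * e c y)))
        ≡⟨ ∑-swap (λ c y → 𝟙 (InF? c) * (n y * e c y)) ⟩
      ∑ (λ y → ∑ (λ c → 𝟙 (InF? c) * (n y * e c y)))
        ≡⟨ ∑-cong (λ y → trans (∑-cong (λ c → exchange (𝟙 (InF? c)) (n y) (e c y))) (∑-*ˡ (n y) (λ c → 𝟙 (InF? c) * e c y))) ⟩
      ∑ (λ y → n y * ∑ (λ c → 𝟙 (InF? c) * e c y))
        ≡⟨ ∑-cong (λ y → trans (𝟙-guard (¬? (T (y *ᶠ v) ≟ᶠ 0ᶠ)) (unique-point y)) (ℤ.*-identityʳ (n y))) ⟩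
      ∑ n
        ≡⟨ count-non-orthogonal ⟩
      Q * (Q * Q) - Q * Q
        ≡⟨ factor Q ⟩
      Q * (Q * Q - Q) ∎)
      where
      open ≡-Reasoning
      h : Carrier → ℤ
      h y = n y * 𝟙 (T (y *ᶠ y) ≟ᶠ 1ᶠ)
      D = ∑ h
      e : Carrier → Carrier → ℤ
      e c y = 𝟙 (T (y *ᶠ y) +ᶠ c *ᶠ (2ᶠ *ᶠ T (y *ᶠ v)) ≟ᶠ 1ᶠ)
      exchange : ∀ a b c → a * (b * c) ≡ b * (a * c)
      exchange = ℤRing.solve-∀
      factor : ∀ Q → Q * (Q * Q) - Q * Q ≡ Q * (Q * Q - Q)
      factor = ℤRing.solve-∀

    -- w = φv − φ²v is orthogonal to v with T(w²) = −T(v)², and −1 is a square in F.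
    unit-vector : ∃[ y ] T (y *ᶠ v) ≡ 0ᶠ × T (y *ᶠ y) ≡ 1ᶠ
    unit-vector = c *ᶠ w , y⊥v , y²
      where
      open ≡-Reasoning
      c w τ : Carrier
      τ = T v
      c = I *ᶠ τ ⁻¹
      w = φ v -ᶠ φ (φ v)
      c∈F : InF c
      c∈F = *∈F I∈F (⁻¹∈F Tv≢0 (T∈F v))
      φw : φ w ≡ φ (φ v) -ᶠ v
      φw = trans (frob-+ _ _) (cong (φ (φ v) +ᶠ_) (trans (φ-neg _) (cong -ᶠ_ (φ³ v))))
      φφw : φ (φ w) ≡ v -ᶠ φ v
      φφw = trans (cong φ φw) (trans (frob-+ _ _) (cong₂ _+ᶠ_ (φ³ v) (φ-neg v)))
      Twv : T (w *ᶠ v) ≡ 0ᶠ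
      Twv = begin
        T (w *ᶠ v)                                               ≡⟨ T-product w v ⟩
        w *ᶠ v +ᶠ φ w *ᶠ φ v +ᶠ φ (φ w) *ᶠ φ (φ v)               ≡⟨ cong₂ (λ s t → w *ᶠ v +ᶠ s *ᶠ φ v +ᶠ t *ᶠ φ (φ v)) φw φφw ⟩
        w *ᶠ v +ᶠ (φ (φ v) -ᶠ v) *ᶠ φ v +ᶠ (v -ᶠ φ v) *ᶠ φ (φ v) ≡⟨ solve 3 (λ a b c → (b :+ (:- c)) :* a :+ (c :+ (:- a)) :* b :+ (a :+ (:- b)) :* c := con 0ℤ) refl v (φ v) (φ (φ v)) ⟩
        0ᶠ                                                       ∎
      Tw² : T (w *ᶠ w) ≡ -ᶠ (τ *ᶠ τ)
      Tw² = begin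
        T (w *ᶠ w)
          ≡⟨ T-product w w ⟩
        w *ᶠ w +ᶠ φ w *ᶠ φ w +ᶠ φ (φ w) *ᶠ φ (φ w)
          ≡⟨ cong₂ (λ s t → w *ᶠ w +ᶠ s *ᶠ s +ᶠ t *ᶠ t) φw φφw ⟩
        w *ᶠ w +ᶠ (φ (φ v) -ᶠ v) *ᶠ (φ (φ v) -ᶠ v) +ᶠ (v -ᶠ φ v) *ᶠ (v -ᶠ φ v)
          ≡⟨ solve 3 (λ a b c → (b :+ (:- c)) :* (b :+ (:- c)) :+ (c :+ (:- a)) :* (c :+ (:- a)) :+ (a :+ (:- b)) :* (a :+ (:- b))
               := con (ℤ+ 3) :* (a :* a :+ b :* b :+ c :* c) :+ (:- ((a :+ b :+ c) :* (a :+ b :+ c)))) refl v (φ v) (φ (φ v)) ⟩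
        (2ᶠ +ᶠ 1ᶠ) *ᶠ (v *ᶠ v +ᶠ φ v *ᶠ φ v +ᶠ φ (φ v) *ᶠ φ (φ v)) -ᶠ (v +ᶠ φ v +ᶠ φ (φ v)) *ᶠ (v +ᶠ φ v +ᶠ φ (φ v))
          ≡⟨ cong₂ (λ s t → (2ᶠ +ᶠ 1ᶠ) *ᶠ s -ᶠ t *ᶠ t) (trans (sym (T-product v v)) Tv²≡0) (sym (T≡ v)) ⟩
        (2ᶠ +ᶠ 1ᶠ) *ᶠ 0ᶠ -ᶠ τ *ᶠ τ
          ≡⟨ solve 1 (λ t → con (ℤ+ 3) :* con 0ℤ :+ (:- (t :* t)) := :- (t :* t)) refl τ ⟩
        -ᶠ (τ *ᶠ τ) ∎
      y⊥v : T (c *ᶠ w *ᶠ v) ≡ 0ᶠ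
      y⊥v = trans (cong T (*ᶠ-assoc c w v)) (trans (T-* c∈F (w *ᶠ v)) (trans (cong (c *ᶠ_) Twv) (*ᶠ-zeroʳ c)))
      y² : T (c *ᶠ w *ᶠ (c *ᶠ w)) ≡ 1ᶠ
      y² = begin
        T (c *ᶠ w *ᶠ (c *ᶠ w))                     ≡⟨ cong T (solve 2 (λ c w → c :* w :* (c :* w) := c :* (c :* (w :* w))) refl c w) ⟩
        T (c *ᶠ (c *ᶠ (w *ᶠ w)))                   ≡⟨ trans (T-* c∈F _) (cong (c *ᶠ_) (trans (T-* c∈F _) (cong (c *ᶠ_) Tw²))) ⟩
        c *ᶠ (c *ᶠ (-ᶠ (τ *ᶠ τ)))                  ≡⟨ solve 3 (λ i t s → (i :* s) :* ((i :* s) :* (:- (t :* t))) := :- ((i :* i) :* ((t :* s) :* (t :* s)))) refl I τ (τ ⁻¹) ⟩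
        -ᶠ ((I *ᶠ I) *ᶠ ((τ *ᶠ τ ⁻¹) *ᶠ (τ *ᶠ τ ⁻¹)))  ≡⟨ cong₂ (λ s t → -ᶠ (s *ᶠ (t *ᶠ t))) I²≡-1 (inverseʳ τ Tv≢0) ⟩
        -ᶠ ((-ᶠ 1ᶠ) *ᶠ (1ᶠ *ᶠ 1ᶠ))                 ≡⟨ solve 0 (:- ((:- con 1ℤ) :* (con 1ℤ :* con 1ℤ)) := con 1ℤ) refl ⟩
        1ᶠ                                         ∎

    b⊥ : ℤ
    b⊥ = ∑ (λ y → 𝟙 (T (y *ᶠ v) ≟ᶠ 0ᶠ) * 𝟙 (T (y *ᶠ y) ≟ᶠ 1ᶠ))

    B≡ : Q * Q + B 1ᶠ ≡ (Q * Q - Q) + b⊥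
    B≡ = begin
      Q * Q + B 1ᶠ                                                  ≡⟨ count-T-square 1∈F ⟨
      ∑ (λ y → 𝟙 (T (y *ᶠ y) ≟ᶠ 1ᶠ))                                ≡⟨ ∑-cong (λ y → split (¬? (T (y *ᶠ v) ≟ᶠ 0ᶠ)) (T (y *ᶠ v) ≟ᶠ 0ᶠ) (𝟙 (T (y *ᶠ y) ≟ᶠ 1ᶠ)) (𝟙-¬ (T (y *ᶠ v) ≟ᶠ 0ᶠ))) ⟩
      ∑ (λ y → n y * 𝟙 (T (y *ᶠ y) ≟ᶠ 1ᶠ) + 𝟙 (T (y *ᶠ v) ≟ᶠ 0ᶠ) * 𝟙 (T (y *ᶠ y) ≟ᶠ 1ᶠ))
                                                                    ≡⟨ ∑-+ (λ y → n y * 𝟙 (T (y *ᶠ y) ≟ᶠ 1ᶠ)) (λ y → 𝟙 (T (y *ᶠ v) ≟ᶠ 0ᶠ) * 𝟙 (T (y *ᶠ y) ≟ᶠ 1ᶠ)) ⟩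
      ∑ (λ y → n y * 𝟙 (T (y *ᶠ y) ≟ᶠ 1ᶠ)) + b⊥                     ≡⟨ cong (_+ b⊥) count-off-hyperplane ⟩
      (Q * Q - Q) + b⊥                                              ∎
      where
      open ≡-Reasoning
      arith : ∀ i d → i ≡ (1ℤ - d) * i + d * i
      arith = ℤRing.solve-∀
      split : ∀ {P R : Set} (d : Dec P) (e : Dec R) i → 𝟙 d ≡ 1ℤ - 𝟙 e → i ≡ 𝟙 d * i + 𝟙 e * i
      split d e i eq = trans (arith i (𝟙 e)) (cong (λ j → j * i + 𝟙 e * i) (sym eq))

    b⊥≥1 : 1ℤ ≤ b⊥
    b⊥≥1 = subst (_≤ b⊥) (∑-δ₁ y₀) (∑-mono le)
      where
      y₀ = proj₁ unit-vector
      le : ∀ y → 𝟙 (y ≟ᶠ y₀) ≤ 𝟙 (T (y *ᶠ v) ≟ᶠ 0ᶠ) * 𝟙 (T (y *ᶠ y) ≟ᶠ 1ᶠ)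
      le y = ℤ.≤-trans (𝟙-mono (y ≟ᶠ y₀) ((T (y *ᶠ v) ≟ᶠ 0ᶠ) ×-dec (T (y *ᶠ y) ≟ᶠ 1ᶠ)) λ { refl → proj₂ unit-vector })
                       (ℤ.≤-reflexive (𝟙-× (T (y *ᶠ v) ≟ᶠ 0ᶠ) (T (y *ᶠ y) ≟ᶠ 1ᶠ)))
        where
        𝟙-× : ∀ {P R : Set} (d : Dec P) (e : Dec R) → 𝟙 (d ×-dec e) ≡ 𝟙 d * 𝟙 e
        𝟙-× (yes _) e = sym (ℤ.*-identityˡ (𝟙 e))
        𝟙-× (no _)  e = refl

  B-1 : B 1ᶠ ≡ Q
  B-1 = [ (λ eq → trans (add (B 1ᶠ) Q) (trans (cong (_+ Q) eq) (ℤ.+-identityˡ Q))) , ⊥-elim ∘ negative ]′ (ℤ.i*j≡0⇒i≡0∨j≡0 (B 1ᶠ - Q) product)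
    where
    open ≡-Reasoning
    add : ∀ b Q → b ≡ (b - Q) + Q
    add = ℤRing.solve-∀
    difference : ∀ b Q → (b - Q) * (b + Q) ≡ b * b - Q * Q
    difference = ℤRing.solve-∀
    product : (B 1ᶠ - Q) * (B 1ᶠ + Q) ≡ 0ℤ
    product = trans (difference (B 1ᶠ) Q) (trans (cong (_- Q * Q) B²) (ℤ.+-inverseʳ (Q * Q)))
    negative : B 1ᶠ + Q ≢ 0ℤ
    negative eq = let v , Tv²≡0 , Tv≢0 = isotropic in
      case subst (1ℤ ≤_) (trans (sym (rearrange (B 1ᶠ) Q (b⊥ Tv²≡0 Tv≢0) (B≡ Tv²≡0 Tv≢0))) eq) (b⊥≥1 Tv²≡0 Tv≢0) of λ { (Data.Integer.+≤+ ()) }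
      where
      open Isotropic
      left : ∀ b Q → b + Q ≡ (Q * Q + b) - (Q * Q - Q)
      left = ℤRing.solve-∀
      right : ∀ c Q → ((Q * Q - Q) + c) - (Q * Q - Q) ≡ c
      right = ℤRing.solve-∀
      rearrange : ∀ b Q c → Q * Q + b ≡ (Q * Q - Q) + c → b + Q ≡ c
      rearrange b Q c eq = trans (left b Q) (trans (cong (_- (Q * Q - Q)) eq) (right c Q))

  -- The Salié-type sum over g.

  X-minus-one : X (-ᶠ 1ᶠ) ≡ 1ℤ
  X-minus-one = trans (cong X (sym I²≡-1)) (X-square (^ᶠ-nonzero (N *ℕ r) α≢0))

  X-neg : ∀ x → X (-ᶠ x) ≡ X x
  X-neg x = trans (cong X (solve 1 (λ x → :- x := (:- con 1ℤ) :* x) refl x))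
                  (trans (X-* (-ᶠ 1ᶠ) x) (trans (cong (_* X x) X-minus-one) (ℤ.*-identityˡ (X x))))

  X-nonzero : ∀ {x} → x ≢ 0ᶠ → X x * X x ≡ 1ℤ
  X-nonzero {x} x≢0 = trans (sym (X-* x x)) (X-square x≢0)

  -- g + g⁻¹ ± 2 = (g ± 1)²/g, so X(g) = X(z + 2) on the roots of g² − zg + 1, whose discriminant is (z + 2)(z − 2).
  salié-fibre : ∀ z → ∑ (λ g → 𝟙 (g *ᶠ g +ᶠ 1ᶠ ≟ᶠ z *ᶠ g) * X g) ≡ X (z +ᶠ 2ᶠ) + X (z -ᶠ 2ᶠ)
  salié-fibre z = go (z ≟ᶠ 2ᶠ) (z ≟ᶠ (-ᶠ 2ᶠ))
    where
    open ≡-Reasoning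

    only-root : ∀ z a → z ≡ 2ᶠ *ᶠ a → a *ᶠ a ≡ 1ᶠ → ∑ (λ g → 𝟙 (g *ᶠ g +ᶠ 1ᶠ ≟ᶠ z *ᶠ g) * X g) ≡ X a
    only-root z a refl a²≡1 = trans (∑-cong (λ g → cong (_* X g) (𝟙-cong (g *ᶠ g +ᶠ 1ᶠ ≟ᶠ 2ᶠ *ᶠ a *ᶠ g) (g ≟ᶠ a) (to g) (from g)))) (∑-δ X a)
      where
      expand : ∀ g → (g -ᶠ a) *ᶠ (g -ᶠ a) ≡ g *ᶠ g +ᶠ 1ᶠ -ᶠ 2ᶠ *ᶠ a *ᶠ g
      expand g = trans (solve 2 (λ g a → (g :+ (:- a)) :* (g :+ (:- a)) := g :* g :+ a :* a :+ (:- ((con 1ℤ :+ con 1ℤ) :* a :* g))) refl g a)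
                       (cong (λ s → g *ᶠ g +ᶠ s -ᶠ 2ᶠ *ᶠ a *ᶠ g) a²≡1)
      to : ∀ g → g *ᶠ g +ᶠ 1ᶠ ≡ 2ᶠ *ᶠ a *ᶠ g → g ≡ a
      to g eq = -ᶠ-unique ([ id , id ]′ (zero-product (trans (expand g) (-ᶠ-self eq))))
      from : ∀ g → g ≡ a → g *ᶠ g +ᶠ 1ᶠ ≡ 2ᶠ *ᶠ a *ᶠ g
      from g g≡a = -ᶠ-unique (trans (sym (expand g)) (trans (cong (λ s → s *ᶠ s) (-ᶠ-self g≡a)) (*ᶠ-zeroˡ 0ᶠ)))

    generic : z -ᶠ 2ᶠ ≢ 0ᶠ → z +ᶠ 2ᶠ ≢ 0ᶠ → ∑ (λ g → 𝟙 (g *ᶠ g +ᶠ 1ᶠ ≟ᶠ z *ᶠ g) * X g) ≡ X (z +ᶠ 2ᶠ) + X (z -ᶠ 2ᶠ)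
    generic z-2≢0 z+2≢0 = begin
      ∑ (λ g → root g * X g)                                             ≡⟨ ∑-cong (λ g → 𝟙-guard (g *ᶠ g +ᶠ 1ᶠ ≟ᶠ z *ᶠ g) (X-root g)) ⟩
      ∑ (λ g → root g * X (z +ᶠ 2ᶠ))                                     ≡⟨ ∑-*ʳ (X (z +ᶠ 2ᶠ)) root ⟩
      ∑ root * X (z +ᶠ 2ᶠ)                                               ≡⟨ cong (_* X (z +ᶠ 2ᶠ)) count-roots ⟩
      (1ℤ + X (z +ᶠ 2ᶠ) * X (z -ᶠ 2ᶠ)) * X (z +ᶠ 2ᶠ)                     ≡⟨ expand (X (z +ᶠ 2ᶠ)) (X (z -ᶠ 2ᶠ)) ⟩
      X (z +ᶠ 2ᶠ) + X (z +ᶠ 2ᶠ) * X (z +ᶠ 2ᶠ) * X (z -ᶠ 2ᶠ)              ≡⟨ cong (X (z +ᶠ 2ᶠ) +_) (trans (cong (_* X (z -ᶠ 2ᶠ)) (X-nonzero z+2≢0)) (ℤ.*-identityˡ (X (z -ᶠ 2ᶠ)))) ⟩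
      X (z +ᶠ 2ᶠ) + X (z -ᶠ 2ᶠ)                                          ∎
      where
      root : Carrier → ℤ
      root g = 𝟙 (g *ᶠ g +ᶠ 1ᶠ ≟ᶠ z *ᶠ g)

      expand : ∀ a b → (1ℤ + a * b) * a ≡ a + a * a * b
      expand = ℤRing.solve-∀

      X-root : ∀ g → g *ᶠ g +ᶠ 1ᶠ ≡ z *ᶠ g → X g ≡ X (z +ᶠ 2ᶠ)
      X-root g eq = begin
        X g                                          ≡⟨ ℤ.*-identityʳ (X g) ⟨
        X g * 1ℤ                                     ≡⟨ cong (X g *_) (X-nonzero z+2≢0) ⟨
        X g * (X (z +ᶠ 2ᶠ) * X (z +ᶠ 2ᶠ))            ≡⟨ ℤ.*-assoc (X g) (X (z +ᶠ 2ᶠ)) (X (z +ᶠ 2ᶠ)) ⟨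
        X g * X (z +ᶠ 2ᶠ) * X (z +ᶠ 2ᶠ)              ≡⟨ cong (_* X (z +ᶠ 2ᶠ)) (trans (sym (X-* g (z +ᶠ 2ᶠ))) (trans (cong X (sym square)) (X-square g+1≢0))) ⟩
        1ℤ * X (z +ᶠ 2ᶠ)                             ≡⟨ ℤ.*-identityˡ (X (z +ᶠ 2ᶠ)) ⟩
        X (z +ᶠ 2ᶠ)                                  ∎
        where
        square : (g +ᶠ 1ᶠ) *ᶠ (g +ᶠ 1ᶠ) ≡ g *ᶠ (z +ᶠ 2ᶠ)
        square = begin
          (g +ᶠ 1ᶠ) *ᶠ (g +ᶠ 1ᶠ)              ≡⟨ solve 1 (λ g → (g :+ con 1ℤ) :* (g :+ con 1ℤ) := (g :* g :+ con 1ℤ) :+ g :* (con 1ℤ :+ con 1ℤ)) refl g ⟩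
          (g *ᶠ g +ᶠ 1ᶠ) +ᶠ g *ᶠ 2ᶠ           ≡⟨ cong (_+ᶠ g *ᶠ 2ᶠ) eq ⟩
          z *ᶠ g +ᶠ g *ᶠ 2ᶠ                   ≡⟨ solve 2 (λ z g → z :* g :+ g :* (con 1ℤ :+ con 1ℤ) := g :* (z :+ (con 1ℤ :+ con 1ℤ))) refl z g ⟩
          g *ᶠ (z +ᶠ 2ᶠ)                      ∎
        g≢0 : g ≢ 0ᶠ
        g≢0 refl = 1≢0 (trans (solve 0 (con 1ℤ := con 0ℤ :* con 0ℤ :+ con 1ℤ) refl) (trans eq (*ᶠ-zeroʳ z)))
        g+1≢0 : g +ᶠ 1ᶠ ≢ 0ᶠ
        g+1≢0 eq0 = *ᶠ-nonzero g≢0 z+2≢0 (trans (sym square) (trans (cong (λ s → s *ᶠ s) eq0) (*ᶠ-zeroˡ 0ᶠ)))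

      count-roots : ∑ root ≡ 1ℤ + X (z +ᶠ 2ᶠ) * X (z -ᶠ 2ᶠ)
      count-roots = begin
        ∑ root                                        ≡⟨ ∑-cong (λ g → 𝟙-cong (g *ᶠ g +ᶠ 1ᶠ ≟ᶠ z *ᶠ g) ((2ᶠ *ᶠ g -ᶠ z) *ᶠ (2ᶠ *ᶠ g -ᶠ z) ≟ᶠ d) (to g) (from g)) ⟩
        ∑ (λ g → isRoot (2ᶠ *ᶠ g -ᶠ z))               ≡⟨ ∑-scale (λ g → isRoot (g -ᶠ z)) 2ᶠ 2≢0 ⟩
        ∑ (λ g → isRoot (g -ᶠ z))                     ≡⟨ ∑-translate isRoot (-ᶠ z) ⟩
        ∑ isRoot                                      ≡⟨ count-square-roots d ⟩
        1ℤ + X d                                      ≡⟨ cong (1ℤ +_) (X-* (z +ᶠ 2ᶠ) (z -ᶠ 2ᶠ)) ⟩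
        1ℤ + X (z +ᶠ 2ᶠ) * X (z -ᶠ 2ᶠ)                ∎
        where
        d = (z +ᶠ 2ᶠ) *ᶠ (z -ᶠ 2ᶠ)
        isRoot : Carrier → ℤ
        isRoot y = 𝟙 (y *ᶠ y ≟ᶠ d)
        complete : ∀ g → (2ᶠ *ᶠ g -ᶠ z) *ᶠ (2ᶠ *ᶠ g -ᶠ z) -ᶠ d ≡ 2ᶠ *ᶠ (2ᶠ *ᶠ (g *ᶠ g +ᶠ 1ᶠ -ᶠ z *ᶠ g))
        complete = solve 2 (λ z g → let two = con 1ℤ :+ con 1ℤ in
          (two :* g :+ (:- z)) :* (two :* g :+ (:- z)) :+ (:- ((z :+ two) :* (z :+ (:- two)))) := two :* (two :* (g :* g :+ con 1ℤ :+ (:- (z :* g))))) refl z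
        to : ∀ g → g *ᶠ g +ᶠ 1ᶠ ≡ z *ᶠ g → (2ᶠ *ᶠ g -ᶠ z) *ᶠ (2ᶠ *ᶠ g -ᶠ z) ≡ d
        to g eq = -ᶠ-unique (trans (complete g) (trans (cong (λ s → 2ᶠ *ᶠ (2ᶠ *ᶠ s)) (-ᶠ-self eq)) (trans (cong (2ᶠ *ᶠ_) (*ᶠ-zeroʳ 2ᶠ)) (*ᶠ-zeroʳ 2ᶠ))))
        from : ∀ g → (2ᶠ *ᶠ g -ᶠ z) *ᶠ (2ᶠ *ᶠ g -ᶠ z) ≡ d → g *ᶠ g +ᶠ 1ᶠ ≡ z *ᶠ g
        from g eq = -ᶠ-unique (halve (halve (trans (sym (complete g)) (-ᶠ-self eq))))
          where
          halve : ∀ {a} → 2ᶠ *ᶠ a ≡ 0ᶠ → a ≡ 0ᶠ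
          halve 2a≡0 = [ ⊥-elim ∘ 2≢0 , id ]′ (zero-product 2a≡0)

    X-4 : X (2ᶠ +ᶠ 2ᶠ) ≡ 1ℤ
    X-4 = trans (cong X (solve 0 (let two = con 1ℤ :+ con 1ℤ in two :+ two := two :* two) refl)) (X-square 2≢0)

    -- At z = 2 and z = -2 the quadratic has the double root 1 or -1. On the right one term is X(0)
    -- = 0 and the other is X(4) or X(-4), both equal to 1.
    go : Dec (z ≡ 2ᶠ) → Dec (z ≡ -ᶠ 2ᶠ) → ∑ (λ g → 𝟙 (g *ᶠ g +ᶠ 1ᶠ ≟ᶠ z *ᶠ g) * X g) ≡ X (z +ᶠ 2ᶠ) + X (z -ᶠ 2ᶠ)
    go (yes z≡2) _ = trans (only-root z 1ᶠ (trans z≡2 (sym (*ᶠ-identityʳ 2ᶠ))) (*ᶠ-identityʳ 1ᶠ))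
      (trans X-1 (sym (cong₂ _+_ (trans (cong (λ z → X (z +ᶠ 2ᶠ)) z≡2) X-4) (trans (cong X (-ᶠ-self z≡2)) X-0))))
    go (no _) (yes z≡-2) = trans (only-root z (-ᶠ 1ᶠ) (trans z≡-2 (solve 0 (:- (con 1ℤ :+ con 1ℤ) := (con 1ℤ :+ con 1ℤ) :* (:- con 1ℤ)) refl))
        (solve 0 ((:- con 1ℤ) :* (:- con 1ℤ) := con 1ℤ) refl))
      (trans X-minus-one (sym (cong₂ _+_
        (trans (cong (λ z → X (z +ᶠ 2ᶠ)) z≡-2) (trans (cong X (solve 0 (let two = con 1ℤ :+ con 1ℤ in (:- two) :+ two := con 0ℤ) refl)) X-0))
        (trans (cong (λ z → X (z -ᶠ 2ᶠ)) z≡-2) (trans (cong X (solve 0 (let two = con 1ℤ :+ con 1ℤ in (:- two) :+ (:- two) := :- (two :+ two)) refl)) (trans (X-neg (2ᶠ +ᶠ 2ᶠ)) X-4))))))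
    go (no z≢2) (no z≢-2) = generic (z≢2 ∘ -ᶠ-unique)
      (λ eq → z≢-2 (-ᶠ-unique (trans (solve 1 (λ z → let two = con 1ℤ :+ con 1ℤ in z :+ (:- (:- two)) := z :+ two) refl z) eq)))

  -- Translating z by a moves the hyperplane T(xz) = 0 to T(xz) = aT(x). Scaling by x then gives the
  -- trace fibre over aT(x) at the price of a factor X(x), and aT(x) lies in F, where B is known.
  shifted-sum : ∀ {x} → x ≢ 0ᶠ → ∀ {a} → InF a → ∑ (λ z → 𝟙 (T (x *ᶠ z) ≟ᶠ 0ᶠ) * X (z +ᶠ a)) ≡ X x * (X a * X (T x) * Q)
  shifted-sum {x} x≢0 {a} a∈F = begin
    ∑ (λ z → 𝟙 (T (x *ᶠ z) ≟ᶠ 0ᶠ) * X (z +ᶠ a))                            ≡⟨ ∑-cong (λ z → cong (_* X (z +ᶠ a)) (𝟙-cong (T (x *ᶠ z) ≟ᶠ 0ᶠ) (T (x *ᶠ (z +ᶠ a)) ≟ᶠ a *ᶠ T x)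
                                                                                (λ eq → trans (shift z) (trans (cong (_+ᶠ a *ᶠ T x) eq) (+ᶠ-identityˡ _)))
                                                                                (λ eq → trans (solve 2 (λ s t → s := (s :+ t) :+ (:- t)) refl (T (x *ᶠ z)) (a *ᶠ T x)) (-ᶠ-self (trans (sym (shift z)) eq))))) ⟩
    ∑ (λ z → 𝟙 (T (x *ᶠ (z +ᶠ a)) ≟ᶠ a *ᶠ T x) * X (z +ᶠ a))               ≡⟨ ∑-translate (λ z → 𝟙 (T (x *ᶠ z) ≟ᶠ a *ᶠ T x) * X z) a ⟩
    ∑ (λ z → 𝟙 (T (x *ᶠ z) ≟ᶠ a *ᶠ T x) * X z)                             ≡⟨ ∑-cong (λ z → trans (cong (𝟙 (T (x *ᶠ z) ≟ᶠ a *ᶠ T x) *_) (X-scale z)) (exchange (𝟙 (T (x *ᶠ z) ≟ᶠ a *ᶠ T x)) (X x) (X (x *ᶠ z)))) ⟩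
    ∑ (λ z → X x * (𝟙 (T (x *ᶠ z) ≟ᶠ a *ᶠ T x) * X (x *ᶠ z)))              ≡⟨ ∑-*ˡ (X x) (λ z → 𝟙 (T (x *ᶠ z) ≟ᶠ a *ᶠ T x) * X (x *ᶠ z)) ⟩
    X x * ∑ (λ z → 𝟙 (T (x *ᶠ z) ≟ᶠ a *ᶠ T x) * X (x *ᶠ z))                ≡⟨ cong (X x *_) (∑-scale (λ z → 𝟙 (T z ≟ᶠ a *ᶠ T x) * X z) x x≢0) ⟩
    X x * B (a *ᶠ T x)                                                     ≡⟨ cong (X x *_) (trans (B-F (*∈F a∈F (T∈F x))) (cong₂ _*_ (X-* a (T x)) B-1)) ⟩
    X x * (X a * X (T x) * Q)                                              ∎
    where
    open ≡-Reasoning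
    exchange : ∀ a b c → a * (b * c) ≡ b * (a * c)
    exchange = ℤRing.solve-∀
    shift : ∀ z → T (x *ᶠ (z +ᶠ a)) ≡ T (x *ᶠ z) +ᶠ a *ᶠ T x
    shift z = trans (cong T (solve 3 (λ x z a → x :* (z :+ a) := x :* z :+ a :* x) refl x z a)) (trans (T-+ _ _) (cong (T (x *ᶠ z) +ᶠ_) (T-* a∈F x)))
    X-scale : ∀ z → X z ≡ X x * X (x *ᶠ z)
    X-scale z = begin
      X z                   ≡⟨ ℤ.*-identityˡ (X z) ⟨
      1ℤ * X z              ≡⟨ cong (_* X z) (X-nonzero x≢0) ⟨
      X x * X x * X z       ≡⟨ ℤ.*-assoc (X x) (X x) (X z) ⟩
      X x * (X x * X z)     ≡⟨ cong (X x *_) (X-* x z) ⟨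
      X x * X (x *ᶠ z)      ∎

  2∈F : InF 2ᶠ
  2∈F = +∈F 1∈F 1∈F

  -- The factor `X g` vanishes at 0, where `g ⁻¹` is unspecified, so a sum over E is really one over
  -- E*.
  salié : Carrier → Carrier → ℤ
  salié x g = X g * 𝟙 (T (x *ᶠ (g +ᶠ g ⁻¹)) ≟ᶠ 0ᶠ)

  -- The terms are sorted by z = g + g⁻¹, written as g² + 1 = zg to avoid the inverse. The shifts by
  -- 2 and by -2 contribute equally because -1 is a square, whence the factor 2.
  ∑-salié : ∀ {x} → x ≢ 0ᶠ → ∑ (salié x) ≡ ℤ+ 2 * (X x * (X 2ᶠ * X (T x) * Q))
  ∑-salié {x} x≢0 = begin
    ∑ (salié x)                                                              ≡⟨ ∑-cong (λ g → fibre g (g ≟ᶠ 0ᶠ)) ⟩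
    ∑ (λ g → ∑ (λ z → P z * (R z g * X g)))                                  ≡⟨ ∑-swap (λ g z → P z * (R z g * X g)) ⟩
    ∑ (λ z → ∑ (λ g → P z * (R z g * X g)))                                  ≡⟨ ∑-cong (λ z → trans (∑-*ˡ (P z) (λ g → R z g * X g)) (trans (cong (P z *_) (salié-fibre z)) (ℤ.*-distribˡ-+ (P z) (X (z +ᶠ 2ᶠ)) (X (z -ᶠ 2ᶠ))))) ⟩
    ∑ (λ z → P z * X (z +ᶠ 2ᶠ) + P z * X (z -ᶠ 2ᶠ))                          ≡⟨ ∑-+ (λ z → P z * X (z +ᶠ 2ᶠ)) (λ z → P z * X (z -ᶠ 2ᶠ)) ⟩
    ∑ (λ z → P z * X (z +ᶠ 2ᶠ)) + ∑ (λ z → P z * X (z -ᶠ 2ᶠ))                ≡⟨ cong₂ _+_ (shifted-sum x≢0 2∈F) (trans (shifted-sum x≢0 (-∈F 2∈F)) (cong (λ s → X x * (s * X (T x) * Q)) (X-neg 2ᶠ))) ⟩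
    V + V                                                                    ≡⟨ double V ⟩
    ℤ+ 2 * V                                                                 ∎
    where
    open ≡-Reasoning
    V = X x * (X 2ᶠ * X (T x) * Q)
    double : ∀ a → a + a ≡ ℤ+ 2 * a
    double = ℤRing.solve-∀
    P : Carrier → ℤ
    P z = 𝟙 (T (x *ᶠ z) ≟ᶠ 0ᶠ)
    R : Carrier → Carrier → ℤ
    R z g = 𝟙 (g *ᶠ g +ᶠ 1ᶠ ≟ᶠ z *ᶠ g)
    fibre : ∀ g → Dec (g ≡ 0ᶠ) → salié x g ≡ ∑ (λ z → P z * (R z g * X g))
    fibre g (yes g≡0) = trans (cong (_* P (g +ᶠ g ⁻¹)) X≡0) (sym (trans (∑-cong (λ z → trans (cong (λ s → P z * (R z g * s)) X≡0) (vanish (P z) (R z g))))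
                              (trans (∑-const 0ℤ) (ℤ.*-zeroʳ (ℤ+ (q ^ 3))))))
      where
      X≡0 = trans (cong X g≡0) X-0
      vanish : ∀ a b → a * (b * 0ℤ) ≡ 0ℤ
      vanish = ℤRing.solve-∀
    fibre g (no g≢0) = sym (begin
      ∑ (λ z → P z * (R z g * X g))                          ≡⟨ ∑-cong (λ z → trans (cong (λ s → P z * (s * X g)) (𝟙-cong (g *ᶠ g +ᶠ 1ᶠ ≟ᶠ z *ᶠ g) (z ≟ᶠ g +ᶠ g ⁻¹) (to z) (from z)))
                                                                 (exchange (P z) (𝟙 (z ≟ᶠ g +ᶠ g ⁻¹)) (X g))) ⟩
      ∑ (λ z → 𝟙 (z ≟ᶠ g +ᶠ g ⁻¹) * (X g * P z))             ≡⟨ ∑-δ (λ z → X g * P z) (g +ᶠ g ⁻¹) ⟩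
      salié x g                                              ∎)
      where
      exchange : ∀ a b c → a * (b * c) ≡ b * (c * a)
      exchange = ℤRing.solve-∀
      clear : (g +ᶠ g ⁻¹) *ᶠ g ≡ g *ᶠ g +ᶠ 1ᶠ
      clear = trans (solve 2 (λ g h → (g :+ h) :* g := g :* g :+ h :* g) refl g (g ⁻¹)) (cong (g *ᶠ g +ᶠ_) (inverseˡ g g≢0))
      to : ∀ z → g *ᶠ g +ᶠ 1ᶠ ≡ z *ᶠ g → z ≡ g +ᶠ g ⁻¹
      to z eq = *ᶠ-cancelˡ g≢0 (trans (*ᶠ-comm g z) (trans (sym eq) (trans (sym clear) (*ᶠ-comm _ g))))
      from : ∀ z → z ≡ g +ᶠ g ⁻¹ → g *ᶠ g +ᶠ 1ᶠ ≡ z *ᶠ g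
      from z refl = sym clear

  -- Real parts of quartic quotients as quadratic sums.

  e₋₁ : ℤ
  e₋₁ = re (χ₄ (-ᶠ 1ᶠ))

  -- (1 + I)² = 2I.
  e₋₁*X2 : e₋₁ * X 2ᶠ ≡ 1ℤ
  e₋₁*X2 = begin
    e₋₁ * X 2ᶠ                      ≡⟨ cong (λ s → re (χ₄ s) * X 2ᶠ) I²≡-1 ⟨
    re (χ₄ (I *ᶠ I)) * X 2ᶠ         ≡⟨ cong (_* X 2ᶠ) (X-χ₄ I) ⟨
    X I * X 2ᶠ                      ≡⟨ X-* I 2ᶠ ⟨
    X (I *ᶠ 2ᶠ)                     ≡⟨ cong X square ⟨
    X ((1ᶠ +ᶠ I) *ᶠ (1ᶠ +ᶠ I))      ≡⟨ X-square 1+I≢0 ⟩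
    1ℤ                              ∎
    where
    open ≡-Reasoning
    square : (1ᶠ +ᶠ I) *ᶠ (1ᶠ +ᶠ I) ≡ I *ᶠ 2ᶠ
    square = begin
      (1ᶠ +ᶠ I) *ᶠ (1ᶠ +ᶠ I)        ≡⟨ solve 1 (λ i → (con 1ℤ :+ i) :* (con 1ℤ :+ i) := con 1ℤ :+ i :* (con 1ℤ :+ con 1ℤ) :+ i :* i) refl I ⟩
      1ᶠ +ᶠ I *ᶠ 2ᶠ +ᶠ I *ᶠ I       ≡⟨ cong (1ᶠ +ᶠ I *ᶠ 2ᶠ +ᶠ_) I²≡-1 ⟩
      1ᶠ +ᶠ I *ᶠ 2ᶠ +ᶠ (-ᶠ 1ᶠ)      ≡⟨ solve 1 (λ z → con 1ℤ :+ z :+ (:- con 1ℤ) := z) refl (I *ᶠ 2ᶠ) ⟩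
      I *ᶠ 2ᶠ                       ∎
    1+I≢0 : 1ᶠ +ᶠ I ≢ 0ᶠ
    1+I≢0 eq = *ᶠ-nonzero (^ᶠ-nonzero (N *ℕ r) α≢0) 2≢0 (trans (sym square) (trans (cong (λ s → s *ᶠ s) eq) (*ᶠ-zeroˡ 0ᶠ)))

  -- If r = w², both roots lie in F by `square-root∈F`, and each contributes X(w) = χ₄(w²). If r is
  -- not a square, then χ₂(r) = -1, so χ₄(r) is i or -i and its real part is 0.
  re-square-root-sum : ∀ {r} → r ≢ 0ᶠ → InF r → ∑ (λ c → 𝟙 (InF? c) * (X c * 𝟙 (c *ᶠ c ≟ᶠ r))) ≡ ℤ+ 2 * re (χ₄ r)
  re-square-root-sum {r} r≢0 r∈F = go (square-or-nonsquare r≢0)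
    where
    open ≡-Reasoning
    rearrange : ∀ a b c → a * (b * c) ≡ c * (a * b)
    rearrange = ℤRing.solve-∀
    double : ∀ a → a + a ≡ ℤ+ 2 * a
    double = ℤRing.solve-∀
    re-square≡-1 : ∀ c → re (c ·c c) ≡ -1ℤ → re c ≡ 0ℤ
    re-square≡-1 czero ()
    re-square≡-1 (ipow f0) ()
    re-square≡-1 (ipow (fs f0)) _ = refl
    re-square≡-1 (ipow (fs (fs f0))) ()
    re-square≡-1 (ipow (fs (fs (fs f0)))) _ = refl
    go : (∃[ w ] w ≢ 0ᶠ × r ≡ w *ᶠ w) ⊎ X r ≡ -1ℤ → ∑ (λ c → 𝟙 (InF? c) * (X c * 𝟙 (c *ᶠ c ≟ᶠ r))) ≡ ℤ+ 2 * re (χ₄ r)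
    go (inj₁ (w , w≢0 , refl)) = begin
      ∑ (λ c → 𝟙 (InF? c) * (X c * 𝟙 (c *ᶠ c ≟ᶠ w *ᶠ w)))      ≡⟨ ∑-cong (λ c → rearrange (𝟙 (InF? c)) (X c) (𝟙 (c *ᶠ c ≟ᶠ w *ᶠ w))) ⟩
      ∑ (λ c → 𝟙 (c *ᶠ c ≟ᶠ w *ᶠ w) * (𝟙 (InF? c) * X c))      ≡⟨ ∑-square-root (λ c → 𝟙 (InF? c) * X c) w≢0 ⟩
      𝟙 (InF? w) * X w + 𝟙 (InF? (-ᶠ w)) * X (-ᶠ w)            ≡⟨ cong₂ _+_ (cong (_* X w) (𝟙-true (InF? w) w∈F)) (cong₂ _*_ (𝟙-true (InF? (-ᶠ w)) (-∈F w∈F)) (X-neg w)) ⟩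
      1ℤ * X w + 1ℤ * X w                                      ≡⟨ cong (λ s → s + s) (ℤ.*-identityˡ (X w)) ⟩
      X w + X w                                                ≡⟨ double (X w) ⟩
      ℤ+ 2 * X w                                               ≡⟨ cong (ℤ+ 2 *_) (X-χ₄ w) ⟩
      ℤ+ 2 * re (χ₄ (w *ᶠ w))                                  ∎
      where
      w∈F = square-root∈F w≢0 r∈F
    go (inj₂ Xr≡-1) = begin
      ∑ (λ c → 𝟙 (InF? c) * (X c * 𝟙 (c *ᶠ c ≟ᶠ r)))           ≡⟨ ∑-cong (λ c → trans (cong (λ s → 𝟙 (InF? c) * (X c * s)) (𝟙-false (c *ᶠ c ≟ᶠ r) (not-square c))) (vanish (𝟙 (InF? c)) (X c))) ⟩
      ∑ (λ _ → 0ℤ)                                             ≡⟨ trans (∑-const 0ℤ) (ℤ.*-zeroʳ (ℤ+ (q ^ 3))) ⟩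
      ℤ+ 2 * 0ℤ                                                ≡⟨ cong (ℤ+ 2 *_) (re-square≡-1 (χ₄ r) Xr≡-1) ⟨
      ℤ+ 2 * re (χ₄ r)                                         ∎
      where
      vanish : ∀ a b → a * (b * 0ℤ) ≡ 0ℤ
      vanish = ℤRing.solve-∀
      not-square : ∀ c → c *ᶠ c ≢ r
      not-square c refl = case trans (sym Xr≡-1) (X-square (λ { refl → r≢0 (*ᶠ-zeroˡ _) })) of λ ()

  -- The nonsquare α^N permutes F and changes the sign of X. This serves the case s = t = 0 of
  -- `re-quotient`, where every c in F satisfies the equation.
  ∑F-X : ∑ (λ c → 𝟙 (InF? c) * X c) ≡ 0ℤ
  ∑F-X = self-negative S (begin
    S                                                       ≡⟨ ∑-scale (λ c → 𝟙 (InF? c) * X c) β β≢0 ⟨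
    ∑ (λ c → 𝟙 (InF? (β *ᶠ c)) * X (β *ᶠ c))                ≡⟨ ∑-cong (λ c → trans (cong₂ _*_ (𝟙-cong (InF? (β *ᶠ c)) (InF? c) (to c) (*∈F β∈F)) (trans (X-* β c) (cong (_* X c) X-α^N))) (exchange (𝟙 (InF? c)) (X c))) ⟩
    ∑ (λ c → -1ℤ * (𝟙 (InF? c) * X c))                      ≡⟨ ∑-*ˡ -1ℤ (λ c → 𝟙 (InF? c) * X c) ⟩
    -1ℤ * S                                                 ∎)
    where
    open ≡-Reasoning
    S = ∑ (λ c → 𝟙 (InF? c) * X c)
    β = α ^ᶠ N
    β≢0 : β ≢ 0ᶠ
    β≢0 = α^-nonzero N
    β∈F : InF β
    β∈F = N∣⇒α^∈F ℕ∣.∣-refl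
    to : ∀ c → InF (β *ᶠ c) → InF c
    to c βc∈F = *ᶠ-cancelˡ β≢0 (trans (cong (_*ᶠ φ c) (sym β∈F)) (trans (sym (φ-* β c)) βc∈F))
    exchange : ∀ a b → a * (-1ℤ * b) ≡ -1ℤ * (a * b)
    exchange = ℤRing.solve-∀

  -- c runs over the square roots of −s/t, and χ₄(c²) = χ₂(c).
  re-quotient : ∀ {s t} → InF s → InF t →
    ℤ+ 2 * re (χ₄ s ·c conj (χ₄ t)) ≡ e₋₁ * ∑ (λ c → 𝟙 (InF? c) * (X c * 𝟙 (s +ᶠ c *ᶠ c *ᶠ t ≟ᶠ 0ᶠ)))
  re-quotient {s} {t} s∈F t∈F = go (s ≟ᶠ 0ᶠ) (t ≟ᶠ 0ᶠ)
    where
    open ≡-Reasoning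
    W : ℤ
    W = ∑ (λ c → 𝟙 (InF? c) * (X c * 𝟙 (s +ᶠ c *ᶠ c *ᶠ t ≟ᶠ 0ᶠ)))

    ∑-vanish : (∀ c → X c * 𝟙 (s +ᶠ c *ᶠ c *ᶠ t ≟ᶠ 0ᶠ) ≡ 0ℤ) → W ≡ 0ℤ
    ∑-vanish eq = trans (∑-cong (λ c → trans (cong (𝟙 (InF? c) *_) (eq c)) (ℤ.*-zeroʳ (𝟙 (InF? c))))) (trans (∑-const 0ℤ) (ℤ.*-zeroʳ (ℤ+ (q ^ 3))))

    both-zero : re (χ₄ s ·c conj (χ₄ t)) ≡ 0ℤ → W ≡ 0ℤ → ℤ+ 2 * re (χ₄ s ·c conj (χ₄ t)) ≡ e₋₁ * W
    both-zero l r = trans (cong (ℤ+ 2 *_) l) (sym (trans (cong (e₋₁ *_) r) (ℤ.*-zeroʳ e₋₁)))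

    χ₄s≡0 : s ≡ 0ᶠ → re (χ₄ s ·c conj (χ₄ t)) ≡ 0ℤ
    χ₄s≡0 s≡0 = cong (λ a → re (a ·c conj (χ₄ t))) (trans (cong χ₄ s≡0) χ₄-0)

    go : Dec (s ≡ 0ᶠ) → Dec (t ≡ 0ᶠ) → ℤ+ 2 * re (χ₄ s ·c conj (χ₄ t)) ≡ e₋₁ * W
    go (yes s≡0) (yes t≡0) = both-zero (χ₄s≡0 s≡0) (trans (∑-cong (λ c → cong (𝟙 (InF? c) *_) (trans (cong (X c *_) (𝟙-true (s +ᶠ c *ᶠ c *ᶠ t ≟ᶠ 0ᶠ) (holds c))) (ℤ.*-identityʳ (X c))))) ∑F-X)
      where
      holds : ∀ c → s +ᶠ c *ᶠ c *ᶠ t ≡ 0ᶠ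
      holds c = trans (cong₂ (λ s t → s +ᶠ c *ᶠ c *ᶠ t) s≡0 t≡0) (solve 1 (λ c → con 0ℤ :+ c :* c :* con 0ℤ := con 0ℤ) refl c)
    go (yes s≡0) (no t≢0) = both-zero (χ₄s≡0 s≡0) (∑-vanish (λ c → c-case c (c ≟ᶠ 0ᶠ)))
      where
      c-case : ∀ c → Dec (c ≡ 0ᶠ) → X c * 𝟙 (s +ᶠ c *ᶠ c *ᶠ t ≟ᶠ 0ᶠ) ≡ 0ℤ
      c-case c (yes c≡0) = cong (_* 𝟙 (s +ᶠ c *ᶠ c *ᶠ t ≟ᶠ 0ᶠ)) (trans (cong X c≡0) X-0)
      c-case c (no c≢0)  = trans (cong (X c *_) (𝟙-false (s +ᶠ c *ᶠ c *ᶠ t ≟ᶠ 0ᶠ)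
        (λ eq → *ᶠ-nonzero (*ᶠ-nonzero c≢0 c≢0) t≢0 (trans (sym (+ᶠ-identityˡ _)) (trans (cong (_+ᶠ c *ᶠ c *ᶠ t) (sym s≡0)) eq))))) (ℤ.*-zeroʳ (X c))
    go (no s≢0) (yes t≡0) = both-zero
      (cong re (trans (cong (λ a → χ₄ s ·c conj a) (trans (cong χ₄ t≡0) χ₄-0)) (·c-zeroʳ (χ₄ s))))
      (∑-vanish (λ c → trans (cong (X c *_) (𝟙-false (s +ᶠ c *ᶠ c *ᶠ t ≟ᶠ 0ᶠ) (λ eq → s≢0 (trans (drop c) eq)))) (ℤ.*-zeroʳ (X c))))
      where
      drop : ∀ c → s ≡ s +ᶠ c *ᶠ c *ᶠ t
      drop c = sym (trans (cong (λ t → s +ᶠ c *ᶠ c *ᶠ t) t≡0) (solve 2 (λ s c → s :+ c :* c :* con 0ℤ := s) refl s c))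
    go (no s≢0) (no t≢0) = begin
      -- With ρ = -s/t one has s = I²ρt, and conjugation cancels χ₄(t). The factor χ₂(I) = χ₄(-1) is
      -- real, so it can be taken out of the real part.
      ℤ+ 2 * re (χ₄ s ·c conj (χ₄ t))              ≡⟨ cong (λ a → ℤ+ 2 * re a) quotient ⟩
      ℤ+ 2 * re (χ₂ I ·c χ₄ ρ)                     ≡⟨ cong (ℤ+ 2 *_) (re-square-· (χ₄ I) (χ₄ ρ)) ⟩
      ℤ+ 2 * (X I * re (χ₄ ρ))                     ≡⟨ exchange (X I) (re (χ₄ ρ)) ⟩
      X I * (ℤ+ 2 * re (χ₄ ρ))                     ≡⟨ cong₂ _*_ (trans (X-χ₄ I) (cong (re ∘ χ₄) I²≡-1)) (sym (re-square-root-sum ρ≢0 ρ∈F)) ⟩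
      e₋₁ * ∑ (λ c → 𝟙 (InF? c) * (X c * 𝟙 (c *ᶠ c ≟ᶠ ρ)))
        ≡⟨ cong (e₋₁ *_) (∑-cong (λ c → cong (λ i → 𝟙 (InF? c) * (X c * i)) (𝟙-cong (c *ᶠ c ≟ᶠ ρ) (s +ᶠ c *ᶠ c *ᶠ t ≟ᶠ 0ᶠ) (to c) (from c)))) ⟩
      e₋₁ * W                                      ∎
      where
      exchange : ∀ a b → ℤ+ 2 * (a * b) ≡ a * (ℤ+ 2 * b)
      exchange = ℤRing.solve-∀
      ρ = -ᶠ (s *ᶠ t ⁻¹)
      ρ∈F : InF ρ
      ρ∈F = -∈F (*∈F s∈F (⁻¹∈F t≢0 t∈F))
      ρt : s ≡ (-ᶠ ρ) *ᶠ t
      ρt = sym (trans (cong (_*ᶠ t) (solve 1 (λ a → :- (:- a) := a) refl (s *ᶠ t ⁻¹))) (mul-inv-cancelʳ′ s t t≢0))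
      ρ≢0 : ρ ≢ 0ᶠ
      ρ≢0 eq = s≢0 (trans ρt (trans (cong (λ a → (-ᶠ a) *ᶠ t) eq) (solve 1 (λ t → (:- con 0ℤ) :* t := con 0ℤ) refl t)))
      quotient : χ₄ s ·c conj (χ₄ t) ≡ χ₂ I ·c χ₄ ρ
      quotient = begin
        χ₄ s ·c conj (χ₄ t)                              ≡⟨ cong (λ a → χ₄ a ·c conj (χ₄ t)) (trans ρt (cong (_*ᶠ t) (trans (solve 1 (λ a → :- a := (:- con 1ℤ) :* a) refl ρ) (cong (_*ᶠ ρ) (sym I²≡-1))))) ⟩
        χ₄ (I *ᶠ I *ᶠ ρ *ᶠ t) ·c conj (χ₄ t)             ≡⟨ cong (_·c conj (χ₄ t)) (trans (χ₄-* (I *ᶠ I *ᶠ ρ) t) (cong (_·c χ₄ t) (trans (χ₄-* (I *ᶠ I) ρ) (cong (_·c χ₄ ρ) (χ₄-* I I))))) ⟩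
        ((χ₂ I ·c χ₄ ρ) ·c χ₄ t) ·c conj (χ₄ t)           ≡⟨ ·c-assoc (χ₂ I ·c χ₄ ρ) (χ₄ t) (conj (χ₄ t)) ⟩
        (χ₂ I ·c χ₄ ρ) ·c (χ₄ t ·c conj (χ₄ t))          ≡⟨ cong ((χ₂ I ·c χ₄ ρ) ·c_) (unit (χ₄-unit t≢0)) ⟩
        (χ₂ I ·c χ₄ ρ) ·c c1                             ≡⟨ trans (·c-comm (χ₂ I ·c χ₄ ρ) c1) (·c-identityˡ _) ⟩
        χ₂ I ·c χ₄ ρ                                     ∎
        where
        unit : (∃[ a ] χ₄ t ≡ ipow a) → χ₄ t ·c conj (χ₄ t) ≡ c1
        unit (a , eq) = trans (cong (λ c → c ·c conj c) eq) (·c-conj a)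
      to : ∀ c → c *ᶠ c ≡ ρ → s +ᶠ c *ᶠ c *ᶠ t ≡ 0ᶠ
      to c eq = trans (cong₂ (λ a b → a +ᶠ b *ᶠ t) ρt eq) (solve 2 (λ a t → (:- a) :* t :+ a :* t := con 0ℤ) refl ρ t)
      from : ∀ c → s +ᶠ c *ᶠ c *ᶠ t ≡ 0ᶠ → c *ᶠ c ≡ ρ
      from c eq = *ᶠ-cancelˡ t≢0 (-ᶠ-unique (begin
        t *ᶠ (c *ᶠ c) -ᶠ t *ᶠ ρ           ≡⟨ solve 3 (λ t d a → t :* d :+ (:- (t :* a)) := (:- a) :* t :+ d :* t) refl t (c *ᶠ c) ρ ⟩
        (-ᶠ ρ) *ᶠ t +ᶠ c *ᶠ c *ᶠ t        ≡⟨ cong (_+ᶠ c *ᶠ c *ᶠ t) ρt ⟨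
        s +ᶠ c *ᶠ c *ᶠ t                  ≡⟨ eq ⟩
        0ᶠ                                ∎))

  -- The powers of μ as representatives of E* modulo F*.

  μ≢0 : μ ≢ 0ᶠ
  μ≢0 = ^ᶠ-nonzero (q ∸ 1) α≢0

  -- The exponent q - 1 = 4r of μ is even, so μ is a square. Passing from g to μⁱg therefore leaves
  -- the quadratic character unchanged.
  X-μ^ : ∀ i → X (μ ^ᶠ i) ≡ 1ℤ
  X-μ^ zero    = X-1
  X-μ^ (suc i) = trans (X-* μ (μ ^ᶠ i)) (cong₂ _*_ X-μ (X-μ^ i))
    where
    X-μ : X μ ≡ 1ℤ
    X-μ = trans (cong X (trans (cong (α ^ᶠ_) (trans q∸1≡4r (split r))) (^ᶠ-+ α (r *ℕ 2) (r *ℕ 2)))) (X-square (α^-nonzero (r *ℕ 2)))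
      where
      split : ∀ r → r *ℕ 4 ≡ r *ℕ 2 +ℕ r *ℕ 2
      split = ℕRing.solve-∀

  μ^-inverse : ∀ i → μ ^ᶠ i *ᶠ (μ ⁻¹) ^ᶠ i ≡ 1ᶠ
  μ^-inverse i = trans (sym (*ᶠ-^ᶠ μ (μ ⁻¹) i)) (trans (cong (_^ᶠ i) (inverseʳ μ μ≢0)) (1^ᶠ i))

  [q-1][q+2]+3≡N : (q ∸ 1) *ℕ (q +ℕ 2) +ℕ 3 ≡ N
  [q-1][q+2]+3≡N = trans (cong₂ (λ a b → a *ℕ (b +ℕ 2) +ℕ 3) q∸1≡4r q≡1+4r) (trans (expand r) (cong (λ a → a *ℕ a +ℕ a +ℕ 1) (sym q≡1+4r)))
    where
    expand : ∀ r → r *ℕ 4 *ℕ (suc (r *ℕ 4) +ℕ 2) +ℕ 3 ≡ suc (r *ℕ 4) *ℕ suc (r *ℕ 4) +ℕ suc (r *ℕ 4) +ℕ 1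
    expand = ℕRing.solve-∀

  -- (q − 1)(q + 2) ≡ −3 mod N, and 3 is invertible modulo N.
  N∣[q-1]m⇒N∣m : ∀ m → N ∣ (q ∸ 1) *ℕ m → N ∣ m
  N∣[q-1]m⇒N∣m m N∣ = N∣m*3⇒N∣m m (ℕ∣.∣m+n∣m⇒∣n
    (subst (N ∣_) (trans (cong (m *ℕ_) (sym [q-1][q+2]+3≡N)) (expand m (q ∸ 1) (q +ℕ 2))) (ℕ∣.∣n⇒∣m*n m ℕ∣.∣-refl))
    (ℕ∣.∣n⇒∣m*n (q +ℕ 2) N∣))
    where
    expand : ∀ m a b → m *ℕ (a *ℕ b +ℕ 3) ≡ b *ℕ (a *ℕ m) +ℕ m *ℕ 3
    expand = ℕRing.solve-∀

  -- With N = 3k + 1, the inverse of 3 modulo N is 2k + 1.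
  solve-congruence : ∀ n → ∃[ i ] i <ℕ N × N ∣ (q ∸ 1) *ℕ i +ℕ n
  solve-congruence n = j % N , ℕ/.m%n<n j N , ℕ∣.∣m+n∣m⇒∣n (subst (N ∣_) reduce N∣j) (ℕ∣.∣n⇒∣m*n ((q ∸ 1) *ℕ (j / N)) ℕ∣.∣-refl)
    where
    k = proj₁ N≡1+3k
    -- Modulo N this is (q + 2)·n/3, and (q - 1)(q + 2) ≡ -3 yields (q - 1)j ≡ -n.
    j = (q +ℕ 2) *ℕ ((2 *ℕ k +ℕ 1) *ℕ n)
    N∣j : N ∣ (q ∸ 1) *ℕ j +ℕ n
    N∣j = ℕ∣.∣m+n∣m⇒∣n (subst (N ∣_) total (ℕ∣.∣n⇒∣m*n ((2 *ℕ k +ℕ 1) *ℕ n) ℕ∣.∣-refl)) (ℕ∣.∣n⇒∣m*n (2 *ℕ n) ℕ∣.∣-refl)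
      where
      expand : ∀ a b k n → (2 *ℕ k +ℕ 1) *ℕ n *ℕ (a *ℕ b +ℕ 3) ≡ 2 *ℕ n *ℕ suc (k *ℕ 3) +ℕ (a *ℕ (b *ℕ ((2 *ℕ k +ℕ 1) *ℕ n)) +ℕ n)
      expand = ℕRing.solve-∀
      total : (2 *ℕ k +ℕ 1) *ℕ n *ℕ N ≡ 2 *ℕ n *ℕ N +ℕ ((q ∸ 1) *ℕ j +ℕ n)
      total = trans (cong ((2 *ℕ k +ℕ 1) *ℕ n *ℕ_) (sym [q-1][q+2]+3≡N))
        (trans (expand (q ∸ 1) (q +ℕ 2) k n) (cong (λ m → 2 *ℕ n *ℕ m +ℕ ((q ∸ 1) *ℕ j +ℕ n)) (sym (proj₂ N≡1+3k))))
    reduce : (q ∸ 1) *ℕ j +ℕ n ≡ (q ∸ 1) *ℕ (j / N) *ℕ N +ℕ ((q ∸ 1) *ℕ (j % N) +ℕ n)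
    reduce = trans (cong (λ j → (q ∸ 1) *ℕ j +ℕ n) (ℕ/.m≡m%n+[m/n]*n j N)) (regroup (q ∸ 1) (j % N) (j / N) N n)
      where
      regroup : ∀ a s d N n → a *ℕ (s +ℕ d *ℕ N) +ℕ n ≡ a *ℕ d *ℕ N +ℕ (a *ℕ s +ℕ n)
      regroup = ℕRing.solve-∀

  congruence-unique : ∀ {n i j} → i <ℕ N → j <ℕ N → N ∣ (q ∸ 1) *ℕ i +ℕ n → N ∣ (q ∸ 1) *ℕ j +ℕ n → i ≡ j
  congruence-unique {n} {i} {j} i<N j<N N∣i N∣j =
    [ (λ i≤j → go i≤j j<N N∣i N∣j) , (λ j≤i → sym (go j≤i i<N N∣j N∣i)) ]′ (ℕ.≤-total i j)
    where
    go : ∀ {i j} → i ≤ℕ j → j <ℕ N → N ∣ (q ∸ 1) *ℕ i +ℕ n → N ∣ (q ∸ 1) *ℕ j +ℕ n → i ≡ j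
    go {i} {j} i≤j j<N N∣i N∣j = ∣difference⇒≡ i≤j j<N (N∣[q-1]m⇒N∣m (j ∸ i) (ℕ∣.∣m+n∣m⇒∣n (subst (N ∣_) split N∣j) N∣i))
      where
      regroup : ∀ a i d n → a *ℕ (i +ℕ d) +ℕ n ≡ a *ℕ i +ℕ n +ℕ a *ℕ d
      regroup = ℕRing.solve-∀
      split : (q ∸ 1) *ℕ j +ℕ n ≡ (q ∸ 1) *ℕ i +ℕ n +ℕ (q ∸ 1) *ℕ (j ∸ i)
      split = trans (cong (λ j → (q ∸ 1) *ℕ j +ℕ n) (sym (ℕ.m+[n∸m]≡n i≤j))) (regroup (q ∸ 1) i (j ∸ i) n)

  -- The powers μⁱ with i < N represent E* modulo F*.
  ∑-coset : ∀ {g} → g ≢ 0ᶠ → sum {N} (λ i → 𝟙 (InF? (μ ^ᶠ toℕ i *ᶠ g))) ≡ 1ℤ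
  ∑-coset {g} g≢0 = begin
    sum {N} (λ i → 𝟙 (InF? (μ ^ᶠ toℕ i *ᶠ g)))        ≡⟨ sum-single (λ i → 𝟙 (InF? (μ ^ᶠ toℕ i *ᶠ g))) (fromℕ< i₀<N) (λ i i≢i₀ → 𝟙-false (InF? (μ ^ᶠ toℕ i *ᶠ g)) (λ i∈F →
                                                          i≢i₀ (Fin.toℕ-injective (trans (congruence-unique {n} (Fin.toℕ<n i) i₀<N (to (toℕ i) i∈F) N∣i₀) (sym (Fin.toℕ-fromℕ< i₀<N)))))) ⟩
    𝟙 (InF? (μ ^ᶠ toℕ (fromℕ< i₀<N) *ᶠ g))            ≡⟨ cong (λ i → 𝟙 (InF? (μ ^ᶠ i *ᶠ g))) (Fin.toℕ-fromℕ< i₀<N) ⟩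
    𝟙 (InF? (μ ^ᶠ i₀ *ᶠ g))                           ≡⟨ 𝟙-true (InF? (μ ^ᶠ i₀ *ᶠ g)) (subst InF (sym (exponent i₀)) (N∣⇒α^∈F N∣i₀)) ⟩
    1ℤ                                                ∎
    where
    open ≡-Reasoning
    n i₀ : ℕ
    n = proj₁ (prim g g≢0)
    i₀ = proj₁ (solve-congruence n)
    i₀<N : i₀ <ℕ N
    i₀<N = proj₁ (proj₂ (solve-congruence n))
    N∣i₀ : N ∣ (q ∸ 1) *ℕ i₀ +ℕ n
    N∣i₀ = proj₂ (proj₂ (solve-congruence n))
    exponent : ∀ i → μ ^ᶠ i *ᶠ g ≡ α ^ᶠ ((q ∸ 1) *ℕ i +ℕ n)
    exponent i = sym (trans (^ᶠ-+ α ((q ∸ 1) *ℕ i) n) (cong₂ _*ᶠ_ (^ᶠ-* α (q ∸ 1) i) (proj₂ (prim g g≢0))))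
    to : ∀ i → InF (μ ^ᶠ i *ᶠ g) → N ∣ (q ∸ 1) *ℕ i +ℕ n
    to i i∈F = α^∈F⇒N∣ ((q ∸ 1) *ℕ i +ℕ n) (subst InF (exponent i) i∈F)

  -- The difference κ₁ - κ₋₁.

  -- For c = μⁱg in F*, T(μⁱx) + c²T(μ⁻ⁱx) = c T(x(g + g⁻¹)) and χ₂(c) = χ₂(g).
  to-salié : ∀ x i → ∑ (λ c → 𝟙 (InF? c) * (X c * 𝟙 (T (μ ^ᶠ i *ᶠ x) +ᶠ c *ᶠ c *ᶠ T ((μ ⁻¹) ^ᶠ i *ᶠ x) ≟ᶠ 0ᶠ)))
           ≡ ∑ (λ g → 𝟙 (InF? (μ ^ᶠ i *ᶠ g)) * salié x g)
  to-salié x i = trans (sym (∑-scale F u (^ᶠ-nonzero i μ≢0))) (∑-cong (λ g → 𝟙-guard (InF? (u *ᶠ g)) (λ ug∈F → go g ug∈F (g ≟ᶠ 0ᶠ))))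
    where
    open ≡-Reasoning
    u = μ ^ᶠ i
    ν = (μ ⁻¹) ^ᶠ i
    F : Carrier → ℤ
    F c = 𝟙 (InF? c) * (X c * 𝟙 (T (u *ᶠ x) +ᶠ c *ᶠ c *ᶠ T (ν *ᶠ x) ≟ᶠ 0ᶠ))
    X-ug : ∀ g → X (u *ᶠ g) ≡ X g
    X-ug g = trans (X-* u g) (trans (cong (_* X g) (X-μ^ i)) (ℤ.*-identityˡ (X g)))
    go : ∀ g → InF (u *ᶠ g) → Dec (g ≡ 0ᶠ) → X (u *ᶠ g) * 𝟙 (T (u *ᶠ x) +ᶠ (u *ᶠ g) *ᶠ (u *ᶠ g) *ᶠ T (ν *ᶠ x) ≟ᶠ 0ᶠ) ≡ salié x g
    go g _ (yes g≡0) = trans (cong (_* 𝟙 (T (u *ᶠ x) +ᶠ (u *ᶠ g) *ᶠ (u *ᶠ g) *ᶠ T (ν *ᶠ x) ≟ᶠ 0ᶠ)) (trans (X-ug g) X≡0)) (sym (cong (_* 𝟙 (T (x *ᶠ (g +ᶠ g ⁻¹)) ≟ᶠ 0ᶠ)) X≡0))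
      where X≡0 = trans (cong X g≡0) X-0
    go g ug∈F (no g≢0) = cong₂ _*_ (X-ug g) (𝟙-cong (T (u *ᶠ x) +ᶠ c *ᶠ c *ᶠ T (ν *ᶠ x) ≟ᶠ 0ᶠ) (T (x *ᶠ (g +ᶠ g ⁻¹)) ≟ᶠ 0ᶠ)
        (λ eq → [ ⊥-elim ∘ *ᶠ-nonzero (^ᶠ-nonzero i μ≢0) g≢0 , id ]′ (zero-product (trans (sym factor) eq)))
        (λ eq → trans factor (trans (cong (c *ᶠ_) eq) (*ᶠ-zeroʳ c))))
      where
      c = u *ᶠ g
      first : T (u *ᶠ x) ≡ c *ᶠ T (g ⁻¹ *ᶠ x)
      first = trans (cong T (sym (trans (solve 4 (λ u g h x → u :* g :* (h :* x) := (g :* h) :* (u :* x)) refl u g (g ⁻¹) x) (trans (cong (_*ᶠ (u *ᶠ x)) (inverseʳ g g≢0)) (*ᶠ-identityˡ _)))))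
                    (T-* ug∈F (g ⁻¹ *ᶠ x))
      second : c *ᶠ T (ν *ᶠ x) ≡ T (g *ᶠ x)
      second = trans (sym (T-* ug∈F (ν *ᶠ x))) (cong T (trans (solve 4 (λ u g v x → u :* g :* (v :* x) := (u :* v) :* (g :* x)) refl u g ν x) (trans (cong (_*ᶠ (g *ᶠ x)) (μ^-inverse i)) (*ᶠ-identityˡ _))))
      factor : T (u *ᶠ x) +ᶠ c *ᶠ c *ᶠ T (ν *ᶠ x) ≡ c *ᶠ T (x *ᶠ (g +ᶠ g ⁻¹))
      factor = begin
        T (u *ᶠ x) +ᶠ c *ᶠ c *ᶠ T (ν *ᶠ x)           ≡⟨ cong₂ _+ᶠ_ first (trans (*ᶠ-assoc c c _) (cong (c *ᶠ_) second)) ⟩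
        c *ᶠ T (g ⁻¹ *ᶠ x) +ᶠ c *ᶠ T (g *ᶠ x)        ≡⟨ *ᶠ-distribˡ-+ᶠ c _ _ ⟨
        c *ᶠ (T (g ⁻¹ *ᶠ x) +ᶠ T (g *ᶠ x))           ≡⟨ cong (c *ᶠ_) (trans (sym (T-+ (g ⁻¹ *ᶠ x) (g *ᶠ x))) (cong T (solve 3 (λ g h x → h :* x :+ g :* x := x :* (g :+ h)) refl g (g ⁻¹) x))) ⟩
        c *ᶠ T (x *ᶠ (g +ᶠ g ⁻¹))                    ∎

  κ-difference : ∀ x → x ≢ 0ᶠ → ℤ+ (κ c1 x) - ℤ+ (κ cm1 x) ≡ Q * re (χ₂ x ·c χ₂ (T x))
  -- Everything is doubled until the end, because both square roots of -s/t enter `re-quotient`.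
  κ-difference x x≢0 = ℤ.*-cancelˡ-≡ (ℤ+ 2) (ℤ+ (κ c1 x) - ℤ+ (κ cm1 x)) (Q * re (χ₂ x ·c χ₂ (T x))) (begin
    ℤ+ 2 * (ℤ+ (κ c1 x) - ℤ+ (κ cm1 x))
      ≡⟨ cong (ℤ+ 2 *_) as-sum ⟩
    ℤ+ 2 * sum {N} reTerm
      ≡⟨ *-distribˡ-sum {N} (ℤ+ 2) reTerm ⟩
    sum {N} (λ i → ℤ+ 2 * reTerm i)
      ≡⟨ sum-cong-≗ {N} (λ i → trans (re-quotient (T∈F _) (T∈F _)) (cong (e₋₁ *_) (to-salié x (toℕ i)))) ⟩
    sum {N} (λ i → e₋₁ * ∑ (λ g → coset i g * salié x g))
      ≡⟨ *-distribˡ-sum {N} e₋₁ (λ i → ∑ (λ g → coset i g * salié x g)) ⟨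
    e₋₁ * sum {N} (λ i → ∑ (λ g → coset i g * salié x g))
      ≡⟨ cong (e₋₁ *_) (∑-sum-swap (λ g i → coset i g * salié x g)) ⟨
    e₋₁ * ∑ (λ g → sum {N} (λ i → coset i g * salié x g))
      ≡⟨ cong (e₋₁ *_) (∑-cong (λ g → collapse g (g ≟ᶠ 0ᶠ))) ⟩
    e₋₁ * ∑ (salié x)
      ≡⟨ cong (e₋₁ *_) (∑-salié x≢0) ⟩
    e₋₁ * (ℤ+ 2 * (X x * (X 2ᶠ * X (T x) * Q)))
      ≡⟨ regroup e₋₁ (X x) (X 2ᶠ) (X (T x)) Q ⟩
    (e₋₁ * X 2ᶠ) * (ℤ+ 2 * (Q * (X x * X (T x))))
      ≡⟨ trans (cong (_* (ℤ+ 2 * (Q * (X x * X (T x))))) e₋₁*X2) (ℤ.*-identityˡ (ℤ+ 2 * (Q * (X x * X (T x))))) ⟩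
    ℤ+ 2 * (Q * (X x * X (T x)))
      ≡⟨ cong (λ s → ℤ+ 2 * (Q * s)) (re-square-· (χ₄ x) (χ₂ (T x))) ⟨
    ℤ+ 2 * (Q * re (χ₂ x ·c χ₂ (T x))) ∎)
    where
    open ≡-Reasoning
    term : ℕ → C4₀
    term i = χ₄ (T (μ ^ᶠ i *ᶠ x)) ·c conj (χ₄ (T ((μ ⁻¹) ^ᶠ i *ᶠ x)))

    reTerm : Fin N → ℤ
    reTerm i = re (term (toℕ i))

    coset : Fin N → Carrier → ℤ
    coset i g = 𝟙 (InF? (μ ^ᶠ toℕ i *ᶠ g))

    regroup : ∀ e a b c Q → e * (ℤ+ 2 * (a * (b * c * Q))) ≡ (e * b) * (ℤ+ 2 * (Q * (a * c)))
    regroup = ℤRing.solve-∀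

    as-sum : ℤ+ (κ c1 x) - ℤ+ (κ cm1 x) ≡ sum {N} reTerm
    as-sum = begin
      ℤ+ (κ c1 x) - ℤ+ (κ cm1 x)
        ≡⟨ cong₂ _-_ (length-filter-upTo (λ i → term i ≟C c1) id N) (length-filter-upTo (λ i → term i ≟C cm1) id N) ⟩
      sum {N} S₁ - sum {N} S₋₁
        ≡⟨ cong (sum {N} S₁ +_) (trans (sym (ℤ.-1*i≡-i (sum {N} S₋₁))) (*-distribˡ-sum {N} -1ℤ S₋₁)) ⟩
      sum {N} S₁ + sum {N} (λ i → -1ℤ * S₋₁ i)
        ≡⟨ ∑-distrib-+ S₁ (λ i → -1ℤ * S₋₁ i) ⟨
      sum {N} (λ i → S₁ i + -1ℤ * S₋₁ i)
        ≡⟨ sum-cong-≗ {N} (λ i → trans (cong (S₁ i +_) (ℤ.-1*i≡-i (S₋₁ i))) (re-𝟙 (term (toℕ i)))) ⟩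
      sum {N} reTerm ∎
      where
      S₁ S₋₁ : Fin N → ℤ
      S₁ i  = 𝟙 (term (toℕ i) ≟C c1)
      S₋₁ i = 𝟙 (term (toℕ i) ≟C cm1)

    collapse : ∀ g → Dec (g ≡ 0ᶠ) → sum {N} (λ i → coset i g * salié x g) ≡ salié x g
    collapse g (yes g≡0) = trans (sum-zero {N} (λ i → trans (cong (coset i g *_) zero-term) (ℤ.*-zeroʳ (coset i g)))) (sym zero-term)
      where
      zero-term : salié x g ≡ 0ℤ
      zero-term = cong (_* 𝟙 (T (x *ᶠ (g +ᶠ g ⁻¹)) ≟ᶠ 0ᶠ)) (trans (cong X g≡0) X-0)
    collapse g (no g≢0) = begin
      sum {N} (λ i → coset i g * salié x g)       ≡⟨ sum-cong-≗ {N} (λ i → ℤ.*-comm (coset i g) (salié x g)) ⟩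
      sum {N} (λ i → salié x g * coset i g)       ≡⟨ *-distribˡ-sum {N} (salié x g) (λ i → coset i g) ⟨
      salié x g * sum {N} (λ i → coset i g)       ≡⟨ cong (salié x g *_) (∑-coset g≢0) ⟩
      salié x g * 1ℤ                          ≡⟨ ℤ.*-identityʳ (salié x g) ⟩
      salié x g                               ∎

mainTheorem6 : (q : ℕ) → IsPrimePower q → q % 4 ≡ 1 → ¬ (q % 3 ≡ 1)
    → (E : FiniteField (q ^ 3)) (α : FiniteField.Carrier E) → FiniteField.IsPrimitive E α
    → (x : FiniteField.Carrier E) → x ≢ FiniteField.0ᶠ E
    → let open Characters q E α in
    ℤ+ (κ c1 x) - ℤ+ (κ cm1 x) ≡ ℤ+ q * re (χ₂ x ·c χ₂ (T x))
mainTheorem6 .(p ^ suc k) (p , k , pp , refl) q%4≡1 q%3≢1 E α prim =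
  -- The exponent `suc k *ℕ 3` exhibits the size q³ of E as a power of p, and iterating the p-th
  -- power map `suc k` times gives the additivity of x ↦ x^q.
  Cubic.κ-difference (p ^ suc k) 2≤q q%4≡1 q%3≢1 E α prim (Frobenius.frobenius^-+ E pp {suc k *ℕ 3} (ℕ.^-*-assoc p (suc k) 3) (suc k))
  where
  2≤q : 2 ≤ℕ p ^ suc k
  2≤q = ℕ.≤-trans (ℕ.nonTrivial⇒n>1 p {{prime⇒nonTrivial pp}}) (ℕ.m≤m*n p (p ^ k) {{ℕ.m^n≢0 p k {{ℕ.nonTrivial⇒nonZero p {{prime⇒nonTrivial pp}}}}}})
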